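{- Let $m\ge 3$ and let $a,b,c$ be integers with $1\le a\le b<\frac m2$ and $1\le c\le\frac m2$. Then $B_2(m;a,b,c)$ is a nut graph if and only if all of the following hold: (i) $m$ is coprime to each of $\gcd(a-b,a+b+c)$, $\gcd(a-b,a+b-c)$, $\gcd(a+b,a-b+c)$, $\gcd(a+b,a-b-c)$; (ii) if $v_2(m)>v_2(c)$, then neither $v_2(a)$ nor $v_2(b)$ equals $v_2(c)-1$; (iii) if $12\mid m$, then it is not the case that $a+b\equiv\pm2$, $a-b\equiv\pm 2$ and $c\equiv\pm3\pmod{12}$; (iv) if $30\mid m$, then none of the following holds modulo $30$: one of $a+b,a-b$ is $\equiv\pm3$, the other $\equiv\pm5$, and $c\equiv\pm6$; one of $a+b,a-b$ is $\equiv\pm3$, the other $\equiv\pm9$, and $c\equiv\pm10$; one of $a+b,a-b$ is $\equiv\pm5$, the other $\equiv\pm9$, and $c\equiv\pm12$. All $\pm$ signs are chosen independently (so there are $8$ forbidden triples $(a+b,a-b,c)$ mod $12$ in (iii) and $48$ mod $30$ in (iv)).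
   Context: A graph is a nut graph if $0$ is an adjacency eigenvalue of multiplicity one and a corresponding eigenvector has no zero entries. $B_2(m;a,b,c)$ is the graph on vertices $x_0,\dots,x_{m-1},y_0,\dots,y_{m-1}$ (indices mod $m$) with edges $x_ix_{i\pm a}$, $y_iy_{i\pm b}$, $x_iy_i$ and $x_iy_{i+c}$ for all $i$. For a nonzero integer $x$, $v_2(x)$ is the exponent of $2$ in the prime factorization of $|x|$. -}

module Defs where

open import Data.Bool using (Bool; true; false; _∨_; if_then_else_)
open import Data.Nat as ℕ using (ℕ; zero; suc; _^_)
open import Data.Nat.Divisibility using (_∣?_)
open import Data.Nat.GCD using (gcd)
open import Data.Fin using (Fin; toℕ)
import Data.Fin as Fin
open import Data.Sum using (_⊎_; inj₁; inj₂)
open import Data.Product using (_×_; Σ; ∃)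
open import Data.Integer as ℤ using (ℤ; +_; ∣_∣)
import Data.Integer.Divisibility as ℤD
open import Data.Rational as ℚ using (ℚ; 0ℚ; 1ℚ)
open import Relation.Nullary using (¬_; does)
open import Relation.Binary.PropositionalEquality using (_≡_; _≢_)

sumFin : (n : ℕ) → (Fin n → ℚ) → ℚ
sumFin zero    f = 0ℚ
sumFin (suc n) f = f Fin.zero ℚ.+ sumFin n (λ i → f (Fin.suc i))

Cong : ℕ → ℤ → ℤ → Set
Cong n x y = (+ n) ℤD.∣ (x ℤ.- y)

cong? : ℕ → ℤ → ℤ → Bool
cong? n x y = does (n ∣? ∣ x ℤ.- y ∣)

PM : ℕ → ℤ → ℕ → Set
PM n x r = Cong n x (+ r) ⊎ Cong n x (ℤ.- (+ r))

IsV2 : ℤ → ℕ → Set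
IsV2 x k = (+ (2 ^ k)) ℤD.∣ x × ¬ ((+ (2 ^ suc k)) ℤD.∣ x)

-- The graph B₂(m; a, b, c)
-- Vertices: inj₁ i = x_i, inj₂ i = y_i, i ∈ {0,…,m-1}.

Vert : ℕ → Set
Vert m = Fin m ⊎ Fin m

sumV : (m : ℕ) → (Vert m → ℚ) → ℚ
sumV m f = sumFin m (λ i → f (inj₁ i)) ℚ.+ sumFin m (λ i → f (inj₂ i))

pos : {m : ℕ} → Fin m → ℤ
pos i = + toℕ i

adjB : (m a b c : ℕ) → Vert m → Vert m → Bool
adjB m a b c (inj₁ i) (inj₁ j) =
  cong? m (pos j) (pos i ℤ.+ + a) ∨ cong? m (pos j) (pos i ℤ.- + a)
adjB m a b c (inj₂ i) (inj₂ j) =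
  cong? m (pos j) (pos i ℤ.+ + b) ∨ cong? m (pos j) (pos i ℤ.- + b)
adjB m a b c (inj₁ i) (inj₂ j) =
  cong? m (pos j) (pos i) ∨ cong? m (pos j) (pos i ℤ.+ + c)
adjB m a b c (inj₂ j) (inj₁ i) =
  cong? m (pos j) (pos i) ∨ cong? m (pos j) (pos i ℤ.+ + c)

adjMat : (m a b c : ℕ) → Vert m → Vert m → ℚ
adjMat m a b c u v = if adjB m a b c u v then 1ℚ else 0ℚ

InKernel : (m : ℕ) → (Vert m → Vert m → ℚ) → (Vert m → ℚ) → Set
InKernel m A x = ∀ u → sumV m (λ v → A u v ℚ.* x v) ≡ 0ℚ

-- 0 is an eigenvalue of A of multiplicity one (null space is spanned by
-- a single nonzero vector x) and that eigenvector has no zero entries.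
IsNut : (m : ℕ) → (Vert m → Vert m → ℚ) → Set
IsNut m A =
  Σ (Vert m → ℚ) λ x →
    InKernel m A x
    × (∀ v → x v ≢ 0ℚ)
    × (∀ y → InKernel m A y → ∃ λ (t : ℚ) → ∀ v → y v ≡ t ℚ.* x v)

IsNutB₂ : (m a b c : ℕ) → Set
IsNutB₂ m a b c = IsNut m (adjMat m a b c)

gcdℤ : ℤ → ℤ → ℕ
gcdℤ x y = gcd ∣ x ∣ ∣ y ∣

Forb30 : ℤ → ℤ → ℤ → ℕ → ℕ → ℕ → Set
Forb30 s d c p q r =
  ((PM 30 s p × PM 30 d q) ⊎ (PM 30 s q × PM 30 d p)) × PM 30 c r

{-# OPTIONS --safe #-}

-- Let T be the shift, s = a + b and d = a − b. Eliminating one half of a kernel vector shows that the graph is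
-- nut iff the only m-periodic u with T^s + T^{-s} + T^d + T^{-d} = 2 + T^c + T^{-c} on u are the constants.
--
-- For a prime p ≥ 9 the Frobenius congruence makes the conjugate equation, with ps, pd, pc for s, d, c, hold
-- modulo p on u. The difference g of its two sides is symmetric and a sum of 8 monomials: gᵏ u is divisible
-- by pᵏ but of size O(8ᵏ), so gᵏ u = 0 for large k, and then g u = 0 by symmetry. Hence the equation holds
-- with σs, σd, σc for every σ prime to 210. On a suitable multiple of u, averaging over these σ replaces
-- (T^e + T^{-e}) / 2 by the number t(e) = μ(N)/φ(N) if the order N of T^e divides 210, and by 0 otherwise. So
-- t(s) + t(d) = 1 + t(c), which has nine families of solutions; each of them violates one of the conditions.
-- Conversely, each violated condition provides an explicit nonconstant u.

module Submission where

open import Defs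
open import Algebra.Bundles using (CommutativeRing)
import Algebra.Properties.AbelianGroup as AbelianGroupProperties
import Algebra.Solver.Ring as RingSolver
open import Algebra.Solver.Ring.AlmostCommutativeRing
  using (fromCommutativeRing; _-Raw-AlmostCommutative⟶_)
open import Data.Bool as Bool using (Bool; true; false; _∨_; if_then_else_)
open import Data.Empty using (⊥)
open import Data.Fin as Fin using (Fin; toℕ; fromℕ<)
import Data.Fin.Properties as Finₚ
open import Data.Integer as ℤ using (ℤ; +_; -[1+_]; 0ℤ; 1ℤ; -1ℤ; ∣_∣)
import Data.Integer.DivMod as ℤDivMod
import Data.Integer.Divisibility.Signed as ℤS
import Data.Integer.Properties as ℤₚ
import Data.Integer.Solver as IntegerSolver
open import Data.List as List using (List; []; _∷_; _++_; cartesianProductWith)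
open import Data.List.Relation.Unary.All as All using (All; []; _∷_)
import Data.List.Relation.Unary.All.Properties as Allₚ
open import Data.List.Relation.Unary.Any as Any using (Any; here; there)
open import Data.Maybe using (Maybe; just; nothing)
open import Data.Nat as ℕ using (ℕ; zero; suc; _≤_; _<_; s≤s; z≤n)
open import Data.Nat.Combinatorics using (_C_; nCn≡1; nC1≡n; nCk+nC[k+1]≡[n+1]C[k+1])
open import Data.Nat.Coprimality using (Coprime; coprime?; coprime⇒gcd≡1)
open import Data.Nat.Divisibility
  using (_∣_; _∣?_; divides; ∣-refl; ∣-trans; ∣⇒≤; ∣1⇒≡1; _∣0; m∣m*n; n∣m*n; ∣m+n∣m⇒∣n)
open import Data.Nat.GCD using (gcd-GCD; gcd[m,n]∣m; gcd[m,n]∣n; module Bézout)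
open import Data.Nat.Induction using (<-rec)
open import Data.Nat.ListAction using (product)
open import Data.Nat.Primality using (Prime; prime?; ¬prime[1]; euclidsLemma; prime⇒nonZero)
open import Data.Nat.Primality.Factorisation using (PrimeFactorisation; factorise)
import Data.Nat.Properties as ℕₚ
import Data.Nat.Solver as NatSolver
open import Data.Product using (_×_; ∃; _,_; proj₁; proj₂)
open import Data.Rational as ℚ using (ℚ; 0ℚ; 1ℚ; ↥_; ↧_)
open import Data.Rational.Literals using (fromℤ)
import Data.Rational.Properties as ℚₚ
import Data.Rational.Solver as RationalSolver
import Data.Rational.Unnormalised as ℚᵘ
import Data.Rational.Unnormalised.Properties as ℚᵘₚ
open import Data.Sum as Sum using (_⊎_; inj₁; inj₂; [_,_])
open import Data.Vec using (Vec; []; _∷_; lookup)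
open import Function using (_∘_; mk⇔)
open import Function.Bundles using (_⇔_)
open import Level using (0ℓ)
import Relation.Binary.Reasoning.Setoid as SetoidReasoning
open import Relation.Binary.PropositionalEquality as ≡
  using (_≡_; _≢_; _≗_; refl; sym; trans; cong; cong₂; subst; module ≡-Reasoning)
open import Relation.Nullary using (¬_; Dec; does; yes; no; contradiction)
open import Relation.Nullary.Decidable
  using (True; toWitness; from-yes; dec-true; dec-false; map′; ¬?; _→-dec_; _×-dec_; _⊎-dec_)

-- No roots of unity occur explicitly. A periodic integer function `u` stands for the set of
-- characters in its Fourier support, and `p ≈[ u ] q` says that `p` and `q` agree at all of them.
-- The resulting ring is not a domain, so neither one eigenvalue nor a vanishing factor can be
-- chosen; instead `u` is replaced by a nonzero `⟦ r ⟧ u`, on which all earlier relations persist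
-- (`⊑`). For this reason what has to be remembered about `u`, such as being orthogonal to the
-- constants, is phrased as a relation between operators. The bound 8 says nothing about the primes
-- 2, 3, 5, 7, so only the σ prime to their product 210 are available. This still suffices: orders
-- that do not divide 210 average to 0, and there are finitely many others. The averaged equation
-- knows only the orders of T^s, T^d and T^c. To get back to residues, (i) shows that T itself has
-- order 12 or 30 in the isolated cases; the combinations of residues that have the right orders but
-- do not solve the equation are then excluded by the irrationality of the square root of 5.

private module ℤ+ = AbelianGroupProperties ℤₚ.+-0-abelianGroup

module ℤ-Solver where
  open IntegerSolver.+-*-Solver public
    using (solve; _:=_; _:+_; _:*_; _:-_; :-_) renaming (con to #)

-- Integer polynomials in the shift T on functions ℤ → ℤ; sh e is T^e.

infixl 6 _⊕_
infixl 7 _⊗_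

data Op : Set where
  sh  : ℤ → Op
  con : ℤ → Op
  _⊕_ : Op → Op → Op
  _⊗_ : Op → Op → Op

⟦_⟧ : Op → (ℤ → ℤ) → ℤ → ℤ
⟦ sh e ⟧  u i = u (i ℤ.+ e)
⟦ con k ⟧ u i = k ℤ.* u i
⟦ p ⊕ q ⟧ u i = ⟦ p ⟧ u i ℤ.+ ⟦ q ⟧ u i
⟦ p ⊗ q ⟧ u i = ⟦ p ⟧ (⟦ q ⟧ u) i

⟦⟧-cong : ∀ p {u v} → u ≗ v → ⟦ p ⟧ u ≗ ⟦ p ⟧ v
⟦⟧-cong (sh e)  h i = h (i ℤ.+ e)
⟦⟧-cong (con k) h i = cong (k ℤ.*_) (h i)
⟦⟧-cong (p ⊕ q) h i = cong₂ ℤ._+_ (⟦⟧-cong p h i) (⟦⟧-cong q h i)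
⟦⟧-cong (p ⊗ q) h i = ⟦⟧-cong p (⟦⟧-cong q h) i

⟦⟧-+ : ∀ p u v → ⟦ p ⟧ (λ i → u i ℤ.+ v i) ≗ (λ i → ⟦ p ⟧ u i ℤ.+ ⟦ p ⟧ v i)
⟦⟧-+ (sh e)  u v i = refl
⟦⟧-+ (con k) u v i = ℤₚ.*-distribˡ-+ k (u i) (v i)
⟦⟧-+ (p ⊕ q) u v i = trans (cong₂ ℤ._+_ (⟦⟧-+ p u v i) (⟦⟧-+ q u v i))
  (solve 4 (λ a b c d → (a :+ b) :+ (c :+ d) := (a :+ c) :+ (b :+ d)) refl
    (⟦ p ⟧ u i) (⟦ p ⟧ v i) (⟦ q ⟧ u i) (⟦ q ⟧ v i))
  where open ℤ-Solver
⟦⟧-+ (p ⊗ q) u v i = trans (⟦⟧-cong p (⟦⟧-+ q u v) i) (⟦⟧-+ p (⟦ q ⟧ u) (⟦ q ⟧ v) i)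

⟦⟧-* : ∀ p k u → ⟦ p ⟧ (λ i → k ℤ.* u i) ≗ (λ i → k ℤ.* ⟦ p ⟧ u i)
⟦⟧-* (sh e)  k u i = refl
⟦⟧-* (con l) k u i = solve 3 (λ a b c → a :* (b :* c) := b :* (a :* c)) refl l k (u i)
  where open ℤ-Solver
⟦⟧-* (p ⊕ q) k u i = trans (cong₂ ℤ._+_ (⟦⟧-* p k u i) (⟦⟧-* q k u i))
  (sym (ℤₚ.*-distribˡ-+ k (⟦ p ⟧ u i) (⟦ q ⟧ u i)))
⟦⟧-* (p ⊗ q) k u i = trans (⟦⟧-cong p (⟦⟧-* q k u) i) (⟦⟧-* p k (⟦ q ⟧ u) i)

+-swapʳ : ∀ i j k → i ℤ.+ j ℤ.+ k ≡ i ℤ.+ k ℤ.+ j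
+-swapʳ = solve 3 (λ i j k → i :+ j :+ k := i :+ k :+ j) refl
  where open ℤ-Solver

⟦⟧-shift : ∀ p e u → ⟦ p ⟧ (λ i → u (i ℤ.+ e)) ≗ (λ i → ⟦ p ⟧ u (i ℤ.+ e))
⟦⟧-shift (sh f)  e u i = cong u (+-swapʳ i f e)
⟦⟧-shift (con k) e u i = refl
⟦⟧-shift (p ⊕ q) e u i = cong₂ ℤ._+_ (⟦⟧-shift p e u i) (⟦⟧-shift q e u i)
⟦⟧-shift (p ⊗ q) e u i = trans (⟦⟧-cong p (⟦⟧-shift q e u) i) (⟦⟧-shift p e (⟦ q ⟧ u) i)

⟦⟧-comm : ∀ p q u → ⟦ p ⟧ (⟦ q ⟧ u) ≗ ⟦ q ⟧ (⟦ p ⟧ u)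
⟦⟧-comm (sh e)    q u i = sym (⟦⟧-shift q e u i)
⟦⟧-comm (con k)   q u i = sym (⟦⟧-* q k u i)
⟦⟧-comm (p₁ ⊕ p₂) q u i =
  trans (cong₂ ℤ._+_ (⟦⟧-comm p₁ q u i) (⟦⟧-comm p₂ q u i))
        (sym (⟦⟧-+ q (⟦ p₁ ⟧ u) (⟦ p₂ ⟧ u) i))
⟦⟧-comm (p₁ ⊗ p₂) q u i =
  trans (⟦⟧-cong p₁ (⟦⟧-comm p₂ q u) i) (⟦⟧-comm p₁ q (⟦ p₂ ⟧ u) i)

⟦⟧-0 : ∀ p {u} → (∀ i → u i ≡ 0ℤ) → ∀ i → ⟦ p ⟧ u i ≡ 0ℤ
⟦⟧-0 p {u} h i = trans (⟦⟧-cong p {v = λ j → 0ℤ ℤ.* u j} h i) (⟦⟧-* p 0ℤ u i)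

-- Equality of the actions on u only: this is ℤ[T, T⁻¹] modulo the annihilator of u.
infix 4 _≈[_]_
record _≈[_]_ (p : Op) (u : ℤ → ℤ) (q : Op) : Set where
  constructor mk
  field at : ⟦ p ⟧ u ≗ ⟦ q ⟧ u
open _≈[_]_ public

opRing : (ℤ → ℤ) → CommutativeRing 0ℓ 0ℓ
opRing u = record
  { Carrier = Op ; _≈_ = _≈[ u ]_ ; _+_ = _⊕_ ; _*_ = _⊗_
  ; -_ = con -1ℤ ⊗_ ; 0# = con 0ℤ ; 1# = con 1ℤ
  ; isCommutativeRing = record
    { isRing = record
      { +-isAbelianGroup = record
        { isGroup = record
          { isMonoid = record
            { isSemigroup = record
              { isMagma = record
                { isEquivalence = record
                  { refl  = mk λ _ → refl
                  ; sym   = λ e → mk λ i → sym (at e i)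
                  ; trans = λ e f → mk λ i → trans (at e i) (at f i) }
                ; ∙-cong = λ e f → mk λ i → cong₂ ℤ._+_ (at e i) (at f i) }
              ; assoc = λ p q r → mk λ i → ℤₚ.+-assoc (⟦ p ⟧ u i) (⟦ q ⟧ u i) (⟦ r ⟧ u i) }
            ; identity = (λ p → mk λ i → ℤₚ.+-identityˡ (⟦ p ⟧ u i))
                       , (λ p → mk λ i → ℤₚ.+-identityʳ (⟦ p ⟧ u i)) }
          ; inverse = (λ p → mk λ i → neg+ (⟦ p ⟧ u i) (u i))
                    , (λ p → mk λ i → +neg (⟦ p ⟧ u i) (u i))
          ; ⁻¹-cong = λ e → mk λ i → cong (-1ℤ ℤ.*_) (at e i) }
        ; comm = λ p q → mk λ i → ℤₚ.+-comm (⟦ p ⟧ u i) (⟦ q ⟧ u i) }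
      ; *-cong = λ {p} {p′} {q} {q′} e f → mk λ i →
          trans (⟦⟧-cong p (at f) i)
         (trans (⟦⟧-comm p q′ u i)
         (trans (⟦⟧-cong q′ (at e) i) (⟦⟧-comm q′ p′ u i)))
      ; *-assoc = λ p q r → mk λ i → refl
      ; *-identity = (λ p → mk λ i → ℤₚ.*-identityˡ (⟦ p ⟧ u i))
                   , (λ p → mk λ i → trans (⟦⟧-* p 1ℤ u i) (ℤₚ.*-identityˡ (⟦ p ⟧ u i)))
      ; distrib = (λ p q r → mk λ i → ⟦⟧-+ p (⟦ q ⟧ u) (⟦ r ⟧ u) i)
                , (λ p q r → mk λ i → refl) }
    ; *-comm = λ p q → mk λ i → ⟦⟧-comm p q u i } }
  where
  open ℤ-Solver
  neg+ : ∀ x y → -1ℤ ℤ.* x ℤ.+ x ≡ 0ℤ ℤ.* y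
  neg+ = solve 2 (λ x y → # -1ℤ :* x :+ x := # 0ℤ :* y) refl
  +neg : ∀ x y → x ℤ.+ -1ℤ ℤ.* x ≡ 0ℤ ℤ.* y
  +neg = solve 2 (λ x y → x :+ # -1ℤ :* x := # 0ℤ :* y) refl

module OpSolver (u : ℤ → ℤ) where
  con-homomorphism : ℤ.+-*-rawRing -Raw-AlmostCommutative⟶ fromCommutativeRing (opRing u)
  con-homomorphism = record
    { ⟦_⟧    = con
    ; +-homo = λ k l → mk λ i → ℤₚ.*-distribʳ-+ (u i) k l
    ; *-homo = λ k l → mk λ i → ℤₚ.*-assoc k l (u i)
    ; -‿homo = λ k → mk λ i → trans (cong (ℤ._* u i) (sym (ℤₚ.-1*i≡-i k))) (ℤₚ.*-assoc -1ℤ k (u i))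
    ; 0-homo = mk λ _ → refl
    ; 1-homo = mk λ _ → refl }

  con-≟ : ∀ k l → Maybe (con k ≈[ u ] con l)
  con-≟ k l with k ℤ.≟ l
  ... | yes refl = just (mk λ _ → refl)
  ... | no _     = nothing

  open RingSolver ℤ.+-*-rawRing (fromCommutativeRing (opRing u)) con-homomorphism con-≟ public
    using (solve; _:=_; _:+_; _:*_; _:-_; :-_) renaming (con to #)

sh-+ : ∀ {u} e f → sh (e ℤ.+ f) ≈[ u ] sh e ⊗ sh f
sh-+ {u} e f = mk λ i → cong u (sym (ℤₚ.+-assoc i e f))

sh-0 : ∀ {u} → sh 0ℤ ≈[ u ] con 1ℤ
sh-0 {u} = mk λ i → trans (cong u (ℤₚ.+-identityʳ i)) (sym (ℤₚ.*-identityˡ (u i)))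

sh-≡ : ∀ {u e f} → e ≡ f → sh e ≈[ u ] sh f
sh-≡ refl = mk λ _ → refl

infix 4 _⊑_
-- Passing to `v` keeps only part of the characters of `u`: the ring of `v` is a quotient of the
-- ring of `u`. This takes the place of choosing an eigenvalue.
_⊑_ : (u v : ℤ → ℤ) → Set
u ⊑ v = ∀ {p q} → p ≈[ u ] q → p ≈[ v ] q

-- `r` commutes with both operators, so multiples of `u` inherit its relations.
⊑-⟦⟧ : ∀ r u → u ⊑ ⟦ r ⟧ u
⊑-⟦⟧ r u {p} {q} e = mk λ i →
  trans (⟦⟧-comm p r u i) (trans (⟦⟧-cong r (at e) i) (⟦⟧-comm r q u i))

-- The Frobenius congruence

-- For `suc k` below a prime `suc n`, this identity pushes the prime into the binomial coefficient.
-- Induction along Pascal's rule avoids factorials and division.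
absorption : ∀ n k → suc k ℕ.* (suc n C suc k) ≡ suc n ℕ.* (n C k)
absorption zero    zero    = refl
absorption zero    (suc k) = ℕₚ.*-zeroʳ k
absorption (suc n) zero    = begin
  1 ℕ.* (suc (suc n) C 1) ≡⟨ ℕₚ.*-identityˡ _ ⟩
  suc (suc n) C 1         ≡⟨ nC1≡n (suc (suc n)) ⟩
  suc (suc n)             ≡⟨ ℕₚ.*-identityʳ _ ⟨
  suc (suc n) ℕ.* 1       ∎
  where open ≡-Reasoning
absorption (suc n) (suc k) = begin
  suc (suc k) ℕ.* (suc (suc n) C suc (suc k))
    ≡⟨ cong (suc (suc k) ℕ.*_) (nCk+nC[k+1]≡[n+1]C[k+1] (suc n) (suc k)) ⟨
  suc (suc k) ℕ.* (a ℕ.+ (suc n C suc (suc k)))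
    ≡⟨ ℕₚ.*-distribˡ-+ (suc (suc k)) a _ ⟩
  suc (suc k) ℕ.* a ℕ.+ suc (suc k) ℕ.* (suc n C suc (suc k))
    ≡⟨ cong (suc (suc k) ℕ.* a ℕ.+_) (absorption n (suc k)) ⟩
  a ℕ.+ suc k ℕ.* a ℕ.+ suc n ℕ.* (n C suc k)
    ≡⟨ cong (λ t → a ℕ.+ t ℕ.+ suc n ℕ.* (n C suc k)) (absorption n k) ⟩
  a ℕ.+ suc n ℕ.* (n C k) ℕ.+ suc n ℕ.* (n C suc k)
    ≡⟨ solve 4 (λ a n x y → a :+ n :* x :+ n :* y := a :+ n :* (x :+ y)) refl a (suc n) (n C k) (n C suc k) ⟩
  a ℕ.+ suc n ℕ.* ((n C k) ℕ.+ (n C suc k))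
    ≡⟨ cong (λ t → a ℕ.+ suc n ℕ.* t) (nCk+nC[k+1]≡[n+1]C[k+1] n k) ⟩
  suc (suc n) ℕ.* a ∎
  where
  open ≡-Reasoning
  open NatSolver.+-*-Solver using (solve; _:+_; _:*_; _:=_)
  a = suc n C suc k

prime∣pCk : ∀ {p k} → Prime p → suc k < p → p ∣ (p C suc k)
prime∣pCk {suc n} {k} pp k<p
  with euclidsLemma (suc k) (suc n C suc k) pp
         (subst (suc n ∣_) (sym (absorption n k)) (m∣m*n (n C k)))
... | inj₁ p∣k = contradiction (∣⇒≤ p∣k) (ℕₚ.<⇒≱ k<p)
... | inj₂ h   = h

module Frobenius {a ℓ} (R : CommutativeRing a ℓ) where
  open CommutativeRing R hiding (zero) renaming (refl to ≈-refl; sym to ≈-sym; trans to ≈-trans)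
  open import Algebra.Properties.Semiring.Exp semiring using (_^_; ^-congˡ) public
  open import Algebra.Properties.Semiring.Mult semiring
    using (×-assocˡ; ×-cong; ×-homo-1) renaming (_×_ to _·_) public
  open import Algebra.Properties.CommutativeMonoid.Mult +-commutativeMonoid using (×-distrib-+)
  open import Algebra.Properties.Semiring.Sum semiring using (sum; sum-init-last; sum-cong-≋)
  import Algebra.Properties.CommutativeSemiring.Binomial commutativeSemiring as Binomial
  open SetoidReasoning setoid

  zero-multiple : ∀ p → p · 0# ≈ 0#
  zero-multiple zero    = ≈-refl
  zero-multiple (suc p) = ≈-trans (+-identityˡ _) (zero-multiple p)

  sum-multiple : ∀ p {n} (t : Fin n → Carrier) → (∀ i → ∃ λ z → t i ≈ p · z) → ∃ λ z → sum t ≈ p · z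
  sum-multiple p {zero}  t h = 0# , ≈-sym (zero-multiple p)
  sum-multiple p {suc n} t h with h Fin.zero | sum-multiple p (λ i → t (Fin.suc i)) (λ i → h (Fin.suc i))
  ... | z , e | w , f = z + w , ≈-trans (+-cong e f) (≈-sym (×-distrib-+ z w p))

  -- All terms of the binomial expansion but the two outer ones are multiples of `p`; they supply
  -- `z`.
  frobenius-+ : ∀ {p} → Prime p → ∀ x y → ∃ λ z → (x + y) ^ p ≈ x ^ p + y ^ p + p · z
  frobenius-+ {0} pp x y = contradiction refl (ℕ.≢-nonZero⁻¹ 0 {{prime⇒nonZero pp}})
  frobenius-+ {p@(suc n)} pp x y = proj₁ middle , (begin
    (x + y) ^ p                      ≈⟨ Binomial.theorem p x y ⟩
    t Fin.zero + sum (λ i → t (Fin.suc i))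
                                     ≈⟨ +-congˡ (sum-init-last (λ i → t (Fin.suc i))) ⟩
    t Fin.zero + (sum mid + t (Fin.suc (Fin.fromℕ n)))
                                     ≈⟨ +-cong first (+-cong (proj₂ middle) last) ⟩
    y ^ p + (p · z + x ^ p)          ≈⟨ +-congˡ (+-comm (p · z) (x ^ p)) ⟩
    y ^ p + (x ^ p + p · z)          ≈⟨ +-assoc _ _ _ ⟨
    y ^ p + x ^ p + p · z            ≈⟨ +-congʳ (+-comm (y ^ p) (x ^ p)) ⟩
    x ^ p + y ^ p + p · z            ∎)
    where
    t : Fin (suc p) → Carrier
    t = Binomial.binomialTerm x y p
    mid : Fin n → Carrier
    mid i = t (Fin.suc (Fin.inject₁ i))
    middle : ∃ λ z → sum mid ≈ p · z
    middle = sum-multiple p mid λ i →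
      let k<p = s≤s (subst (_< n) (sym (Finₚ.toℕ-inject₁ i)) (Finₚ.toℕ<n i)) in
      multiple i (prime∣pCk pp k<p)
      where
      multiple : ∀ i → p ∣ (p C suc (toℕ (Fin.inject₁ i))) → ∃ λ z → mid i ≈ p · z
      multiple i (divides q e) = q · b , (begin
        mid i                                   ≈⟨ ×-cong e ≈-refl ⟩
        (q ℕ.* p) · b                           ≡⟨ cong (_· b) (ℕₚ.*-comm q p) ⟩
        (p ℕ.* q) · b                           ≈⟨ ×-assocˡ b p q ⟨
        p · (q · b)                             ∎)
        where b = Binomial.binomial x y p (Fin.suc (Fin.inject₁ i))
    z = proj₁ middle
    first : t Fin.zero ≈ y ^ p
    first = ≈-trans (×-homo-1 _) (*-identityˡ _)
    last : t (Fin.suc (Fin.fromℕ n)) ≈ x ^ p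
    last rewrite Finₚ.toℕ-fromℕ n | nCn≡1 (suc n) | ℕₚ.n∸n≡0 n =
      ≈-trans (×-homo-1 _) (*-identityʳ _)

  sumL : List Carrier → Carrier
  sumL = List.foldr _+_ 0#

  frobenius : ∀ {n} → Prime (suc n) → ∀ xs →
    ∃ λ z → sumL xs ^ suc n ≈ sumL (List.map (_^ suc n) xs) + suc n · z
  frobenius {n} pp [] = 0# , (begin
    0# * 0# ^ n       ≈⟨ zeroˡ (0# ^ n) ⟩
    0#                ≈⟨ +-identityˡ 0# ⟨
    0# + 0#           ≈⟨ +-congˡ (zero-multiple (suc n)) ⟨
    0# + suc n · 0#   ∎)
  frobenius {n} pp (x ∷ xs) = proj₁ rec + proj₁ two , (begin
    (x + sumL xs) ^ p                          ≈⟨ proj₂ two ⟩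
    x ^ p + sumL xs ^ p + p · proj₁ two        ≈⟨ +-congʳ (+-congˡ (proj₂ rec)) ⟩
    x ^ p + (s + p · proj₁ rec) + p · proj₁ two ≈⟨ +-congʳ (+-assoc _ _ _) ⟨
    x ^ p + s + p · proj₁ rec + p · proj₁ two  ≈⟨ +-assoc _ _ _ ⟩
    x ^ p + s + (p · proj₁ rec + p · proj₁ two) ≈⟨ +-congˡ (×-distrib-+ (proj₁ rec) (proj₁ two) p) ⟨
    x ^ p + s + p · (proj₁ rec + proj₁ two)    ∎)
    where
    p = suc n
    s = sumL (List.map (_^ p) xs)
    two = frobenius-+ pp x (sumL xs)
    rec = frobenius pp xs

module OpRing (u : ℤ → ℤ) where
  open CommutativeRing (opRing u) public
    using (setoid; *-cong; *-congˡ; *-congʳ; +-cong; +-congˡ; +-congʳ; *-assoc; *-comm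
          ; +-assoc; +-comm; *-identityˡ; *-identityʳ; +-identityˡ; +-identityʳ; zeroˡ; zeroʳ)
    renaming (refl to ≈-refl; sym to ≈-sym; trans to ≈-trans)

-- The cosine relation and its conjugates modulo a prime

cos : ℤ → Op
cos e = sh e ⊕ sh (ℤ.- e)

-- The constant 2 is written `cos 0ℤ`, so that both sides are sums of two cosines: one form of the
-- Frobenius congruence serves for both, and multiplying all exponents by σ leaves the constant in
-- place.
CosRel : (ℤ → ℤ) → ℤ → ℤ → ℤ → Set
CosRel u s d c = cos s ⊕ cos d ≈[ u ] cos 0ℤ ⊕ cos c

cosGap : ℤ → ℤ → ℤ → Op
cosGap s d c = cos s ⊕ cos d ⊕ con -1ℤ ⊗ (cos 0ℤ ⊕ cos c)

module _ {u : ℤ → ℤ} where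
  open OpRing u
  open OpSolver u
  open SetoidReasoning setoid
  private module Fr = Frobenius (opRing u)
  open Fr using (_^_; _·_; sumL)

  gap⇒CosRel : ∀ {s d c} → cosGap s d c ≈[ u ] con 0ℤ → CosRel u s d c
  gap⇒CosRel {s} {d} {c} h = begin
    x          ≈⟨ solve 2 (λ x y → x := (x :+ (# -1ℤ) :* y) :+ y) ≈-refl x y ⟩
    cosGap s d c ⊕ y ≈⟨ +-congʳ h ⟩
    con 0ℤ ⊕ y ≈⟨ +-identityˡ y ⟩
    y          ∎
    where
    x = cos s ⊕ cos d
    y = cos 0ℤ ⊕ cos c

  ·≈con : ∀ n z → n · z ≈[ u ] con (+ n) ⊗ z
  ·≈con zero    z = ≈-sym (zeroˡ z)
  ·≈con (suc n) z = begin
    z ⊕ n · z            ≈⟨ +-congˡ (·≈con n z) ⟩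
    z ⊕ con (+ n) ⊗ z    ≈⟨ solve 2 (λ z k → z :+ k :* z := (# 1ℤ :+ k) :* z) ≈-refl z (con (+ n)) ⟩
    (con 1ℤ ⊕ con (+ n)) ⊗ z ≈⟨ *-congʳ (mk λ i → sym (ℤₚ.*-distribʳ-+ (u i) 1ℤ (+ n))) ⟩
    con (+ suc n) ⊗ z    ∎

  sh-^ : ∀ n e → sh e ^ n ≈[ u ] sh (+ n ℤ.* e)
  sh-^ zero    e = ≈-sym sh-0
  sh-^ (suc n) e = begin
    sh e ⊗ sh e ^ n        ≈⟨ *-congˡ (sh-^ n e) ⟩
    sh e ⊗ sh (+ n ℤ.* e)  ≈⟨ sh-+ e (+ n ℤ.* e) ⟨
    sh (e ℤ.+ + n ℤ.* e)   ≈⟨ sh-≡ (sym (ℤₚ.suc-* (+ n) e)) ⟩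
    sh (+ suc n ℤ.* e)     ∎

  cos-^ : ∀ {n} → Prime (suc n) → ∀ e f → let p = suc n in
    ∃ λ z → (cos e ⊕ cos f) ^ p ≈[ u ] cos (+ p ℤ.* e) ⊕ cos (+ p ℤ.* f) ⊕ con (+ p) ⊗ z
  cos-^ {n} pp e f = proj₁ fr , (begin
    (cos e ⊕ cos f) ^ p
      ≈⟨ Fr.^-congˡ p (solve 4 (λ a b c d → (a :+ b) :+ (c :+ d) := a :+ (b :+ (c :+ (d :+ # 0ℤ))))
           ≈-refl (sh e) (sh (ℤ.- e)) (sh f) (sh (ℤ.- f))) ⟩
    sumL (sh e ∷ sh (ℤ.- e) ∷ sh f ∷ sh (ℤ.- f) ∷ []) ^ p
      ≈⟨ proj₂ fr ⟩
    sh e ^ p ⊕ (sh (ℤ.- e) ^ p ⊕ (sh f ^ p ⊕ (sh (ℤ.- f) ^ p ⊕ con 0ℤ))) ⊕ p · z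
      ≈⟨ +-cong (+-cong (sh-^ p e) (+-cong (-sh-^ e) (+-cong (sh-^ p f) (+-congʳ (-sh-^ f))))) (·≈con p z) ⟩
    sh (P ℤ.* e) ⊕ (sh (ℤ.- (P ℤ.* e)) ⊕ (sh (P ℤ.* f) ⊕ (sh (ℤ.- (P ℤ.* f)) ⊕ con 0ℤ))) ⊕ con P ⊗ z
      ≈⟨ solve 5 (λ a b c d x → a :+ (b :+ (c :+ (d :+ # 0ℤ))) :+ x := (a :+ b) :+ (c :+ d) :+ x) ≈-refl
           (sh (P ℤ.* e)) (sh (ℤ.- (P ℤ.* e))) (sh (P ℤ.* f)) (sh (ℤ.- (P ℤ.* f))) (con P ⊗ z) ⟩
    cos (P ℤ.* e) ⊕ cos (P ℤ.* f) ⊕ con P ⊗ z ∎)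
    where
    p = suc n
    P = + p
    fr = Fr.frobenius pp (sh e ∷ sh (ℤ.- e) ∷ sh f ∷ sh (ℤ.- f) ∷ [])
    z = proj₁ fr
    -sh-^ : ∀ e → sh (ℤ.- e) ^ p ≈[ u ] sh (ℤ.- (P ℤ.* e))
    -sh-^ e = ≈-trans (sh-^ p (ℤ.- e)) (sh-≡ (sym (ℤₚ.neg-distribʳ-* P e)))

  -- The p-th powers of the two sides agree, and each is the conjugate side up to a multiple of p;
  -- the two error terms make up the quotient.
  CosRel⇒multiple : ∀ {n s d c} → Prime (suc n) → CosRel u s d c → let P = + suc n in
    ∃ λ z → cosGap (P ℤ.* s) (P ℤ.* d) (P ℤ.* c) ≈[ u ] con P ⊗ z
  CosRel⇒multiple {n} {s} {d} {c} pp h = r ⊕ con -1ℤ ⊗ l , (begin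
    x ⊕ con -1ℤ ⊗ (cos 0ℤ ⊕ cos (P ℤ.* c))
      ≈⟨ +-congˡ (*-congˡ (+-congʳ (≈-sym cos0))) ⟩
    x ⊕ con -1ℤ ⊗ y
      ≈⟨ solve 4 (λ x y p l → x :+ (# -1ℤ) :* y := (x :+ p :* l) :+ (# -1ℤ) :* (y :+ p :* l))
           ≈-refl x y (con P) l ⟩
    (x ⊕ con P ⊗ l) ⊕ con -1ℤ ⊗ (y ⊕ con P ⊗ l)
      ≈⟨ +-congʳ xy ⟩
    (y ⊕ con P ⊗ r) ⊕ con -1ℤ ⊗ (y ⊕ con P ⊗ l)
      ≈⟨ solve 4 (λ y p l r → (y :+ p :* r) :+ (# -1ℤ) :* (y :+ p :* l) := p :* (r :+ (# -1ℤ) :* l))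
           ≈-refl y (con P) l r ⟩
    con P ⊗ (r ⊕ con -1ℤ ⊗ l) ∎)
    where
    P = + suc n
    l = proj₁ (cos-^ pp s d)
    r = proj₁ (cos-^ pp 0ℤ c)
    x = cos (P ℤ.* s) ⊕ cos (P ℤ.* d)
    y = cos (P ℤ.* 0ℤ) ⊕ cos (P ℤ.* c)
    xy : x ⊕ con P ⊗ l ≈[ u ] y ⊕ con P ⊗ r
    xy = ≈-trans (≈-sym (proj₂ (cos-^ pp s d)))
           (≈-trans (Fr.^-congˡ (suc n) h) (proj₂ (cos-^ pp 0ℤ c)))
    cos0 : cos (P ℤ.* 0ℤ) ≈[ u ] cos 0ℤ
    cos0 = +-cong (sh-≡ (ℤₚ.*-zeroʳ P)) (sh-≡ (cong ℤ.-_ (ℤₚ.*-zeroʳ P)))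

-- Periods and sums over a period

Fixes : (ℤ → ℤ) → ℤ → Set
Fixes u e = sh e ≈[ u ] con 1ℤ

module _ {u : ℤ → ℤ} where
  open OpRing u
  open SetoidReasoning setoid

  fixes-at : ∀ {e} → Fixes u e → ∀ i → u (i ℤ.+ e) ≡ u i
  fixes-at h i = trans (at h i) (ℤₚ.*-identityˡ (u i))

  fixes-+ : ∀ {e f} → Fixes u e → Fixes u f → Fixes u (e ℤ.+ f)
  fixes-+ {e} {f} h k = ≈-trans (sh-+ e f) (≈-trans (*-cong h k) (*-identityˡ (con 1ℤ)))

  fixes-neg : ∀ {e} → Fixes u e → Fixes u (ℤ.- e)
  fixes-neg {e} h = begin
    sh (ℤ.- e)          ≈⟨ *-identityˡ _ ⟨
    con 1ℤ ⊗ sh (ℤ.- e) ≈⟨ *-congʳ h ⟨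
    sh e ⊗ sh (ℤ.- e)   ≈⟨ sh-+ e (ℤ.- e) ⟨
    sh (e ℤ.+ ℤ.- e)    ≈⟨ sh-≡ (ℤₚ.+-inverseʳ e) ⟩
    sh 0ℤ               ≈⟨ sh-0 ⟩
    con 1ℤ              ∎

  fixes-ℕ* : ∀ n {e} → Fixes u e → Fixes u (+ n ℤ.* e)
  fixes-ℕ* zero    h = sh-0
  fixes-ℕ* (suc n) {e} h =
    ≈-trans (sh-≡ (ℤₚ.suc-* (+ n) e)) (fixes-+ h (fixes-ℕ* n h))

  fixes-* : ∀ k {e} → Fixes u e → Fixes u (k ℤ.* e)
  fixes-* (+ n)      h = fixes-ℕ* n h
  fixes-* -[1+ n ] {e} h = ≈-trans (sh-≡ (sym (ℤₚ.neg-distribˡ-* (+ suc n) e)))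
    (fixes-neg (fixes-ℕ* (suc n) h))

  periodic-rec : ∀ {m} .{{_ : ℕ.NonZero m}} → Fixes u (+ m) → (P : ℤ → Set) →
    (∀ j → j < m → P (u (+ j))) → ∀ i → P (u i)
  periodic-rec {m} h P base i =
    subst P (sym (trans (cong u (ℤDivMod.a≡a%ℕn+[a/ℕn]*n i m))
                        (fixes-at (fixes-* (i ℤDivMod./ℕ m) h) (+ (i ℤDivMod.%ℕ m)))))
      (base (i ℤDivMod.%ℕ m) (ℤDivMod.n%ℕd<d i m))

sumTo : ℕ → (ℤ → ℤ) → ℤ
sumTo zero    z = 0ℤ
sumTo (suc n) z = sumTo n z ℤ.+ z (+ n)

sumTo-cong : ∀ n {y z} → y ≗ z → sumTo n y ≡ sumTo n z
sumTo-cong zero    h = refl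
sumTo-cong (suc n) h = cong₂ ℤ._+_ (sumTo-cong n h) (h (+ n))

sumTo-+ : ∀ n y z → sumTo n (λ i → y i ℤ.+ z i) ≡ sumTo n y ℤ.+ sumTo n z
sumTo-+ zero    y z = refl
sumTo-+ (suc n) y z = trans (cong (ℤ._+ (y (+ n) ℤ.+ z (+ n))) (sumTo-+ n y z))
  (solve 4 (λ a b c d → a :+ b :+ (c :+ d) := a :+ c :+ (b :+ d)) refl
    (sumTo n y) (sumTo n z) (y (+ n)) (z (+ n)))
  where open ℤ-Solver

sumTo-0 : ∀ n {z} → (∀ i → z i ≡ 0ℤ) → sumTo n z ≡ 0ℤ
sumTo-0 zero    h = refl
sumTo-0 (suc n) h = cong₂ ℤ._+_ (sumTo-0 n h) (h (+ n))

sumTo-step : ∀ n z → sumTo n (λ i → z (i ℤ.+ 1ℤ)) ℤ.+ z 0ℤ ≡ sumTo n z ℤ.+ z (+ n)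
sumTo-step zero    z = refl
sumTo-step (suc n) z = trans (+-swapʳ (sumTo n (λ i → z (i ℤ.+ 1ℤ))) (z (+ n ℤ.+ 1ℤ)) (z 0ℤ))
  (cong₂ ℤ._+_ (sumTo-step n z) (cong z (ℤₚ.+-comm (+ n) 1ℤ)))

-- Positive definiteness of the inner product below; the sum is moved to ℕ, where the summands of a
-- vanishing sum vanish.
sumTo-squares : ∀ n (z : ℤ → ℤ) → sumTo n (λ i → z i ℤ.* z i) ≡ 0ℤ → ∀ j → j < n → z (+ j) ≡ 0ℤ
sumTo-squares n z h j j<n = go n h j j<n
  where
  square-nonneg : ∀ x → + (∣ x ∣ ℕ.* ∣ x ∣) ≡ x ℤ.* x
  square-nonneg (+ n)      = ℤₚ.pos-* n n
  square-nonneg -[1+ n ]   = refl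
  sq : ℕ → ℕ
  sq zero    = 0
  sq (suc n) = sq n ℕ.+ ∣ z (+ n) ∣ ℕ.* ∣ z (+ n) ∣
  sq≡ : ∀ n → + sq n ≡ sumTo n (λ i → z i ℤ.* z i)
  sq≡ zero    = refl
  sq≡ (suc n) = cong₂ ℤ._+_ (sq≡ n) (square-nonneg (z (+ n)))
  square-0 : ∀ x → x ℕ.* x ≡ 0 → x ≡ 0
  square-0 zero e = refl
  sq-0 : ∀ n → sq n ≡ 0 → ∀ j → j < n → z (+ j) ≡ 0ℤ
  sq-0 (suc n) e j j<n with ℕₚ.m≤n⇒m<n∨m≡n (ℕₚ.≤-pred j<n)
  ... | inj₁ lt   = sq-0 n (ℕₚ.m+n≡0⇒m≡0 (sq n) e) j lt
  ... | inj₂ refl = ℤₚ.∣i∣≡0⇒i≡0 (square-0 ∣ z (+ n) ∣ (ℕₚ.m+n≡0⇒n≡0 (sq n) e))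
  go : ∀ n → sumTo n (λ i → z i ℤ.* z i) ≡ 0ℤ → ∀ j → j < n → z (+ j) ≡ 0ℤ
  go n h = sq-0 n (ℤₚ.+-injective (trans (sq≡ n) h))

-- Adjoint operators and symmetric nilpotents

infix 10 _†
-- The adjoint for `⟨_,_⟩` on periodic functions, that is, complex conjugation T ↦ T⁻¹. Reversing
-- products makes `adjoint` a direct induction.
_† : Op → Op
sh e † = sh (ℤ.- e)
con k † = con k
(p ⊕ q) † = p † ⊕ q †
(p ⊗ q) † = q † ⊗ p †

module _ (m : ℕ) where

  sumTo-shift : ∀ e {z} → Fixes z (+ m) → sumTo m (λ i → z (i ℤ.+ e)) ≡ sumTo m z
  sumTo-shift e {z} per = go e z per
    where
    one : ∀ z → Fixes z (+ m) → sumTo m (λ i → z (i ℤ.+ 1ℤ)) ≡ sumTo m z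
    one z per = ℤ+.∙-cancelʳ (z 0ℤ) _ _
      (trans (sumTo-step m z) (cong (λ t → sumTo m z ℤ.+ t)
        (trans (cong z (sym (ℤₚ.+-identityˡ (+ m)))) (fixes-at per 0ℤ))))
    nat : ∀ n z → Fixes z (+ m) → sumTo m (λ i → z (i ℤ.+ + n)) ≡ sumTo m z
    nat zero    z per = sumTo-cong m (λ i → cong z (ℤₚ.+-identityʳ i))
    nat (suc n) z per =
      trans (sumTo-cong m (λ i → cong z (sym (ℤₚ.+-assoc i 1ℤ (+ n)))))
        (trans (one (⟦ sh (+ n) ⟧ z) (⊑-⟦⟧ (sh (+ n)) z per)) (nat n z per))
    go : ∀ e z → Fixes z (+ m) → sumTo m (λ i → z (i ℤ.+ e)) ≡ sumTo m z
    go (+ n)      z per = nat n z per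
    go -[1+ n ] z per =
      trans (sym (nat (suc n) (⟦ sh -[1+ n ] ⟧ z) (⊑-⟦⟧ (sh -[1+ n ]) z per)))
        (sumTo-cong m (λ i → cong z (trans (ℤₚ.+-assoc i (+ suc n) -[1+ n ])
          (trans (cong (λ t → i ℤ.+ t) (ℤₚ.+-inverseʳ (+ suc n))) (ℤₚ.+-identityʳ i)))))

  ⟨_,_⟩ : (ℤ → ℤ) → (ℤ → ℤ) → ℤ
  ⟨ v , w ⟩ = sumTo m (λ i → v i ℤ.* w i)

  fixes-product : ∀ {v w e} → Fixes v e → Fixes w e → Fixes (λ i → v i ℤ.* w i) e
  fixes-product h k = mk λ i → trans (cong₂ ℤ._*_ (fixes-at h i) (fixes-at k i))
    (sym (ℤₚ.*-identityˡ _))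

  adjoint : ∀ p {v w} → Fixes v (+ m) → Fixes w (+ m) → ⟨ ⟦ p ⟧ v , w ⟩ ≡ ⟨ v , ⟦ p † ⟧ w ⟩
  adjoint (sh e) {v} {w} pv pw =
    trans (sumTo-cong m (λ i → cong (λ t → v (i ℤ.+ e) ℤ.* w t)
             (sym (trans (ℤₚ.+-assoc i e (ℤ.- e))
               (trans (cong (λ t → i ℤ.+ t) (ℤₚ.+-inverseʳ e)) (ℤₚ.+-identityʳ i))))))
      (sumTo-shift e {λ i → v i ℤ.* w (i ℤ.+ ℤ.- e)}
        (fixes-product pv (⊑-⟦⟧ (sh (ℤ.- e)) w pw)))
  adjoint (con k) {v} {w} pv pw = sumTo-cong m λ i →
    solve 3 (λ k x y → k :* x :* y := x :* (k :* y)) refl k (v i) (w i)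
    where open ℤ-Solver
  adjoint (p ⊕ q) {v} {w} pv pw = begin
    ⟨ ⟦ p ⊕ q ⟧ v , w ⟩
      ≡⟨ sumTo-cong m (λ i → ℤₚ.*-distribʳ-+ (w i) (⟦ p ⟧ v i) (⟦ q ⟧ v i)) ⟩
    sumTo m (λ i → ⟦ p ⟧ v i ℤ.* w i ℤ.+ ⟦ q ⟧ v i ℤ.* w i)
      ≡⟨ sumTo-+ m _ _ ⟩
    ⟨ ⟦ p ⟧ v , w ⟩ ℤ.+ ⟨ ⟦ q ⟧ v , w ⟩
      ≡⟨ cong₂ ℤ._+_ (adjoint p pv pw) (adjoint q pv pw) ⟩
    ⟨ v , ⟦ p † ⟧ w ⟩ ℤ.+ ⟨ v , ⟦ q † ⟧ w ⟩
      ≡⟨ sumTo-+ m _ _ ⟨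
    sumTo m (λ i → v i ℤ.* ⟦ p † ⟧ w i ℤ.+ v i ℤ.* ⟦ q † ⟧ w i)
      ≡⟨ sumTo-cong m (λ i → ℤₚ.*-distribˡ-+ (v i) (⟦ p † ⟧ w i) (⟦ q † ⟧ w i)) ⟨
    ⟨ v , ⟦ (p ⊕ q) † ⟧ w ⟩ ∎
    where open ≡-Reasoning
  adjoint (p ⊗ q) {v} {w} pv pw =
    trans (adjoint p (⊑-⟦⟧ q v pv) pw) (adjoint q pv (⊑-⟦⟧ (p †) w pw))

  module _ .{{_ : ℕ.NonZero m}} {g : Op} (sa : ∀ {u} → g † ≈[ u ] g) where

    -- As `g` is its own adjoint, the squared length of g w is ⟨w, g g w⟩ = 0.
    symmetric-reduced : ∀ {w} → Fixes w (+ m) →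
      (∀ i → ⟦ g ⊗ g ⟧ w i ≡ 0ℤ) → ∀ i → ⟦ g ⟧ w i ≡ 0ℤ
    symmetric-reduced {w} pw h = periodic-rec pgw (_≡ 0ℤ) (sumTo-squares m (⟦ g ⟧ w) (begin
      ⟨ ⟦ g ⟧ w , ⟦ g ⟧ w ⟩       ≡⟨ adjoint g pw pgw ⟩
      ⟨ w , ⟦ g † ⟧ (⟦ g ⟧ w) ⟩   ≡⟨ sumTo-0 m (λ i → trans
                                       (cong (w i ℤ.*_) (trans (at (sa {⟦ g ⟧ w}) i) (h i)))
                                       (ℤₚ.*-zeroʳ (w i))) ⟩
      0ℤ                          ∎))
      where
      open ≡-Reasoning
      pgw : Fixes (⟦ g ⟧ w) (+ m)
      pgw = ⊑-⟦⟧ g w pw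

infixr 8 _↑_
_↑_ : Op → ℕ → Op
p ↑ zero  = con 1ℤ
p ↑ suc k = p ⊗ p ↑ k

-- Each use of `symmetric-reduced`, on the function g^k u, lowers the exponent by one. The extra
-- factor `g` at the start covers the exponent 0.
symmetric-nilpotent : ∀ m .{{_ : ℕ.NonZero m}} g → (∀ {u} → g † ≈[ u ] g) → ∀ {u} → Fixes u (+ m) →
  ∀ k → g ↑ k ≈[ u ] con 0ℤ → g ≈[ u ] con 0ℤ
symmetric-nilpotent m g sa {u} pu k h = go k (≈-trans (*-congˡ h) (zeroʳ g))
  where
  open OpRing u
  go : ∀ k → g ↑ suc k ≈[ u ] con 0ℤ → g ≈[ u ] con 0ℤ
  go zero    h = ≈-trans (≈-sym (*-identityʳ g)) h
  go (suc k) h = go k (mk (symmetric-reduced m {g} sa {⟦ g ↑ k ⟧ u} (⊑-⟦⟧ (g ↑ k) u pu) (at h)))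

-- Size of an operator against divisibility by a prime

norm : Op → ℕ
norm (sh e)  = 1
norm (con k) = ∣ k ∣
norm (p ⊕ q) = norm p ℕ.+ norm q
norm (p ⊗ q) = norm p ℕ.* norm q

-- `norm` adds the absolute values of the coefficients of the expression as written, without
-- collecting terms. It thus bounds the action in the supremum norm and is exactly multiplicative.
norm-bound : ∀ p {u β} → (∀ i → ∣ u i ∣ ≤ β) → ∀ i → ∣ ⟦ p ⟧ u i ∣ ≤ norm p ℕ.* β
norm-bound (sh e)  {β = β} h i = ℕₚ.≤-trans (h (i ℤ.+ e)) (ℕₚ.≤-reflexive (sym (ℕₚ.*-identityˡ β)))
norm-bound (con k) {u} h i = ℕₚ.≤-trans (ℕₚ.≤-reflexive (ℤₚ.∣i*j∣≡∣i∣*∣j∣ k (u i)))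
  (ℕₚ.*-monoʳ-≤ ∣ k ∣ (h i))
norm-bound (p ⊕ q) {u} {β} h i = begin
  ∣ ⟦ p ⟧ u i ℤ.+ ⟦ q ⟧ u i ∣       ≤⟨ ℤₚ.∣i+j∣≤∣i∣+∣j∣ (⟦ p ⟧ u i) (⟦ q ⟧ u i) ⟩
  ∣ ⟦ p ⟧ u i ∣ ℕ.+ ∣ ⟦ q ⟧ u i ∣   ≤⟨ ℕₚ.+-mono-≤ (norm-bound p h i) (norm-bound q h i) ⟩
  norm p ℕ.* β ℕ.+ norm q ℕ.* β     ≡⟨ ℕₚ.*-distribʳ-+ β (norm p) (norm q) ⟨
  (norm p ℕ.+ norm q) ℕ.* β         ∎
  where open ℕₚ.≤-Reasoning
norm-bound (p ⊗ q) {u} {β} h i = ℕₚ.≤-trans (norm-bound p (norm-bound q h) i)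
  (ℕₚ.≤-reflexive (sym (ℕₚ.*-assoc (norm p) (norm q) β)))

norm-↑ : ∀ p k → norm (p ↑ k) ≡ norm p ℕ.^ k
norm-↑ p zero    = refl
norm-↑ p (suc k) = cong (norm p ℕ.*_) (norm-↑ p k)

multiple-↑ : ∀ {u n g z} → g ≈[ u ] con (+ n) ⊗ z → ∀ k → g ↑ k ≈[ u ] con (+ (n ℕ.^ k)) ⊗ z ↑ k
multiple-↑ {u} h zero = ≈-sym (*-identityˡ (con 1ℤ))
  where open OpRing u
multiple-↑ {u} {n} {g} {z} h (suc k) = begin
  g ⊗ g ↑ k                                       ≈⟨ *-cong h (multiple-↑ h k) ⟩
  (con (+ n) ⊗ z) ⊗ (con (+ (n ℕ.^ k)) ⊗ z ↑ k)   ≈⟨ solve 4 (λ a b c d → (a :* b) :* (c :* d) := (a :* c) :* (b :* d))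
                                                      ≈-refl (con (+ n)) z (con (+ (n ℕ.^ k))) (z ↑ k) ⟩
  (con (+ n) ⊗ con (+ (n ℕ.^ k))) ⊗ z ↑ suc k     ≈⟨ *-congʳ (mk λ i → sym (trans
                                                      (cong (ℤ._* u i) (ℤₚ.pos-* n (n ℕ.^ k)))
                                                      (ℤₚ.*-assoc (+ n) (+ (n ℕ.^ k)) (u i)))) ⟩
  con (+ (n ℕ.^ suc k)) ⊗ z ↑ suc k               ∎
  where
  open OpRing u
  open OpSolver u
  open SetoidReasoning setoid

periodic-bounded : ∀ {m u} .{{_ : ℕ.NonZero m}} → Fixes u (+ m) → ∃ λ β → ∀ i → ∣ u i ∣ ≤ β
periodic-bounded {m} {u} pu = bound m , periodic-rec pu (λ x → ∣ x ∣ ≤ bound m) (below m)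
  where
  bound : ℕ → ℕ
  bound zero    = 0
  bound (suc n) = bound n ℕ.+ ∣ u (+ n) ∣
  below : ∀ n j → j < n → ∣ u (+ j) ∣ ≤ bound n
  below (suc n) j j<n with ℕₚ.m≤n⇒m<n∨m≡n (ℕₚ.≤-pred j<n)
  ... | inj₁ lt   = ℕₚ.≤-trans (below n j lt) (ℕₚ.m≤m+n (bound n) _)
  ... | inj₂ refl = ℕₚ.m≤n+m _ (bound n)

-- Bernoulli's inequality: (9/8)^k ≥ 1 + k/8, which is 1 + β for this `k`.
8^k*β<9^k : ∀ β → let k = 8 ℕ.* β in 8 ℕ.^ k ℕ.* β < 9 ℕ.^ k
8^k*β<9^k β = ℕₚ.<-≤-trans (ℕₚ.*-monoʳ-< (8 ℕ.^ k) {{ℕₚ.m^n≢0 8 k}} (ℕₚ.n<1+n β))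
  (ℕₚ.*-cancelˡ-≤ 8 (ℕₚ.≤-trans (ℕₚ.≤-reflexive rearrange) (bernoulli k)))
  where
  open NatSolver.+-*-Solver
  k = 8 ℕ.* β
  rearrange : 8 ℕ.* (8 ℕ.^ k ℕ.* suc β) ≡ 8 ℕ.^ k ℕ.* (8 ℕ.+ k)
  rearrange = solve 2 (λ x b → con 8 :* (x :* (con 1 :+ b)) := x :* (con 8 :+ con 8 :* b)) refl (8 ℕ.^ k) β
  bernoulli : ∀ k → 8 ℕ.^ k ℕ.* (8 ℕ.+ k) ≤ 8 ℕ.* 9 ℕ.^ k
  bernoulli zero    = ℕₚ.≤-refl
  bernoulli (suc k) = R.begin
    8 ℕ.* x ℕ.* (8 ℕ.+ suc k)            R.≤⟨ ℕₚ.m≤m+n _ (x ℕ.* k) ⟩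
    8 ℕ.* x ℕ.* (8 ℕ.+ suc k) ℕ.+ x ℕ.* k
      R.≡⟨ solve 2 (λ x k → con 8 :* x :* (con 9 :+ k) :+ x :* k := con 9 :* (x :* (con 8 :+ k))) refl x k ⟩
    9 ℕ.* (x ℕ.* (8 ℕ.+ k))              R.≤⟨ ℕₚ.*-monoʳ-≤ 9 (bernoulli k) ⟩
    9 ℕ.* (8 ℕ.* 9 ℕ.^ k)
      R.≡⟨ solve 1 (λ y → con 9 :* (con 8 :* y) := con 8 :* (con 9 :* y)) refl (9 ℕ.^ k) ⟩
    8 ℕ.* 9 ℕ.^ suc k                    R.∎
    where
    module R = ℕₚ.≤-Reasoning
    x = 8 ℕ.^ k

-- All conjugates of an eigenvalue of g are at most 8 in size, so one divisible by p ≥ 9 has norm less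
-- than 1 after division by p; here the norm is replaced by the growth of the powers of g.
multiple-vanishes : ∀ {m} .{{_ : ℕ.NonZero m}} {u p} → Fixes u (+ m) → 9 ≤ p →
  ∀ g → norm g ≡ 8 → (∀ {v} → g † ≈[ v ] g) → ∀ {z} → g ≈[ u ] con (+ p) ⊗ z → g ≈[ u ] con 0ℤ
multiple-vanishes {m} {u} {p} pu 9≤p g ng sa {z} h with periodic-bounded {m} pu
... | β , bd = symmetric-nilpotent m g sa pu k (mk λ i → zero-at i)
  where
  k = 8 ℕ.* β
  zero-at : ∀ i → ⟦ g ↑ k ⟧ u i ≡ 0ℤ
  small : ∀ w → p ℕ.^ k ℕ.* ∣ w ∣ < p ℕ.^ k → w ≡ 0ℤ
  small w lt = ℤₚ.∣i∣≡0⇒i≡0 (ℕₚ.n<1⇒n≡0 (ℕₚ.*-cancelˡ-< (p ℕ.^ k) ∣ w ∣ 1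
    (ℕₚ.<-≤-trans lt (ℕₚ.≤-reflexive (sym (ℕₚ.*-identityʳ (p ℕ.^ k)))))))
  value : ∀ i → ⟦ g ↑ k ⟧ u i ≡ + (p ℕ.^ k) ℤ.* ⟦ z ↑ k ⟧ u i
  value i = at (multiple-↑ h k) i
  zero-at i = trans (value i) (trans (cong (+ (p ℕ.^ k) ℤ.*_) (small (⟦ z ↑ k ⟧ u i) (begin-strict
    p ℕ.^ k ℕ.* ∣ ⟦ z ↑ k ⟧ u i ∣            ≡⟨ ℤₚ.∣i*j∣≡∣i∣*∣j∣ (+ (p ℕ.^ k)) (⟦ z ↑ k ⟧ u i) ⟨
    ∣ + (p ℕ.^ k) ℤ.* ⟦ z ↑ k ⟧ u i ∣        ≡⟨ cong ∣_∣ (value i) ⟨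
    ∣ ⟦ g ↑ k ⟧ u i ∣                        ≤⟨ norm-bound (g ↑ k) bd i ⟩
    norm (g ↑ k) ℕ.* β                       ≡⟨ cong (ℕ._* β) (trans (norm-↑ g k) (cong (ℕ._^ k) ng)) ⟩
    8 ℕ.^ k ℕ.* β                            <⟨ 8^k*β<9^k β ⟩
    9 ℕ.^ k                                  ≤⟨ ℕₚ.^-monoˡ-≤ k 9≤p ⟩
    p ℕ.^ k                                  ∎))) (ℤₚ.*-zeroʳ (+ (p ℕ.^ k))))
    where open ℕₚ.≤-Reasoning

cosGap-† : ∀ s d c {u} → (cosGap s d c) † ≈[ u ] cosGap s d c
cosGap-† s d c {u} = +-cong (+-cong (cos-† s) (cos-† d))
  (≈-trans (*-comm _ _) (*-congˡ (+-cong (cos-† 0ℤ) (cos-† c))))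
  where
  open OpRing u
  cos-† : ∀ e → (cos e) † ≈[ u ] cos e
  cos-† e = ≈-trans (+-congˡ (sh-≡ (ℤₚ.neg-involutive e))) (+-comm (sh (ℤ.- e)) (sh e))

CosRel-prime : ∀ {m} .{{_ : ℕ.NonZero m}} {u s d c p} → Fixes u (+ m) → Prime p → 9 ≤ p →
  CosRel u s d c → CosRel u (+ p ℤ.* s) (+ p ℤ.* d) (+ p ℤ.* c)
CosRel-prime {m} {u} {s} {d} {c} {suc n} pu pp 9≤p h = gap⇒CosRel {s = P ℤ.* s} {P ℤ.* d} {P ℤ.* c}
  (multiple-vanishes {m} pu 9≤p _ refl
    (λ {v} → cosGap-† (P ℤ.* s) (P ℤ.* d) (P ℤ.* c) {v}) (proj₂ (CosRel⇒multiple {s = s} {d} {c} pp h)))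
  where P = + suc n

-- Galois conjugates

CosRel-resp : ∀ {u s d c s′ d′ c′} → s ≡ s′ → d ≡ d′ → c ≡ c′ → CosRel u s d c → CosRel u s′ d′ c′
CosRel-resp refl refl refl h = h

CosRel-product : ∀ {m} .{{_ : ℕ.NonZero m}} {u s d c} → Fixes u (+ m) →
  ∀ ps → All Prime ps → All (9 ≤_) ps → CosRel u s d c →
  let σ = + product ps in CosRel u (σ ℤ.* s) (σ ℤ.* d) (σ ℤ.* c)
CosRel-product {s = s} {d} {c} pu [] [] [] h =
  CosRel-resp (sym (ℤₚ.*-identityˡ s)) (sym (ℤₚ.*-identityˡ d)) (sym (ℤₚ.*-identityˡ c)) h
CosRel-product {m} {u} {s} {d} {c} pu (p ∷ ps) (pp ∷ pps) (le ∷ les) h =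
  CosRel-resp (assoc s) (assoc d) (assoc c)
    (CosRel-prime {m} {s = σ ℤ.* s} {σ ℤ.* d} {σ ℤ.* c} pu pp le
      (CosRel-product {m} {s = s} {d} {c} pu ps pps les h))
  where
  σ = + product ps
  assoc : ∀ e → + p ℤ.* (σ ℤ.* e) ≡ + product (p ∷ ps) ℤ.* e
  assoc e = trans (sym (ℤₚ.*-assoc (+ p) σ e)) (cong (ℤ._* e) (sym (ℤₚ.pos-* p (product ps))))

-- 210 = 2·3·5·7 is the product of the primes that the bound 8 does not exclude.
prime<9⇒∣210 : ∀ {p} → p < 9 → Prime p → p ∣ 210
prime<9⇒∣210 = from-yes (ℕₚ.allUpTo? (λ p → prime? p →-dec (p ∣? 210)) 9)

prime-coprime-210⇒9≤ : ∀ {p σ} → Coprime σ 210 → Prime p → p ∣ σ → 9 ≤ p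
prime-coprime-210⇒9≤ {p} cop pp p∣σ with p ℕ.<? 9
... | no p≮9  = ℕₚ.≮⇒≥ p≮9
... | yes p<9 = contradiction (subst Prime (cop (p∣σ , prime<9⇒∣210 p<9 pp)) pp) ¬prime[1]

CosRel-coprime : ∀ {m} .{{_ : ℕ.NonZero m}} {u s d c} → Fixes u (+ m) → CosRel u s d c →
  ∀ σ → Coprime σ 210 → CosRel u (+ σ ℤ.* s) (+ σ ℤ.* d) (+ σ ℤ.* c)
CosRel-coprime pu h zero cop = contradiction (cop {210} (210 ∣0 , ∣-refl)) λ ()
CosRel-coprime {m} {u} {s} {d} {c} pu h σ@(suc _) cop =
  subst (λ t → CosRel u (+ t ℤ.* s) (+ t ℤ.* d) (+ t ℤ.* c)) (sym isFactorisation)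
    (CosRel-product {m} {s = s} {d} {c} pu factors factorsPrime (large factors factorsPrime
      (subst (λ t → Coprime t 210) isFactorisation cop)) h)
  where
  open PrimeFactorisation (factorise σ)
  large : ∀ ps → All Prime ps → Coprime (product ps) 210 → All (9 ≤_) ps
  large [] [] _ = []
  large (p ∷ ps) (pp ∷ pps) cop =
    prime-coprime-210⇒9≤ {σ = product (p ∷ ps)} cop pp (m∣m*n (product ps)) ∷
    large ps pps (λ (i∣ , i∣210) → cop (∣-trans i∣ (n∣m*n p) , i∣210))

-- Sums over arithmetic progressions of exponents

sumSh : ℤ → List ℕ → Op
sumSh e []      = con 0ℤ
sumSh e (k ∷ ks) = sh (+ k ℤ.* e) ⊕ sumSh e ks

infixl 5 _⊞_
-- Sums of pairs are kept with multiplicity, so that the exponential sum over `ks ⊞ ls` is a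
-- product.
_⊞_ : List ℕ → List ℕ → List ℕ
_⊞_ = cartesianProductWith ℕ._+_

multiples : ℕ → ℕ → ℕ → List ℕ
multiples t k zero    = []
multiples t k (suc n) = t ℕ.* k ∷ multiples t (suc k) n

NonZeroFun : (ℤ → ℤ) → Set
NonZeroFun u = ∃ λ i → u i ≢ 0ℤ

zero? : ∀ {m u} .{{_ : ℕ.NonZero m}} → Fixes u (+ m) → NonZeroFun u ⊎ (∀ i → u i ≡ 0ℤ)
zero? {m} {u} pu with ℕₚ.allUpTo? (λ j → u (+ j) ℤ.≟ 0ℤ) m
... | yes h = inj₂ (periodic-rec pu (_≡ 0ℤ) (λ j → h {j}))
... | no ¬h with ℕₚ.anyUpTo? (λ j → ¬? (u (+ j) ℤ.≟ 0ℤ)) m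
...   | yes (j , _ , nz) = inj₁ (+ j , nz)
...   | no ¬nz = contradiction (λ {j} j<m → all-zero j j<m) ¬h
  where
  all-zero : ∀ j → j < m → u (+ j) ≡ 0ℤ
  all-zero j j<m with u (+ j) ℤ.≟ 0ℤ
  ... | yes e = e
  ... | no nz = contradiction (j , j<m , nz) ¬nz

module _ {u : ℤ → ℤ} where
  open OpRing u
  open OpSolver u
  open SetoidReasoning setoid

  sh-*+ : ∀ k l e → sh (+ (k ℕ.+ l) ℤ.* e) ≈[ u ] sh (+ k ℤ.* e) ⊗ sh (+ l ℤ.* e)
  sh-*+ k l e = ≈-trans (sh-≡ (trans (cong (ℤ._* e) (ℤₚ.pos-+ k l)) (ℤₚ.*-distribʳ-+ e (+ k) (+ l))))
    (sh-+ (+ k ℤ.* e) (+ l ℤ.* e))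

  sumSh-++ : ∀ e ks ls → sumSh e (ks ++ ls) ≈[ u ] sumSh e ks ⊕ sumSh e ls
  sumSh-++ e []       ls = ≈-sym (+-identityˡ _)
  sumSh-++ e (k ∷ ks) ls = ≈-trans (+-congˡ (sumSh-++ e ks ls)) (≈-sym (+-assoc _ _ _))

  sumSh-map : ∀ e k ls → sumSh e (List.map (k ℕ.+_) ls) ≈[ u ] sh (+ k ℤ.* e) ⊗ sumSh e ls
  sumSh-map e k []       = ≈-sym (zeroʳ _)
  sumSh-map e k (l ∷ ls) = ≈-trans (+-cong (sh-*+ k l e) (sumSh-map e k ls))
    (solve 3 (λ a b c → a :* b :+ a :* c := a :* (b :+ c)) ≈-refl _ _ _)

  sumSh-⊞ : ∀ e ks ls → sumSh e (ks ⊞ ls) ≈[ u ] sumSh e ks ⊗ sumSh e ls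
  sumSh-⊞ e []       ls = ≈-sym (zeroˡ _)
  sumSh-⊞ e (k ∷ ks) ls = begin
    sumSh e (List.map (k ℕ.+_) ls ++ (ks ⊞ ls))                  ≈⟨ sumSh-++ e (List.map (k ℕ.+_) ls) (ks ⊞ ls) ⟩
    sumSh e (List.map (k ℕ.+_) ls) ⊕ sumSh e (ks ⊞ ls)           ≈⟨ +-cong (sumSh-map e k ls) (sumSh-⊞ e ks ls) ⟩
    sh (+ k ℤ.* e) ⊗ sumSh e ls ⊕ sumSh e ks ⊗ sumSh e ls        ≈⟨ solve 3 (λ a b c → a :* c :+ b :* c := (a :+ b) :* c) ≈-refl _ _ _ ⟩
    sumSh e (k ∷ ks) ⊗ sumSh e ls                                ∎

  sumCos : ℤ → List ℕ → Op
  sumCos e ks = sumSh e ks ⊕ sumSh (ℤ.- e) ks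

  CosRel-sum : ∀ {s d c} ks → All (λ σ → CosRel u (+ σ ℤ.* s) (+ σ ℤ.* d) (+ σ ℤ.* c)) ks →
    sumCos s ks ⊕ sumCos d ks ≈[ u ] sumCos 0ℤ ks ⊕ sumCos c ks
  CosRel-sum [] [] = ≈-refl
  CosRel-sum {s} {d} {c} (k ∷ ks) (h ∷ hs) = begin
    sumCos s (k ∷ ks) ⊕ sumCos d (k ∷ ks)   ≈⟨ regroup s d ⟩
    (cos (K ℤ.* s) ⊕ cos (K ℤ.* d)) ⊕ (sumCos s ks ⊕ sumCos d ks)
                                            ≈⟨ +-cong (≈-trans h (+-congʳ cos-0)) (CosRel-sum ks hs) ⟩
    (cos (K ℤ.* 0ℤ) ⊕ cos (K ℤ.* c)) ⊕ (sumCos 0ℤ ks ⊕ sumCos c ks)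
                                            ≈⟨ regroup 0ℤ c ⟨
    sumCos 0ℤ (k ∷ ks) ⊕ sumCos c (k ∷ ks)  ∎
    where
    K = + k
    cos-0 : cos 0ℤ ≈[ u ] cos (K ℤ.* 0ℤ)
    cos-0 = +-cong (sh-≡ (sym (ℤₚ.*-zeroʳ K))) (sh-≡ (cong ℤ.-_ (sym (ℤₚ.*-zeroʳ K))))
    regroup : ∀ e f → sumCos e (k ∷ ks) ⊕ sumCos f (k ∷ ks) ≈[ u ]
      (cos (K ℤ.* e) ⊕ cos (K ℤ.* f)) ⊕ (sumCos e ks ⊕ sumCos f ks)
    regroup e f = ≈-trans
      (+-cong (+-congˡ (+-congʳ (sh-≡ (sym (ℤₚ.neg-distribʳ-* K e)))))
              (+-congˡ (+-congʳ (sh-≡ (sym (ℤₚ.neg-distribʳ-* K f))))))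
      (solve 8 (λ a A b B c C d D → ((a :+ A) :+ (b :+ B)) :+ ((c :+ C) :+ (d :+ D)) :=
                                    ((a :+ b) :+ (c :+ d)) :+ ((A :+ B) :+ (C :+ D))) ≈-refl
        (sh (K ℤ.* e)) (sumSh e ks) (sh (ℤ.- (K ℤ.* e))) (sumSh (ℤ.- e) ks)
        (sh (K ℤ.* f)) (sumSh f ks) (sh (ℤ.- (K ℤ.* f))) (sumSh (ℤ.- f) ks))

  sumSh-multiples-shift : ∀ t e k n →
    sh (+ t ℤ.* e) ⊗ sumSh e (multiples t k n) ≈[ u ] sumSh e (multiples t (suc k) n)
  sumSh-multiples-shift t e k zero    = zeroʳ _
  sumSh-multiples-shift t e k (suc n) = ≈-trans
    (solve 3 (λ x y z → x :* (y :+ z) := x :* y :+ x :* z) ≈-refl _ _ _)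
    (+-cong (≈-trans (≈-sym (sh-*+ t (t ℕ.* k) e)) (sh-≡ (cong (λ x → + x ℤ.* e) (sym (ℕₚ.*-suc t k)))))
            (sumSh-multiples-shift t e (suc k) n))

  sumSh-multiples-step : ∀ t e k n →
    sumSh e (multiples t (suc k) n) ⊕ sh (+ (t ℕ.* k) ℤ.* e) ≈[ u ]
    sumSh e (multiples t k n) ⊕ sh (+ (t ℕ.* (k ℕ.+ n)) ℤ.* e)
  sumSh-multiples-step t e k zero    = +-congˡ (sh-≡ (cong (λ x → + (t ℕ.* x) ℤ.* e) (sym (ℕₚ.+-identityʳ k))))
  sumSh-multiples-step t e k (suc n) = begin
    (y ⊕ z) ⊕ x   ≈⟨ solve 3 (λ x y z → (y :+ z) :+ x := x :+ (z :+ y)) ≈-refl x y z ⟩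
    x ⊕ (z ⊕ y)   ≈⟨ +-congˡ (sumSh-multiples-step t e (suc k) n) ⟩
    x ⊕ (sumSh e (multiples t (suc k) n) ⊕ sh (+ (t ℕ.* (suc k ℕ.+ n)) ℤ.* e))
                  ≈⟨ +-assoc _ _ _ ⟨
    x ⊕ sumSh e (multiples t (suc k) n) ⊕ sh (+ (t ℕ.* (suc k ℕ.+ n)) ℤ.* e)
                  ≈⟨ +-congˡ (sh-≡ (cong (λ x → + (t ℕ.* x) ℤ.* e) (sym (ℕₚ.+-suc k n)))) ⟩
    x ⊕ sumSh e (multiples t (suc k) n) ⊕ sh (+ (t ℕ.* (k ℕ.+ suc n)) ℤ.* e) ∎
    where
    x = sh (+ (t ℕ.* k) ℤ.* e)
    y = sh (+ (t ℕ.* suc k) ℤ.* e)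
    z = sumSh e (multiples t (suc (suc k)) n)

  -- Multiplication by T^{te} exchanges the first term, T⁰, for T^{tne}, and both act as 1. The
  -- summand 1 is added and cancelled because the telescoping identity is stated without
  -- subtraction.
  geometric-invariant : ∀ t e n → Fixes u (+ (t ℕ.* n) ℤ.* e) →
    sh (+ t ℤ.* e) ⊗ sumSh e (multiples t 0 n) ≈[ u ] sumSh e (multiples t 0 n)
  geometric-invariant t e n h = begin
    sh (+ t ℤ.* e) ⊗ S               ≈⟨ sumSh-multiples-shift t e 0 n ⟩
    S′                               ≈⟨ solve 1 (λ x → x := x :+ # 1ℤ :- # 1ℤ) ≈-refl S′ ⟩
    S′ ⊕ con 1ℤ ⊕ con -1ℤ ⊗ con 1ℤ   ≈⟨ +-congʳ (+-congˡ (≈-trans (sh-≡ (cong (λ x → + x ℤ.* e) (ℕₚ.*-zeroʳ t))) sh-0)) ⟨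
    S′ ⊕ sh (+ (t ℕ.* 0) ℤ.* e) ⊕ con -1ℤ ⊗ con 1ℤ ≈⟨ +-congʳ (sumSh-multiples-step t e 0 n) ⟩
    S ⊕ sh (+ (t ℕ.* n) ℤ.* e) ⊕ con -1ℤ ⊗ con 1ℤ  ≈⟨ +-congʳ (+-congˡ h) ⟩
    S ⊕ con 1ℤ ⊕ con -1ℤ ⊗ con 1ℤ    ≈⟨ solve 1 (λ x → x :+ # 1ℤ :- # 1ℤ := x) ≈-refl S ⟩
    S                                ∎
    where
    S = sumSh e (multiples t 0 n)
    S′ = sumSh e (multiples t 1 n)

  sumSh-fixed : ∀ t e k n → Fixes u (+ t ℤ.* e) → sumSh e (multiples t k n) ≈[ u ] con (+ n)
  sumSh-fixed t e k zero    h = ≈-refl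
  sumSh-fixed t e k (suc n) h = ≈-trans
    (+-cong (≈-trans (sh-≡ (trans (cong (ℤ._* e) (trans (ℤₚ.pos-* t k) (ℤₚ.*-comm (+ t) (+ k))))
                                  (ℤₚ.*-assoc (+ k) (+ t) e)))
                     (fixes-ℕ* k h))
            (sumSh-fixed t e (suc k) n h))
    (mk λ i → sym (ℤₚ.*-distribʳ-+ (u i) 1ℤ (+ n)))

-- If T^{tne} = 1 on u, then T^{te} is either trivial on u or, for false, has no fixed vectors in ℤ[T] u.
Component : (ℤ → ℤ) → (t n : ℕ) → ℤ → Bool → Set
Component u t n e true  = Fixes u (+ t ℤ.* e)
Component u t n e false = sumSh e (multiples t 0 n) ≈[ u ] con 0ℤ

Component-⊑ : ∀ {u v t n e} → u ⊑ v → ∀ b → Component u t n e b → Component v t n e b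
Component-⊑ le true  h = le h
Component-⊑ le false h = le h

Component± : (ℤ → ℤ) → (t n : ℕ) → ℤ → Bool → Set
Component± u t n e b = Component u t n e b × Component u t n (ℤ.- e) b

-- The values of the geometric sum `S` are fixed by T^{te}. If `S e` or `S (- e)` does not kill `u`,
-- its value is the new function; if both do, `u` itself is of the second kind.
split : ∀ {m} .{{_ : ℕ.NonZero m}} {u} → NonZeroFun u → Fixes u (+ m) →
  ∀ t n e → Fixes u (+ (t ℕ.* n) ℤ.* e) →
  ∃ λ v → u ⊑ v × NonZeroFun v × ∃ (Component± v t n e)
split {m} {u} nz pu t n e h = go (zero? (⊑-⟦⟧ (S e) u pu)) (zero? (⊑-⟦⟧ (S (ℤ.- e)) u pu))
  where
  S : ℤ → Op
  S e = sumSh e (multiples t 0 n)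
  flip : ∀ {u} t e → Fixes u (+ t ℤ.* e) → Fixes u (+ t ℤ.* ℤ.- e)
  flip {u} t e h = ≈-trans (sh-≡ (sym (ℤₚ.neg-distribʳ-* (+ t) e))) (fixes-neg h)
    where open OpRing u
  invariant : ∀ e → Fixes u (+ (t ℕ.* n) ℤ.* e) → Fixes (⟦ S e ⟧ u) (+ t ℤ.* e)
  invariant e h = mk λ i → trans (at (geometric-invariant t e n h) i) (sym (ℤₚ.*-identityˡ _))
  go : (NonZeroFun (⟦ S e ⟧ u) ⊎ (∀ i → ⟦ S e ⟧ u i ≡ 0ℤ)) →
    (NonZeroFun (⟦ S (ℤ.- e) ⟧ u) ⊎ (∀ i → ⟦ S (ℤ.- e) ⟧ u i ≡ 0ℤ)) →
    ∃ λ v → u ⊑ v × NonZeroFun v × ∃ (Component± v t n e)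
  go (inj₁ nz′) _ = ⟦ S e ⟧ u , ⊑-⟦⟧ (S e) u , nz′ , true , invariant e h , flip t e (invariant e h)
  go _ (inj₁ nz′) = ⟦ S (ℤ.- e) ⟧ u , ⊑-⟦⟧ (S (ℤ.- e)) u , nz′ , true ,
    subst (λ x → Fixes (⟦ S (ℤ.- e) ⟧ u) (+ t ℤ.* x)) (ℤₚ.neg-involutive e)
      (flip t (ℤ.- e) (invariant (ℤ.- e) (flip (t ℕ.* n) e h))) ,
    invariant (ℤ.- e) (flip (t ℕ.* n) e h)
  go (inj₂ z) (inj₂ z′) = u , (λ h → h) , nz , false , mk z , mk z′

-- The order of T^e on u: torsion bᵣ says that it divides 210 and that r divides it iff bᵣ is false;
-- generic stands for all the other orders.
data Order : Set where
  generic : Order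
  torsion : (b₂ b₃ b₅ b₇ : Bool) → Order

-- In the torsion case t n = 210 with n prime: T^{te} is an n-th root of unity, and it is trivial
-- iff n does not divide the (squarefree) order. In the generic case T^{210 e} is an m-th root of
-- unity other than 1, expressed by the vanishing sum of its powers.
HasOrder : (ℤ → ℤ) → ℕ → ℤ → Order → Set
HasOrder u m e generic = Component u 210 m e false
HasOrder u m e (torsion b₂ b₃ b₅ b₇) = Fixes u (+ 210 ℤ.* e) ×
  Component u 105 2 e b₂ × Component u 70 3 e b₃ × Component u 42 5 e b₅ × Component u 30 7 e b₇

HasOrder± : (ℤ → ℤ) → ℕ → ℤ → Order → Set
HasOrder± u m e o = HasOrder u m e o × HasOrder u m (ℤ.- e) o

HasOrder-⊑ : ∀ {u v m e} → u ⊑ v → ∀ o → HasOrder u m e o → HasOrder v m e o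
HasOrder-⊑ le generic h = le h
HasOrder-⊑ {u} {v} {m} {e} le (torsion b₂ b₃ b₅ b₇) (h , h₂ , h₃ , h₅ , h₇) =
  le h , c 105 2 b₂ h₂ , c 70 3 b₃ h₃ , c 42 5 b₅ h₅ , c 30 7 b₇ h₇
  where
  c : ∀ t n b → Component u t n e b → Component v t n e b
  c t n = Component-⊑ {t = t} {n} {e} le

HasOrder±-⊑ : ∀ {u v m e o} → u ⊑ v → HasOrder± u m e o → HasOrder± v m e o
HasOrder±-⊑ {m = m} {e} {o} le (h , k) =
  HasOrder-⊑ {m = m} {e} le o h , HasOrder-⊑ {m = m} {ℤ.- e} le o k

PartialOrder : (ℤ → ℤ) → ℤ → Set
PartialOrder u e = ∃ λ b₂ → ∃ λ b₃ → ∃ λ b₅ → ∃ λ b₇ →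
  Component± u 105 2 e b₂ × Component± u 70 3 e b₃ × Component± u 42 5 e b₅ × Component± u 30 7 e b₇

Component±-⊑ : ∀ {u v t n e} → u ⊑ v → ∀ b → Component± u t n e b → Component± v t n e b
Component±-⊑ {t = t} {n} {e} le b (h , k) =
  Component-⊑ {t = t} {n} {e} le b h , Component-⊑ {t = t} {n} {ℤ.- e} le b k

assign-components : ∀ {m} .{{_ : ℕ.NonZero m}} {u} → NonZeroFun u → Fixes u (+ m) →
  ∀ e → Fixes u (+ 210 ℤ.* e) → ∃ λ v → u ⊑ v × NonZeroFun v × PartialOrder v e
assign-components {m} {u} nz pu e h = step₂ (split {m} nz pu 105 2 e h)
  where
  Goal : Set
  Goal = ∃ λ v → u ⊑ v × NonZeroFun v × PartialOrder v e
  step₂ : (∃ λ v → u ⊑ v × NonZeroFun v × ∃ (Component± v 105 2 e)) → Goal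
  step₂ (v₂ , le₂ , nz₂ , b₂ , c₂) = step₃ (split {m} nz₂ (le₂ pu) 70 3 e (le₂ h))
    where
    step₃ : (∃ λ v → v₂ ⊑ v × NonZeroFun v × ∃ (Component± v 70 3 e)) → Goal
    step₃ (v₃ , le₃ , nz₃ , b₃ , c₃) = step₅ (split {m} nz₃ (le₃ (le₂ pu)) 42 5 e (le₃ (le₂ h)))
      where
      step₅ : (∃ λ v → v₃ ⊑ v × NonZeroFun v × ∃ (Component± v 42 5 e)) → Goal
      step₅ (v₅ , le₅ , nz₅ , b₅ , c₅) =
        step₇ (split {m} nz₅ (le₅ (le₃ (le₂ pu))) 30 7 e (le₅ (le₃ (le₂ h))))
        where
        step₇ : (∃ λ v → v₅ ⊑ v × NonZeroFun v × ∃ (Component± v 30 7 e)) → Goal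
        step₇ (v₇ , le₇ , nz₇ , b₇ , c₇) =
          v₇ , (λ x → le₇ (le₅ (le₃ (le₂ x)))) , nz₇ , b₂ , b₃ , b₅ , b₇ ,
          Component±-⊑ {t = 105} {2} {e} (λ x → le₇ (le₅ (le₃ x))) b₂ c₂ ,
          Component±-⊑ {t = 70} {3} {e} (λ x → le₇ (le₅ x)) b₃ c₃ ,
          Component±-⊑ {t = 42} {5} {e} le₇ b₅ c₅ , c₇

-- T^{210 m e} = 1 because `m` is a period, so `split` can decide whether the order divides 210, and
-- then treat the four primes. Each decision may pass to a multiple, on which the earlier ones
-- persist.
assign-order : ∀ {m} .{{_ : ℕ.NonZero m}} {u} → NonZeroFun u → Fixes u (+ m) →
  ∀ e → ∃ λ v → u ⊑ v × NonZeroFun v × ∃ (HasOrder± v m e)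
assign-order {m} {u} nz pu e = generic? (split {m} nz pu 210 m e (fixes-resp (fixes-* (+ 210 ℤ.* e) pu)))
  where
  fixes-resp : Fixes u (+ 210 ℤ.* e ℤ.* + m) → Fixes u (+ (210 ℕ.* m) ℤ.* e)
  fixes-resp = subst (Fixes u) (trans
    (solve 3 (λ x e m → x :* e :* m := x :* m :* e) refl (+ 210) e (+ m))
    (cong (ℤ._* e) (sym (ℤₚ.pos-* 210 m))))
    where open ℤ-Solver
  torsion-order : ∀ {v w} → v ⊑ w → Component± v 210 m e true → PartialOrder w e → ∃ (HasOrder± w m e)
  torsion-order le (h , k) (b₂ , b₃ , b₅ , b₇ , c₂ , c₃ , c₅ , c₇) = torsion b₂ b₃ b₅ b₇ ,
    (le h , proj₁ c₂ , proj₁ c₃ , proj₁ c₅ , proj₁ c₇) , (le k , proj₂ c₂ , proj₂ c₃ , proj₂ c₅ , proj₂ c₇)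
  generic? : (∃ λ v → u ⊑ v × NonZeroFun v × ∃ (Component± v 210 m e)) →
    ∃ λ v → u ⊑ v × NonZeroFun v × ∃ (HasOrder± v m e)
  generic? (v , le , nzv , false , c) = v , le , nzv , generic , c
  generic? (v , le , nzv , true , c) = components (assign-components {m} nzv (le pu) e (proj₁ c))
    where
    components : (∃ λ w → v ⊑ w × NonZeroFun w × PartialOrder w e) →
      ∃ λ v → u ⊑ v × NonZeroFun v × ∃ (HasOrder± v m e)
    components (w , le′ , nzw , po) = w , (λ x → le′ (le x)) , nzw , torsion-order le′ c po

-- All residues prime to 210, listed by the Chinese remainder theorem.
units₂₁₀ : List ℕ
units₂₁₀ = multiples 105 1 1 ⊞ multiples 70 1 2 ⊞ multiples 42 1 4 ⊞ multiples 30 1 6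

-- Representatives modulo 210 m. The added multiples of 210 do not affect coprimality to 210, and
-- their sum kills the roots of unity of generic order.
units : ℕ → List ℕ
units m = units₂₁₀ ⊞ multiples 210 0 m

units-coprime : ∀ m → All (λ σ → Coprime σ 210) (units m)
units-coprime m = Allₚ.cartesianProductWith⁺ (≡.setoid ℕ) (≡.setoid ℕ) ℕ._+_ units₂₁₀ (multiples 210 0 m)
  λ σ∈ τ∈ → coprime-+ (All.lookup coprime₂₁₀ σ∈) (All.lookup (∣multiples 0 m) τ∈)
  where
  coprime₂₁₀ : All (λ σ → Coprime σ 210) units₂₁₀
  coprime₂₁₀ = from-yes (All.all? (λ σ → coprime? σ 210) units₂₁₀)
  ∣multiples : ∀ k n → All (210 ∣_) (multiples 210 k n)
  ∣multiples k zero    = []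
  ∣multiples k (suc n) = m∣m*n k ∷ ∣multiples (suc k) n
  coprime-+ : ∀ {σ τ} → Coprime σ 210 → 210 ∣ τ → Coprime (σ ℕ.+ τ) 210
  coprime-+ {σ} {τ} cop 210∣τ {i} (i∣ , i∣210) =
    cop (∣m+n∣m⇒∣n (subst (i ∣_) (ℕₚ.+-comm σ τ) i∣) (∣-trans i∣210 210∣τ) , i∣210)

-- The sum of x^k over 1 ≤ k ≤ n for an (n+1)-th root of unity x, according to whether x is 1 or its
-- n + 1 powers add up to 0.
primeTrace : ℕ → Bool → ℤ
primeTrace n true  = + n
primeTrace n false = -1ℤ

-- 48 times the normalised trace μ(N)/φ(N) of a root of unity of order N.
trace : Order → ℤ
trace generic = 0ℤ
trace (torsion b₂ b₃ b₅ b₇) =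
  primeTrace 1 b₂ ℤ.* primeTrace 2 b₃ ℤ.* primeTrace 4 b₅ ℤ.* primeTrace 6 b₇

module _ {u : ℤ → ℤ} where
  open OpRing u
  open OpSolver u
  open SetoidReasoning setoid

  con-* : ∀ k l → con (k ℤ.* l) ≈[ u ] con k ⊗ con l
  con-* k l = mk λ i → ℤₚ.*-assoc k l (u i)

  sumSh-component : ∀ t n e b → Component u t (suc n) e b →
    sumSh e (multiples t 1 n) ≈[ u ] con (primeTrace n b)
  sumSh-component t n e true  h = sumSh-fixed t e 1 n h
  sumSh-component t n e false h = begin
    S                         ≈⟨ solve 1 (λ x → x := (# 1ℤ :+ x) :+ # -1ℤ) ≈-refl S ⟩
    (con 1ℤ ⊕ S) ⊕ con -1ℤ    ≈⟨ +-congʳ (+-congʳ (≈-trans (sh-≡ (cong (λ x → + x ℤ.* e) (ℕₚ.*-zeroʳ t))) sh-0)) ⟨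
    (sh (+ (t ℕ.* 0) ℤ.* e) ⊕ S) ⊕ con -1ℤ ≈⟨ +-congʳ h ⟩
    con 0ℤ ⊕ con -1ℤ          ≈⟨ +-identityˡ _ ⟩
    con -1ℤ                   ∎
    where S = sumSh e (multiples t 1 n)

  -- The listing as a sumset splits the sum into geometric sums, one for each prime and one for the
  -- multiples of 210, each of which is known from the order. In the generic case the last one is 0.
  sumSh-units : ∀ m e o → HasOrder u m e o → sumSh e (units m) ≈[ u ] con (trace o ℤ.* + m)
  sumSh-units m e generic h = begin
    sumSh e (units m)                                  ≈⟨ sumSh-⊞ e units₂₁₀ (multiples 210 0 m) ⟩
    sumSh e units₂₁₀ ⊗ sumSh e (multiples 210 0 m)     ≈⟨ *-congˡ h ⟩
    sumSh e units₂₁₀ ⊗ con 0ℤ                          ≈⟨ zeroʳ _ ⟩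
    con 0ℤ                                             ∎
  sumSh-units m e (torsion b₂ b₃ b₅ b₇) (h , h₂ , h₃ , h₅ , h₇) =
    factor (l₂ ⊞ l₃ ⊞ l₅ ⊞ l₇) (multiples 210 0 m)
      (factor (l₂ ⊞ l₃ ⊞ l₅) l₇ (factor (l₂ ⊞ l₃) l₅ (factor l₂ l₃
        (sumSh-component 105 1 e b₂ h₂) (sumSh-component 70 2 e b₃ h₃))
        (sumSh-component 42 4 e b₅ h₅)) (sumSh-component 30 6 e b₇ h₇))
      (sumSh-fixed 210 e 0 m h)
    where
    l₂ = multiples 105 1 1
    l₃ = multiples 70 1 2
    l₅ = multiples 42 1 4
    l₇ = multiples 30 1 6
    factor : ∀ ks ls {k l} → sumSh e ks ≈[ u ] con k → sumSh e ls ≈[ u ] con l →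
      sumSh e (ks ⊞ ls) ≈[ u ] con (k ℤ.* l)
    factor ks ls {k} {l} hk hl = ≈-trans (sumSh-⊞ e ks ls) (≈-trans (*-cong hk hl) (≈-sym (con-* k l)))

con-injective : ∀ {u k l} → NonZeroFun u → con k ≈[ u ] con l → k ≡ l
con-injective {u} {k} {l} (i , nz) h = ℤₚ.*-cancelʳ-≡ k l (u i) {{ℤ.≢-nonZero nz}} (at h i)

-- Summing the conjugate relations over `units m` turns every cosine into an integer, and integers
-- can be compared on a nonzero function. The cancelled factor 2m counts the multiples of 210 and
-- the two signs of the exponent; 48 = φ(210) is the trace of T⁰.
trace-equation : ∀ {m} .{{_ : ℕ.NonZero m}} {u s d c os od oc} → NonZeroFun u → Fixes u (+ m) →
  CosRel u s d c → HasOrder± u m s os → HasOrder± u m d od → HasOrder± u m c oc →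
  trace os ℤ.+ trace od ≡ + 48 ℤ.+ trace oc
trace-equation {m} {u} {s} {d} {c} {os} {od} {oc} nz pu h hs hd hc =
  ℤₚ.*-cancelʳ-≡ _ _ (+ m ℤ.+ + m) {{ℤ.≢-nonZero (double≢0 m)}} (con-injective nz (begin
    con ((trace os ℤ.+ trace od) ℤ.* (+ m ℤ.+ + m)) ≈⟨ double os od ⟩
    (K os ⊕ K os) ⊕ (K od ⊕ K od)                   ≈⟨ +-cong (sumCos-units os hs) (sumCos-units od hd) ⟨
    sumCos {u} s (units m) ⊕ sumCos {u} d (units m) ≈⟨ CosRel-sum {u} {s} {d} {c} (units m) rels ⟩
    sumCos {u} 0ℤ (units m) ⊕ sumCos {u} c (units m) ≈⟨ +-cong (sumCos-units one (zero-trivial , zero-trivial)) (sumCos-units oc hc) ⟩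
    (K one ⊕ K one) ⊕ (K oc ⊕ K oc)                 ≈⟨ double one oc ⟨
    con ((+ 48 ℤ.+ trace oc) ℤ.* (+ m ℤ.+ + m))     ∎))
  where
  open OpRing u
  open SetoidReasoning setoid
  one = torsion true true true true
  K : Order → Op
  K o = con (trace o ℤ.* + m)
  double≢0 : ∀ m .{{_ : ℕ.NonZero m}} → + m ℤ.+ + m ≢ 0ℤ
  double≢0 (suc m) ()
  sumCos-units : ∀ {e} o → HasOrder± u m e o → sumCos {u} e (units m) ≈[ u ] K o ⊕ K o
  sumCos-units {e} o (h , k) = +-cong (sumSh-units m e o h) (sumSh-units m (ℤ.- e) o k)
  double : ∀ o p → con ((trace o ℤ.+ trace p) ℤ.* (+ m ℤ.+ + m)) ≈[ u ] (K o ⊕ K o) ⊕ (K p ⊕ K p)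
  double o p = mk λ i → solve 4
    (λ x y m z → (x :+ y) :* (m :+ m) :* z := (x :* m :* z :+ x :* m :* z) :+ (y :* m :* z :+ y :* m :* z))
    refl (trace o) (trace p) (+ m) (u i)
    where open ℤ-Solver
  zero-trivial : HasOrder u m 0ℤ one
  zero-trivial = sh-0 , sh-0 , sh-0 , sh-0 , sh-0
  rels : All (λ σ → CosRel u (+ σ ℤ.* s) (+ σ ℤ.* d) (+ σ ℤ.* c)) (units m)
  rels = All.map {P = λ σ → Coprime σ 210} (λ {σ} cop → CosRel-coprime {m} {u} {s} {d} {c} pu h σ cop) (units-coprime m)

-- The solutions of the trace equation

infix 4 _≟ₒ_
_≟ₒ_ : (o p : Order) → Dec (o ≡ p)
generic ≟ₒ generic = yes refl
generic ≟ₒ torsion _ _ _ _ = no λ ()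
torsion _ _ _ _ ≟ₒ generic = no λ ()
torsion a b c d ≟ₒ torsion a′ b′ c′ d′ =
  map′ (λ { (refl , refl , refl , refl) → refl }) (λ { refl → refl , refl , refl , refl })
    (a Bool.≟ a′ ×-dec b Bool.≟ b′ ×-dec c Bool.≟ c′ ×-dec d Bool.≟ d′)

∀-bool? : {P : Bool → Set} → (∀ b → Dec (P b)) → Dec (∀ b → P b)
∀-bool? P? = map′ (λ { (t , f) true → t ; (t , f) false → f }) (λ h → h true , h false)
  (P? true ×-dec P? false)

∀-order? : {P : Order → Set} → (∀ o → Dec (P o)) → Dec (∀ o → P o)
∀-order? P? = map′ (λ { (g , t) generic → g ; (g , t) (torsion a b c d) → t a b c d })
  (λ h → h generic , λ a b c d → h (torsion a b c d))
  (P? generic ×-dec ∀-bool? λ a → ∀-bool? λ b → ∀-bool? λ c → ∀-bool? λ d → P? (torsion a b c d))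

o₁ o₂ o₃ o₅ o₆ o₁₀ : Order
o₁  = torsion true  true  true  true
o₂  = torsion false true  true  true
o₃  = torsion true  false true  true
o₅  = torsion true  true  false true
o₆  = torsion false false true  true
o₁₀ = torsion false true  false true

-- Orders 1, 2, 3, 5, 6, 10 have normalised traces 1, -1, -1/2, -1/4, 1/2, 1/4. The first three
-- families leave the other orders open and lead to (i) and (ii); the remaining six are isolated.
Solutions : Order → Order → Order → Set
Solutions os od oc =
    os ≡ o₁
  ⊎ od ≡ o₁
  ⊎ oc ≡ o₂
  ⊎ (os ≡ o₆ × od ≡ o₆ × oc ≡ generic)
  ⊎ (os ≡ o₆ × od ≡ generic × oc ≡ o₃)
  ⊎ (os ≡ generic × od ≡ o₆ × oc ≡ o₃)
  ⊎ (os ≡ o₆ × od ≡ o₁₀ × oc ≡ o₅)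
  ⊎ (os ≡ o₁₀ × od ≡ o₆ × oc ≡ o₅)
  ⊎ (os ≡ o₁₀ × od ≡ o₁₀ × oc ≡ o₃)

-- An exhaustive check over 17 orders, that is, 4913 triples.
solutions : ∀ os od oc → trace os ℤ.+ trace od ≡ + 48 ℤ.+ trace oc → Solutions os od oc
solutions = from-yes (∀-order? λ os → ∀-order? λ od → ∀-order? λ oc →
  (trace os ℤ.+ trace od ℤ.≟ + 48 ℤ.+ trace oc) →-dec
  (os ≟ₒ o₁ ⊎-dec od ≟ₒ o₁ ⊎-dec oc ≟ₒ o₂
    ⊎-dec (os ≟ₒ o₆ ×-dec od ≟ₒ o₆ ×-dec oc ≟ₒ generic)
    ⊎-dec (os ≟ₒ o₆ ×-dec od ≟ₒ generic ×-dec oc ≟ₒ o₃)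
    ⊎-dec (os ≟ₒ generic ×-dec od ≟ₒ o₆ ×-dec oc ≟ₒ o₃)
    ⊎-dec (os ≟ₒ o₆ ×-dec od ≟ₒ o₁₀ ×-dec oc ≟ₒ o₅)
    ⊎-dec (os ≟ₒ o₁₀ ×-dec od ≟ₒ o₆ ×-dec oc ≟ₒ o₅)
    ⊎-dec (os ≟ₒ o₁₀ ×-dec od ≟ₒ o₁₀ ×-dec oc ≟ₒ o₃)))

-- Roots of unity of small order

Anti : (ℤ → ℤ) → ℤ → Set
Anti u e = sh e ≈[ u ] con -1ℤ

quint : ℤ → Op
quint e = con 1ℤ ⊕ sh e ⊕ sh (+ 2 ℤ.* e) ⊕ sh (+ 3 ℤ.* e) ⊕ sh (+ 4 ℤ.* e)

-- The field `sum` is a cyclotomic equation for T^e: Φ₆ here, Φ₃ and Φ₅ in `Order₃` and `Order₅`; in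
-- `Order₁₀` it is Φ₅ for T^{2e}. Being relations, these equations pass to multiples of `u`.
record Order₆ (u : ℤ → ℤ) (e : ℤ) : Set where
  field
    anti : Anti u (+ 3 ℤ.* e)
    sum  : sh (+ 2 ℤ.* e) ⊕ con 1ℤ ≈[ u ] sh e

Order₄ : (ℤ → ℤ) → ℤ → Set
Order₄ u e = Anti u (+ 2 ℤ.* e)

record Order₃ (u : ℤ → ℤ) (e : ℤ) : Set where
  field
    fixed : Fixes u (+ 3 ℤ.* e)
    sum   : con 1ℤ ⊕ sh e ⊕ sh (+ 2 ℤ.* e) ≈[ u ] con 0ℤ

record Order₁₀ (u : ℤ → ℤ) (e : ℤ) : Set where
  field
    fixed : Fixes u (+ 10 ℤ.* e)
    anti  : Anti u (+ 5 ℤ.* e)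
    sum   : quint (+ 2 ℤ.* e) ≈[ u ] con 0ℤ

record Order₅ (u : ℤ → ℤ) (e : ℤ) : Set where
  field
    fixed : Fixes u (+ 5 ℤ.* e)
    sum   : quint e ≈[ u ] con 0ℤ

con≢0 : ∀ {u} → NonZeroFun u → ∀ {k} → k ≢ 0ℤ → ¬ con k ≈[ u ] con 0ℤ
con≢0 nz k≢0 h = k≢0 (con-injective nz h)

module _ {u : ℤ → ℤ} where
  open OpRing u
  open OpSolver u
  open SetoidReasoning setoid

  sh-1* : ∀ e → sh (+ 1 ℤ.* e) ≈[ u ] sh e
  sh-1* e = sh-≡ (ℤₚ.*-identityˡ e)

  sh-inverse : ∀ e → sh e ⊗ sh (ℤ.- e) ≈[ u ] con 1ℤ
  sh-inverse e = ≈-trans (≈-sym (sh-+ e (ℤ.- e))) (≈-trans (sh-≡ (ℤₚ.+-inverseʳ e)) sh-0)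

  sh-reduce : ∀ {n e} → Fixes u (+ n ℤ.* e) → ∀ k q → sh (+ (k ℕ.+ q ℕ.* n) ℤ.* e) ≈[ u ] sh (+ k ℤ.* e)
  sh-reduce {n} {e} h k q = begin
    sh (+ (k ℕ.+ q ℕ.* n) ℤ.* e)                 ≈⟨ sh-*+ k (q ℕ.* n) e ⟩
    sh (+ k ℤ.* e) ⊗ sh (+ (q ℕ.* n) ℤ.* e)      ≈⟨ *-congˡ (≈-trans (sh-≡ assoc) (fixes-ℕ* q h)) ⟩
    sh (+ k ℤ.* e) ⊗ con 1ℤ                      ≈⟨ *-identityʳ _ ⟩
    sh (+ k ℤ.* e)                               ∎
    where
    assoc : + (q ℕ.* n) ℤ.* e ≡ + q ℤ.* (+ n ℤ.* e)
    assoc = trans (cong (ℤ._* e) (ℤₚ.pos-* q n)) (ℤₚ.*-assoc (+ q) (+ n) e)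

  -- A Bézout certificate without subtraction; for numerals it is checked by `refl`.
  fixes-combine : ∀ {a b e} → Fixes u (+ a ℤ.* e) → Fixes u (+ b ℤ.* e) →
    ∀ r p q → r ℕ.+ q ℕ.* b ≡ p ℕ.* a → Fixes u (+ r ℤ.* e)
  fixes-combine {a} {b} {e} ha hb r p q eq = begin
    sh (+ r ℤ.* e)                 ≈⟨ sh-reduce hb r q ⟨
    sh (+ (r ℕ.+ q ℕ.* b) ℤ.* e)   ≈⟨ sh-≡ (cong (λ x → + x ℤ.* e) eq) ⟩
    sh (+ (p ℕ.* a) ℤ.* e)         ≈⟨ sh-reduce ha 0 p ⟩
    sh (+ 0 ℤ.* e)                 ≈⟨ sh-0 ⟩
    con 1ℤ                         ∎

  fixes-multiple : ∀ n a {e} → Fixes u (+ a ℤ.* e) → Fixes u (+ (n ℕ.* a) ℤ.* e)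
  fixes-multiple n a h = ≈-trans (sh-reduce h 0 n) sh-0

  anti-fixes : ∀ {e} → Anti u e → Fixes u (+ 2 ℤ.* e)
  anti-fixes {e} h = begin
    sh (+ 2 ℤ.* e)    ≈⟨ sh-*+ 1 1 e ⟩
    sh (+ 1 ℤ.* e) ⊗ sh (+ 1 ℤ.* e) ≈⟨ *-cong (≈-trans (sh-1* e) h) (≈-trans (sh-1* e) h) ⟩
    con -1ℤ ⊗ con -1ℤ ≈⟨ solve 0 ((# -1ℤ) :* (# -1ℤ) := # 1ℤ) ≈-refl ⟩
    con 1ℤ            ∎

  anti-odd : ∀ j {e} → Anti u e → Anti u (+ suc (2 ℕ.* j) ℤ.* e)
  anti-odd j {e} h = ≈-trans
    (sh-≡ (cong (λ x → + suc x ℤ.* e) (ℕₚ.*-comm 2 j)))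
    (≈-trans (sh-reduce (anti-fixes h) 1 j) (≈-trans (sh-1* e) h))

  ¬anti-fixes : NonZeroFun u → ∀ {e} → Anti u e → ¬ Fixes u e
  ¬anti-fixes nz h k with con-injective nz (≈-trans (≈-sym h) k)
  ... | ()

  sum₂ : ∀ t e → Component u t 2 e false → Anti u (+ t ℤ.* e)
  sum₂ t e h = begin
    x                             ≈⟨ solve 1 (λ x → x := (# 1ℤ :+ (x :+ # 0ℤ)) :+ # -1ℤ) ≈-refl x ⟩
    con 1ℤ ⊕ (x ⊕ con 0ℤ) ⊕ con -1ℤ
      ≈⟨ +-congʳ (+-cong (≈-trans (sh-≡ (cong (λ k → + k ℤ.* e) (ℕₚ.*-zeroʳ t))) sh-0)
           (+-congʳ (sh-≡ (cong (λ k → + k ℤ.* e) (ℕₚ.*-identityʳ t))))) ⟨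
    sumSh e (multiples t 0 2) ⊕ con -1ℤ ≈⟨ +-congʳ h ⟩
    con 0ℤ ⊕ con -1ℤ              ≈⟨ +-identityˡ _ ⟩
    con -1ℤ                       ∎
    where x = sh (+ t ℤ.* e)

  sum₃ : ∀ e → Component u 70 3 e false → con 1ℤ ⊕ sh (+ 70 ℤ.* e) ⊕ sh (+ 140 ℤ.* e) ≈[ u ] con 0ℤ
  sum₃ e h = begin
    con 1ℤ ⊕ x ⊕ y                 ≈⟨ +-congʳ (+-congʳ sh-0) ⟨
    sh 0ℤ ⊕ x ⊕ y                  ≈⟨ solve 3 (λ a x y → a :+ x :+ y := a :+ (x :+ (y :+ # 0ℤ))) ≈-refl (sh 0ℤ) x y ⟩
    sumSh e (multiples 70 0 3)     ≈⟨ h ⟩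
    con 0ℤ                         ∎
    where
    x = sh (+ 70 ℤ.* e)
    y = sh (+ 140 ℤ.* e)

  sum₅ : ∀ e → Component u 42 5 e false →
    con 1ℤ ⊕ sh (+ 42 ℤ.* e) ⊕ sh (+ 84 ℤ.* e) ⊕ sh (+ 126 ℤ.* e) ⊕ sh (+ 168 ℤ.* e) ≈[ u ] con 0ℤ
  sum₅ e h = begin
    con 1ℤ ⊕ x ⊕ y ⊕ z ⊕ w         ≈⟨ +-congʳ (+-congʳ (+-congʳ (+-congʳ sh-0))) ⟨
    sh 0ℤ ⊕ x ⊕ y ⊕ z ⊕ w          ≈⟨ solve 5 (λ a x y z w → a :+ x :+ y :+ z :+ w := a :+ (x :+ (y :+ (z :+ (w :+ # 0ℤ))))) ≈-refl
                                       (sh 0ℤ) x y z w ⟩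
    sumSh e (multiples 42 0 5)     ≈⟨ h ⟩
    con 0ℤ                         ∎
    where
    x = sh (+ 42 ℤ.* e)
    y = sh (+ 84 ℤ.* e)
    z = sh (+ 126 ℤ.* e)
    w = sh (+ 168 ℤ.* e)

  hasOrder₁ : ∀ {m e} → HasOrder u m e o₁ → Fixes u e
  hasOrder₁ {m} {e} (_ , h₂ , h₃ , h₅ , h₇) = ≈-trans (≈-sym (sh-1* e))
    (fixes-combine {15} {14} {e} fix₁₅ fix₁₄ 1 1 1 refl)
    where
    fix₁₅ : Fixes u (+ 15 ℤ.* e)
    fix₁₅ = fixes-combine {105} {30} {e} h₂ h₇ 15 1 3 refl
    fix₁₄ : Fixes u (+ 14 ℤ.* e)
    fix₁₄ = fixes-combine {70} {42} {e} h₃ h₅ 14 2 3 refl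

  hasOrder₂ : ∀ {m e} → HasOrder u m e o₂ → Anti u e
  hasOrder₂ {m} {e} (_ , h₂ , h₃ , h₅ , h₇) = ≈-trans (≈-sym (sh-1* e))
    (≈-trans (≈-sym (sh-reduce {2} {e} fix₂ 1 52)) (sum₂ 105 e h₂))
    where
    fix₁₄ : Fixes u (+ 14 ℤ.* e)
    fix₁₄ = fixes-combine {70} {42} {e} h₃ h₅ 14 2 3 refl
    fix₂ : Fixes u (+ 2 ℤ.* e)
    fix₂ = fixes-combine {30} {14} {e} h₇ fix₁₄ 2 1 2 refl

  hasOrder₆ : ∀ {m e} → HasOrder u m e o₆ → Order₆ u e
  hasOrder₆ {m} {e} (_ , h₂ , h₃ , h₅ , h₇) = record
    { anti = anti
    ; sum  = begin
        sh (+ 2 ℤ.* e) ⊕ con 1ℤ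
          ≈⟨ solve 2 (λ x y → y :+ # 1ℤ := (# 1ℤ :+ (# -1ℤ) :* x :+ y) :+ x) ≈-refl (sh e) (sh (+ 2 ℤ.* e)) ⟩
        (con 1ℤ ⊕ con -1ℤ ⊗ sh e ⊕ sh (+ 2 ℤ.* e)) ⊕ sh e
          ≈⟨ +-congʳ (+-cong (+-congˡ sh70) (sh-reduce {6} {e} fix₆ 2 23)) ⟨
        (con 1ℤ ⊕ sh (+ 70 ℤ.* e) ⊕ sh (+ 140 ℤ.* e)) ⊕ sh e
          ≈⟨ +-congʳ (sum₃ e h₃) ⟩
        con 0ℤ ⊕ sh e
          ≈⟨ +-identityˡ _ ⟩
        sh e ∎ }
    where
    fix₆ : Fixes u (+ 6 ℤ.* e)
    fix₆ = fixes-combine {42} {30} {e} h₅ h₇ 6 3 4 refl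
    anti : Anti u (+ 3 ℤ.* e)
    anti = ≈-trans (≈-sym (sh-reduce {6} {e} fix₆ 3 17)) (sum₂ 105 e h₂)
    -- 70 ≡ 4 modulo 6 and T^{3e} = -1, so the cube root of unity T^{70e} is -T^e; and Φ₃(-x) =
    -- Φ₆(x).
    sh70 : sh (+ 70 ℤ.* e) ≈[ u ] con -1ℤ ⊗ sh e
    sh70 = ≈-trans (sh-reduce {6} {e} fix₆ 4 11) (≈-trans (sh-*+ 3 1 e) (*-cong anti (sh-1* e)))

  hasOrder₃ : ∀ {m e} → HasOrder u m e o₃ → Order₃ u e
  hasOrder₃ {m} {e} (_ , h₂ , h₃ , h₅ , h₇) = record
    { fixed = fix₃
    ; sum   = ≈-trans
        (≈-sym (+-cong (+-congˡ (≈-trans (sh-reduce {3} {e} fix₃ 1 23) (sh-1* e))) (sh-reduce {3} {e} fix₃ 2 46)))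
        (sum₃ e h₃) }
    where
    fix₆ : Fixes u (+ 6 ℤ.* e)
    fix₆ = fixes-combine {42} {30} {e} h₅ h₇ 6 3 4 refl
    fix₃ : Fixes u (+ 3 ℤ.* e)
    fix₃ = fixes-combine {105} {6} {e} h₂ fix₆ 3 1 17 refl

  hasOrder₅ : ∀ {m e} → HasOrder u m e o₅ → Order₅ u e
  hasOrder₅ {m} {e} (_ , h₂ , h₃ , h₅ , h₇) = record
    { fixed = fix₅
    ; sum   = begin
        con 1ℤ ⊕ sh e ⊕ sh (+ 2 ℤ.* e) ⊕ sh (+ 3 ℤ.* e) ⊕ sh (+ 4 ℤ.* e)
          -- 42 ≡ 2 modulo 5, so the powers of T^{42e} are those of T^e in the order 0, 2, 4, 1, 3.
          ≈⟨ solve 4 (λ x y z w → # 1ℤ :+ x :+ y :+ z :+ w := # 1ℤ :+ y :+ w :+ x :+ z) ≈-refl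
               (sh e) (sh (+ 2 ℤ.* e)) (sh (+ 3 ℤ.* e)) (sh (+ 4 ℤ.* e)) ⟩
        con 1ℤ ⊕ sh (+ 2 ℤ.* e) ⊕ sh (+ 4 ℤ.* e) ⊕ sh e ⊕ sh (+ 3 ℤ.* e)
          ≈⟨ +-cong (+-cong (+-cong (+-congˡ (sh-reduce {5} {e} fix₅ 2 8)) (sh-reduce {5} {e} fix₅ 4 16))
               (≈-trans (sh-reduce {5} {e} fix₅ 1 25) (sh-1* e))) (sh-reduce {5} {e} fix₅ 3 33) ⟨
        con 1ℤ ⊕ sh (+ 42 ℤ.* e) ⊕ sh (+ 84 ℤ.* e) ⊕ sh (+ 126 ℤ.* e) ⊕ sh (+ 168 ℤ.* e)
          ≈⟨ sum₅ e h₅ ⟩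
        con 0ℤ ∎ }
    where
    fix₁₀ : Fixes u (+ 10 ℤ.* e)
    fix₁₀ = fixes-combine {70} {30} {e} h₃ h₇ 10 1 2 refl
    fix₅ : Fixes u (+ 5 ℤ.* e)
    fix₅ = fixes-combine {105} {10} {e} h₂ fix₁₀ 5 1 10 refl

  hasOrder₁₀ : ∀ {m e} → HasOrder u m e o₁₀ → Order₁₀ u e
  hasOrder₁₀ {m} {e} (_ , h₂ , h₃ , h₅ , h₇) = record
    { fixed = fix₁₀
    ; anti  = ≈-trans (≈-sym (sh-reduce {10} {e} fix₁₀ 5 10)) (sum₂ 105 e h₂)
    ; sum   = ≈-trans
        (≈-sym (+-cong (+-cong (+-cong (+-congˡ (sh-reduce {10} {e} fix₁₀ 2 4)) (double 2 8))
          (double 3 12)) (double 4 16)))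
        (sum₅ e h₅) }
    where
    fix₁₀ : Fixes u (+ 10 ℤ.* e)
    fix₁₀ = fixes-combine {70} {30} {e} h₃ h₇ 10 1 2 refl
    double : ∀ j q → sh (+ (j ℕ.* 2 ℕ.+ q ℕ.* 10) ℤ.* e) ≈[ u ] sh (+ j ℤ.* (+ 2 ℤ.* e))
    double j q = ≈-trans (sh-reduce {10} {e} fix₁₀ (j ℕ.* 2) q) (sh-≡
      (trans (cong (ℤ._* e) (ℤₚ.pos-* j 2)) (ℤₚ.*-assoc (+ j) (+ 2) e)))

  order₆-fixed : ∀ {e} → Order₆ u e → Fixes u (+ 6 ℤ.* e)
  order₆-fixed {e} o = ≈-trans (sh-≡ (ℤₚ.*-assoc (+ 2) (+ 3) e)) (anti-fixes (Order₆.anti o))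

  order₆-cos : ∀ {e} → Order₆ u e → cos e ≈[ u ] con 1ℤ
  order₆-cos {e} o = begin
    x ⊕ x⁻                 ≈⟨ solve 2 (λ x y → x :+ y := (x :* x :+ # 1ℤ) :* y :+ x :* (# 1ℤ :- x :* y)) ≈-refl x x⁻ ⟩
    (x ⊗ x ⊕ con 1ℤ) ⊗ x⁻ ⊕ x ⊗ (con 1ℤ ⊕ con -1ℤ ⊗ (x ⊗ x⁻))
      ≈⟨ +-cong (*-congʳ (≈-trans (+-congʳ (≈-sym square)) (Order₆.sum o)))
                (*-congˡ (+-congˡ (*-congˡ (sh-inverse e)))) ⟩
    x ⊗ x⁻ ⊕ x ⊗ (con 1ℤ ⊕ con -1ℤ ⊗ con 1ℤ) ≈⟨ +-congʳ (sh-inverse e) ⟩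
    con 1ℤ ⊕ x ⊗ (con 1ℤ ⊕ con -1ℤ ⊗ con 1ℤ) ≈⟨ solve 1 (λ x → # 1ℤ :+ x :* (# 1ℤ :+ (# -1ℤ) :* # 1ℤ) := # 1ℤ) ≈-refl x ⟩
    con 1ℤ                 ∎
    where
    x = sh e
    x⁻ = sh (ℤ.- e)
    square : sh (+ 2 ℤ.* e) ≈[ u ] x ⊗ x
    square = ≈-trans (sh-*+ 1 1 e) (*-cong (sh-1* e) (sh-1* e))

  order₃-cos : ∀ {e} → Order₃ u e → cos e ≈[ u ] con -1ℤ
  order₃-cos {e} o = begin
    x ⊕ sh (ℤ.- e)   ≈⟨ +-congˡ neg ⟩
    x ⊕ y            ≈⟨ solve 2 (λ x y → x :+ y := (# 1ℤ :+ x :+ y) :+ # -1ℤ) ≈-refl x y ⟩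
    (con 1ℤ ⊕ x ⊕ y) ⊕ con -1ℤ ≈⟨ +-congʳ (Order₃.sum o) ⟩
    con 0ℤ ⊕ con -1ℤ ≈⟨ +-identityˡ _ ⟩
    con -1ℤ          ∎
    where
    x = sh e
    y = sh (+ 2 ℤ.* e)
    neg : sh (ℤ.- e) ≈[ u ] y
    neg = begin
      sh (ℤ.- e)                     ≈⟨ *-identityˡ _ ⟨
      con 1ℤ ⊗ sh (ℤ.- e)            ≈⟨ *-congʳ (Order₃.fixed o) ⟨
      sh (+ 3 ℤ.* e) ⊗ sh (ℤ.- e)    ≈⟨ *-congʳ (≈-trans (sh-*+ 2 1 e) (*-congˡ (sh-1* e))) ⟩
      y ⊗ x ⊗ sh (ℤ.- e)             ≈⟨ *-assoc y x (sh (ℤ.- e)) ⟩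
      y ⊗ (x ⊗ sh (ℤ.- e))           ≈⟨ *-congˡ (sh-inverse e) ⟩
      y ⊗ con 1ℤ                     ≈⟨ *-identityʳ y ⟩
      y                              ∎

  cos-0⇒order₄ : ∀ {e} → cos e ≈[ u ] con 0ℤ → Order₄ u e
  cos-0⇒order₄ {e} h = begin
    sh (+ 2 ℤ.* e)        ≈⟨ ≈-trans (sh-*+ 1 1 e) (*-cong (sh-1* e) (sh-1* e)) ⟩
    x ⊗ x                 ≈⟨ solve 2 (λ x y → x :* x := x :* (x :+ y) :- x :* y) ≈-refl x x⁻ ⟩
    x ⊗ (x ⊕ x⁻) ⊕ con -1ℤ ⊗ (x ⊗ x⁻) ≈⟨ +-cong (*-congˡ h) (*-congˡ (sh-inverse e)) ⟩
    x ⊗ con 0ℤ ⊕ con -1ℤ ⊗ con 1ℤ     ≈⟨ solve 1 (λ x → x :* # 0ℤ :+ (# -1ℤ) :* # 1ℤ := # -1ℤ) ≈-refl x ⟩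
    con -1ℤ               ∎
    where
    x = sh e
    x⁻ = sh (ℤ.- e)

  -- For x = T^e, Φ₆(x) = 0 and x² = 1 give x = 2, hence 4 = 1 and 3 = 0 on `u`.
  order₆-¬fixes : NonZeroFun u → ∀ {e} → Order₆ u e → ¬ Fixes u (+ 2 ℤ.* e)
  order₆-¬fixes nz {e} o h = con≢0 nz {+ 3} (λ ()) (begin
    con (+ 3)                       ≈⟨ solve 0 (# (+ 3) := (# 1ℤ :+ # 1ℤ) :* (# 1ℤ :+ # 1ℤ) :- # 1ℤ) ≈-refl ⟩
    (con 1ℤ ⊕ con 1ℤ) ⊗ (con 1ℤ ⊕ con 1ℤ) ⊕ con -1ℤ ⊗ con 1ℤ ≈⟨ +-congʳ (*-cong two two) ⟩
    x ⊗ x ⊕ con -1ℤ ⊗ con 1ℤ        ≈⟨ +-congʳ (≈-trans (sh-*+ 1 1 e) (*-cong (sh-1* e) (sh-1* e))) ⟨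
    sh (+ 2 ℤ.* e) ⊕ con -1ℤ ⊗ con 1ℤ ≈⟨ +-congʳ h ⟩
    con 1ℤ ⊕ con -1ℤ ⊗ con 1ℤ       ≈⟨ solve 0 (# 1ℤ :- # 1ℤ := # 0ℤ) ≈-refl ⟩
    con 0ℤ                          ∎)
    where
    x = sh e
    two : con 1ℤ ⊕ con 1ℤ ≈[ u ] x
    two = ≈-trans (+-congʳ (≈-sym h)) (Order₆.sum o)

  order₃-¬fixes : NonZeroFun u → ∀ {e} → Order₃ u e → ¬ Fixes u e
  order₃-¬fixes nz {e} o h = con≢0 nz {+ 3} (λ ()) (begin
    con (+ 3)                          ≈⟨ solve 0 (# (+ 3) := # 1ℤ :+ # 1ℤ :+ # 1ℤ) ≈-refl ⟩
    con 1ℤ ⊕ con 1ℤ ⊕ con 1ℤ           ≈⟨ +-cong (+-congˡ h) (fixes-ℕ* 2 h) ⟨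
    con 1ℤ ⊕ sh e ⊕ sh (+ 2 ℤ.* e)     ≈⟨ Order₃.sum o ⟩
    con 0ℤ                             ∎)

  quint-¬fixes : NonZeroFun u → ∀ {e} → quint e ≈[ u ] con 0ℤ → ¬ Fixes u e
  quint-¬fixes nz {e} o h = con≢0 nz {+ 5} (λ ()) (begin
    con (+ 5)                          ≈⟨ solve 0 (# (+ 5) := # 1ℤ :+ # 1ℤ :+ # 1ℤ :+ # 1ℤ :+ # 1ℤ) ≈-refl ⟩
    con 1ℤ ⊕ con 1ℤ ⊕ con 1ℤ ⊕ con 1ℤ ⊕ con 1ℤ
      ≈⟨ +-cong (+-cong (+-cong (+-congˡ h) (fixes-ℕ* 2 h)) (fixes-ℕ* 3 h)) (fixes-ℕ* 4 h) ⟨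
    quint e                            ≈⟨ o ⟩
    con 0ℤ                             ∎)

  order₁₀-cos : ∀ {e} → Order₁₀ u e → let z = + 2 ℤ.* e in
    cos e ≈[ u ] con -1ℤ ⊗ (sh (+ 2 ℤ.* z) ⊕ sh (+ 3 ℤ.* z))
  order₁₀-cos {e} o = begin
    sh e ⊕ sh (ℤ.- e)           ≈⟨ +-cong left right ⟩
    con -1ℤ ⊗ y ⊕ con -1ℤ ⊗ x   ≈⟨ solve 2 (λ x y → (# -1ℤ) :* y :+ (# -1ℤ) :* x := (# -1ℤ) :* (x :+ y)) ≈-refl x y ⟩
    con -1ℤ ⊗ (x ⊕ y)           ∎
    where
    x = sh (+ 2 ℤ.* (+ 2 ℤ.* e))
    y = sh (+ 3 ℤ.* (+ 2 ℤ.* e))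
    left : sh e ≈[ u ] con -1ℤ ⊗ y
    left = begin
      sh e                           ≈⟨ solve 1 (λ x → x := (# -1ℤ) :* ((# -1ℤ) :* x)) ≈-refl (sh e) ⟩
      con -1ℤ ⊗ (con -1ℤ ⊗ sh e)     ≈⟨ *-congˡ (*-cong (Order₁₀.anti o) (sh-1* e)) ⟨
      con -1ℤ ⊗ (sh (+ 5 ℤ.* e) ⊗ sh (+ 1 ℤ.* e)) ≈⟨ *-congˡ (sh-*+ 5 1 e) ⟨
      con -1ℤ ⊗ sh (+ 6 ℤ.* e)       ≈⟨ *-congˡ (sh-≡ (ℤₚ.*-assoc (+ 3) (+ 2) e)) ⟩
      con -1ℤ ⊗ y                    ∎
    right : sh (ℤ.- e) ≈[ u ] con -1ℤ ⊗ x
    right = begin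
      sh (ℤ.- e)                     ≈⟨ solve 1 (λ x → x := (# -1ℤ) :* ((# -1ℤ) :* x)) ≈-refl (sh (ℤ.- e)) ⟩
      con -1ℤ ⊗ (con -1ℤ ⊗ sh (ℤ.- e)) ≈⟨ *-congˡ (*-congʳ (Order₁₀.anti o)) ⟨
      con -1ℤ ⊗ (sh (+ 5 ℤ.* e) ⊗ sh (ℤ.- e)) ≈⟨ *-congˡ (*-congʳ (≈-trans (sh-*+ 4 1 e) (*-congˡ (sh-1* e)))) ⟩
      con -1ℤ ⊗ (sh (+ 4 ℤ.* e) ⊗ sh e ⊗ sh (ℤ.- e)) ≈⟨ *-congˡ (≈-trans (*-assoc _ _ _) (*-congˡ (sh-inverse e))) ⟩
      con -1ℤ ⊗ (sh (+ 4 ℤ.* e) ⊗ con 1ℤ) ≈⟨ *-congˡ (*-identityʳ _) ⟩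
      con -1ℤ ⊗ sh (+ 4 ℤ.* e)       ≈⟨ *-congˡ (sh-≡ (ℤₚ.*-assoc (+ 2) (+ 2) e)) ⟩
      con -1ℤ ⊗ x                    ∎

  order₁₀-cos₄ : ∀ {e} → Order₁₀ u e → let z = + 2 ℤ.* e in
    cos (+ 4 ℤ.* e) ≈[ u ] sh (+ 2 ℤ.* z) ⊕ sh (+ 3 ℤ.* z)
  order₁₀-cos₄ {e} o = +-cong (sh-≡ (ℤₚ.*-assoc (+ 2) (+ 2) e)) (begin
    sh (ℤ.- (+ 4 ℤ.* e))                            ≈⟨ *-identityˡ _ ⟨
    con 1ℤ ⊗ sh (ℤ.- (+ 4 ℤ.* e))                   ≈⟨ *-congʳ (Order₁₀.fixed o) ⟨
    sh (+ 10 ℤ.* e) ⊗ sh (ℤ.- (+ 4 ℤ.* e))          ≈⟨ *-congʳ (sh-*+ 6 4 e) ⟩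
    sh (+ 6 ℤ.* e) ⊗ sh (+ 4 ℤ.* e) ⊗ sh (ℤ.- (+ 4 ℤ.* e)) ≈⟨ ≈-trans (*-assoc _ _ _) (*-congˡ (sh-inverse (+ 4 ℤ.* e))) ⟩
    sh (+ 6 ℤ.* e) ⊗ con 1ℤ                         ≈⟨ *-identityʳ _ ⟩
    sh (+ 6 ℤ.* e)                                  ≈⟨ sh-≡ (ℤₚ.*-assoc (+ 3) (+ 2) e) ⟩
    sh (+ 3 ℤ.* (+ 2 ℤ.* e))                        ∎)

  -- With 1 + z + z² + z³ + z⁴ = 0, the number 2 (z² + z³) + 1 is a square root of 5.
  quint-irrational : NonZeroFun u → ∀ {e} → quint e ≈[ u ] con 0ℤ →
    ¬ con (+ 2) ⊗ (sh (+ 2 ℤ.* e) ⊕ sh (+ 3 ℤ.* e)) ⊕ con 1ℤ ≈[ u ] con 0ℤ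
  quint-irrational nz {e} q h = con≢0 nz {+ 5} (λ ()) (begin
    con (+ 5)
      ≈⟨ solve 1 (λ z →
           let q = # 1ℤ :+ z :+ z :* z :+ z :* (z :* z) :+ z :* (z :* (z :* z))
               b = # (+ 2) :* (z :* z :+ z :* (z :* z)) :+ # 1ℤ in
           # (+ 5) := b :* b :+ q :* (# (+ 4) :+ (# -[1+ 3 ]) :* (z :+ z :* z))) ≈-refl z ⟩
    b ⊗ b ⊕ q′ ⊗ k                ≈⟨ +-cong (*-cong b≈0 b≈0) (*-congʳ (≈-trans (≈-sym q≈) q)) ⟩
    con 0ℤ ⊗ con 0ℤ ⊕ con 0ℤ ⊗ k  ≈⟨ solve 1 (λ k → # 0ℤ :* # 0ℤ :+ # 0ℤ :* k := # 0ℤ) ≈-refl k ⟩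
    con 0ℤ ∎)
    where
    z = sh e
    q′ = con 1ℤ ⊕ z ⊕ z ⊗ z ⊕ z ⊗ (z ⊗ z) ⊕ z ⊗ (z ⊗ (z ⊗ z))
    b = con (+ 2) ⊗ (z ⊗ z ⊕ z ⊗ (z ⊗ z)) ⊕ con 1ℤ
    k = con (+ 4) ⊕ con -[1+ 3 ] ⊗ (z ⊕ z ⊗ z)
    sh₂ : sh (+ 2 ℤ.* e) ≈[ u ] z ⊗ z
    sh₂ = ≈-trans (sh-*+ 1 1 e) (*-cong (sh-1* e) (sh-1* e))
    sh₃ : sh (+ 3 ℤ.* e) ≈[ u ] z ⊗ (z ⊗ z)
    sh₃ = ≈-trans (sh-*+ 1 2 e) (*-cong (sh-1* e) sh₂)
    sh₄ : sh (+ 4 ℤ.* e) ≈[ u ] z ⊗ (z ⊗ (z ⊗ z))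
    sh₄ = ≈-trans (sh-*+ 1 3 e) (*-cong (sh-1* e) sh₃)
    q≈ : quint e ≈[ u ] q′
    q≈ = +-cong (+-cong (+-congˡ sh₂) sh₃) sh₄
    b≈0 : b ≈[ u ] con 0ℤ
    b≈0 = ≈-trans (≈-sym (+-congʳ (*-congˡ (+-cong sh₂ sh₃)))) h

-- Ideals of periods and nontrivial functions

record Ideal (P : ℤ → Set) : Set where
  field
    +-closed : ∀ {x y} → P x → P y → P (x ℤ.+ y)
    *-closed : ∀ k {x} → P x → P (k ℤ.* x)

module _ {P : ℤ → Set} (ideal : Ideal P) where
  open Ideal ideal

  ideal-abs : ∀ x → P x → P (+ ∣ x ∣)
  ideal-abs (+ n)      h = h
  ideal-abs -[1+ n ]   h = subst P (ℤₚ.-1*i≡-i -[1+ n ]) (*-closed -1ℤ h)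

  ideal-bézout : ∀ {d a b} p q → d ℕ.+ q ℕ.* b ≡ p ℕ.* a → P (+ a) → P (+ b) → P (+ d)
  ideal-bézout {d} {a} {b} p q eq ha hb = subst P combination (+-closed (*-closed (+ p) ha) (*-closed (ℤ.- + q) hb))
    where
    open ≡-Reasoning
    combination : + p ℤ.* + a ℤ.+ ℤ.- + q ℤ.* + b ≡ + d
    combination = begin
      + p ℤ.* + a ℤ.+ ℤ.- + q ℤ.* + b
        ≡⟨ cong (ℤ._+ ℤ.- + q ℤ.* + b) (trans (sym (ℤₚ.pos-* p a)) (trans (cong +_ (sym eq))
             (trans (ℤₚ.pos-+ d (q ℕ.* b)) (cong (λ t → + d ℤ.+ t) (ℤₚ.pos-* q b))))) ⟩
      + d ℤ.+ + q ℤ.* + b ℤ.+ ℤ.- + q ℤ.* + b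
        ≡⟨ solve 3 (λ d q b → d :+ q :* b :+ (:- q) :* b := d) refl (+ d) (+ q) (+ b) ⟩
      + d ∎
      where open ℤ-Solver

  ideal-gcd : ∀ x y → P x → P y → P (+ gcdℤ x y)
  ideal-gcd x y hx hy with Bézout.identity (gcd-GCD ∣ x ∣ ∣ y ∣)
  ... | Bézout.+- p q eq = ideal-bézout p q eq (ideal-abs x hx) (ideal-abs y hy)
  ... | Bézout.-+ p q eq = ideal-bézout q p eq (ideal-abs y hy) (ideal-abs x hx)

  -- The use of (i): an ideal containing `m`, `x` and `y` contains their greatest common divisor,
  -- which is 1.
  ideal-coprime : ∀ {m} x y → Coprime m (gcdℤ x y) → P (+ m) → P x → P y → P 1ℤ
  ideal-coprime {m} x y cop hm hx hy =
    subst (λ g → P (+ g)) (coprime⇒gcd≡1 cop) (ideal-gcd (+ m) (+ gcdℤ x y) hm (ideal-gcd x y hx hy))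

fixes-ideal : ∀ {u} → Ideal (Fixes u)
fixes-ideal = record { +-closed = fixes-+ ; *-closed = fixes-* }

-- 1 belongs to this ideal iff `n` is a period, which reduces statements on T^n to exponents prime
-- to each other.
scaled-ideal : ∀ n {u} → Ideal (λ x → Fixes u (n ℤ.* x))
scaled-ideal n {u} = record
  { +-closed = λ {x} {y} h k → subst (Fixes u) (sym (ℤₚ.*-distribˡ-+ n x y)) (fixes-+ h k)
  ; *-closed = λ k {x} h → subst (Fixes u) (swap k x) (fixes-* k h) }
  where
  open ℤ-Solver
  swap : ∀ k x → k ℤ.* (n ℤ.* x) ≡ n ℤ.* (k ℤ.* x)
  swap k x = solve 3 (λ n k x → k :* (n :* x) := n :* (k :* x)) refl n k x

-- `zeroSum` expresses orthogonality to the constants. Unlike being nonconstant, it is a relation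
-- and therefore inherited along `⊑`.
record Nontrivial (m : ℕ) (u : ℤ → ℤ) : Set where
  field
    nonzero  : NonZeroFun u
    periodic : Fixes u (+ m)
    zeroSum  : sumSh 1ℤ (multiples 1 0 m) ≈[ u ] con 0ℤ
open Nontrivial

nontrivial-⊑ : ∀ {m u v} → u ⊑ v → NonZeroFun v → Nontrivial m u → Nontrivial m v
nontrivial-⊑ le nz h = record { nonzero = nz ; periodic = le (periodic h) ; zeroSum = le (zeroSum h) }

-- With T = 1 the vanishing sum over a period would be the integer m.
nontrivial-¬fixes : ∀ {m} .{{_ : ℕ.NonZero m}} {u} → Nontrivial m u → ¬ Fixes u 1ℤ
nontrivial-¬fixes {suc m} {u} nt h with con-injective (nonzero nt)
  (≈-trans (≈-sym (sumSh-fixed 1 1ℤ 0 (suc m) h)) (zeroSum nt))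
  where open OpRing u
... | ()

-- Relations between two cosines

cos-neg : ∀ {u} e → cos (ℤ.- e) ≈[ u ] cos e
cos-neg {u} e = ≈-trans (+-congˡ (sh-≡ (ℤₚ.neg-involutive e))) (+-comm _ _)
  where open OpRing u

cos-≡ : ∀ {u e f} → e ≡ f → cos e ≈[ u ] cos f
cos-≡ refl = mk λ _ → refl

cos-0 : ∀ {u} → cos 0ℤ ≈[ u ] con 1ℤ ⊕ con 1ℤ
cos-0 {u} = +-cong sh-0 sh-0
  where open OpRing u

module _ {u : ℤ → ℤ} where
  open OpRing u
  open OpSolver u
  open SetoidReasoning setoid

  -- cos e − cos f = T^{-e} (T^{e+f} − 1)(T^{e-f} − 1) and cos e + cos f = T^{-e} (T^{e+f} + 1)(T^{e-f} + 1).
  cos-product : ∀ k → con k ⊗ con k ≈[ u ] con 1ℤ → ∀ e f → cos e ⊕ con k ⊗ cos f ≈[ u ] con 0ℤ →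
    (sh (e ℤ.+ f) ⊕ con k) ⊗ (sh (e ℤ.+ ℤ.- f) ⊕ con k) ≈[ u ] con 0ℤ
  cos-product k kk e f h = begin
    (sh (e ℤ.+ f) ⊕ con k) ⊗ (sh (e ℤ.+ ℤ.- f) ⊕ con k)
      ≈⟨ *-cong (+-congʳ (sh-+ e f)) (+-congʳ (sh-+ e (ℤ.- f))) ⟩
    (x ⊗ y ⊕ con k) ⊗ (x ⊗ y⁻ ⊕ con k)
      ≈⟨ solve 5 (λ x x⁻ y y⁻ k → (x :* y :+ k) :* (x :* y⁻ :+ k) :=
           x :* (x :+ x⁻ :+ k :* (y :+ y⁻)) :+ x :* x :* (y :* y⁻ :- # 1ℤ) :- (x :* x⁻ :- # 1ℤ) :+ (k :* k :- # 1ℤ))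
           ≈-refl x x⁻ y y⁻ (con k) ⟩
    x ⊗ (cos e ⊕ con k ⊗ cos f) ⊕ x ⊗ x ⊗ (y ⊗ y⁻ ⊕ con -1ℤ ⊗ con 1ℤ)
      ⊕ con -1ℤ ⊗ (x ⊗ x⁻ ⊕ con -1ℤ ⊗ con 1ℤ) ⊕ (con k ⊗ con k ⊕ con -1ℤ ⊗ con 1ℤ)
      ≈⟨ +-cong (+-cong (+-cong (*-congˡ h) (*-congˡ (+-congʳ (sh-inverse f))))
           (*-congˡ (+-congʳ (sh-inverse e)))) (+-congʳ kk) ⟩
    x ⊗ con 0ℤ ⊕ x ⊗ x ⊗ (con 1ℤ ⊕ con -1ℤ ⊗ con 1ℤ)
      ⊕ con -1ℤ ⊗ (con 1ℤ ⊕ con -1ℤ ⊗ con 1ℤ) ⊕ (con 1ℤ ⊕ con -1ℤ ⊗ con 1ℤ)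
      ≈⟨ solve 1 (λ x → x :* # 0ℤ :+ x :* x :* (# 1ℤ :- # 1ℤ) :- (# 1ℤ :- # 1ℤ) :+ (# 1ℤ :- # 1ℤ) := # 0ℤ) ≈-refl x ⟩
    con 0ℤ ∎
    where
    x = sh e
    x⁻ = sh (ℤ.- e)
    y = sh f
    y⁻ = sh (ℤ.- f)

  sum-zero⇒ : ∀ {e} k → sh e ⊕ con k ≈[ u ] con 0ℤ → sh e ≈[ u ] con (ℤ.- k)
  sum-zero⇒ {e} k h = begin
    sh e                                  ≈⟨ solve 2 (λ x k → x := (x :+ k) :- k) ≈-refl (sh e) (con k) ⟩
    (sh e ⊕ con k) ⊕ con -1ℤ ⊗ con k      ≈⟨ +-congʳ h ⟩
    con 0ℤ ⊕ con -1ℤ ⊗ con k              ≈⟨ +-identityˡ _ ⟩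
    con -1ℤ ⊗ con k                       ≈⟨ con-* -1ℤ k ⟨
    con (-1ℤ ℤ.* k)                       ≡⟨ cong con (ℤₚ.-1*i≡-i k) ⟩
    con (ℤ.- k)                           ∎

  cos-difference : ∀ {e f} → cos e ≈[ u ] cos f → cos e ⊕ con -1ℤ ⊗ cos f ≈[ u ] con 0ℤ
  cos-difference {e} {f} h = ≈-trans (+-congʳ h) (solve 1 (λ x → x :- x := # 0ℤ) ≈-refl (cos f))

  fixes-cos : ∀ {e} → Fixes u e → cos e ≈[ u ] con 1ℤ ⊕ con 1ℤ
  fixes-cos h = +-cong h (fixes-neg h)

  anti-neg : ∀ {e} → Anti u e → Anti u (ℤ.- e)
  anti-neg {e} h = begin
    sh (ℤ.- e)                        ≈⟨ solve 1 (λ x → x := (# -1ℤ) :* ((# -1ℤ) :* x)) ≈-refl _ ⟩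
    con -1ℤ ⊗ (con -1ℤ ⊗ sh (ℤ.- e))  ≈⟨ *-congˡ (*-congʳ h) ⟨
    con -1ℤ ⊗ (sh e ⊗ sh (ℤ.- e))     ≈⟨ *-congˡ (sh-inverse e) ⟩
    con -1ℤ ⊗ con 1ℤ                  ≈⟨ *-identityʳ _ ⟩
    con -1ℤ                           ∎

  cos-swap : ∀ {s d c} → CosRel u s d c → CosRel u d s c
  cos-swap h = ≈-trans (+-comm _ _) h

  cos-fixed : ∀ {s d c} → Fixes u s → CosRel u s d c → cos d ≈[ u ] cos c
  cos-fixed {s} {d} {c} hs h = begin
    cos d                             ≈⟨ solve 2 (λ x y → y := (x :+ y) :- x) ≈-refl (cos s) (cos d) ⟩
    (cos s ⊕ cos d) ⊕ con -1ℤ ⊗ cos s ≈⟨ +-cong h (*-congˡ (≈-trans (fixes-cos hs) (≈-sym cos-0))) ⟩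
    (cos 0ℤ ⊕ cos c) ⊕ con -1ℤ ⊗ cos 0ℤ ≈⟨ solve 2 (λ x y → (x :+ y) :- x := y) ≈-refl (cos 0ℤ) (cos c) ⟩
    cos c                             ∎

  cos-anti : ∀ {s d c} → Anti u c → CosRel u s d c → cos s ⊕ con 1ℤ ⊗ cos d ≈[ u ] con 0ℤ
  cos-anti {s} {d} {c} hc h = begin
    cos s ⊕ con 1ℤ ⊗ cos d            ≈⟨ +-congˡ (*-identityˡ _) ⟩
    cos s ⊕ cos d                     ≈⟨ h ⟩
    cos 0ℤ ⊕ cos c                    ≈⟨ +-cong cos-0 (+-cong hc (anti-neg hc)) ⟩
    (con 1ℤ ⊕ con 1ℤ) ⊕ (con -1ℤ ⊕ con -1ℤ) ≈⟨ solve 0 ((# 1ℤ :+ # 1ℤ) :+ (# -1ℤ :+ # -1ℤ) := # 0ℤ) ≈-refl ⟩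
    con 0ℤ                            ∎

-- A substitute for the absence of zero divisors: either `q` kills `u`, or `p` kills the nonzero
-- function `⟦ q ⟧ u`.
factor-eigen : ∀ {m} .{{_ : ℕ.NonZero m}} {u p q} → NonZeroFun u → Fixes u (+ m) →
  p ⊗ q ≈[ u ] con 0ℤ → ∃ λ v → u ⊑ v × NonZeroFun v × (p ≈[ v ] con 0ℤ ⊎ q ≈[ v ] con 0ℤ)
factor-eigen {m} {u} {p} {q} nz pu h with zero? (⊑-⟦⟧ q u pu)
... | inj₁ nz′ = ⟦ q ⟧ u , ⊑-⟦⟧ q u , nz′ , inj₁ (mk (at h))
... | inj₂ z   = u , (λ x → x) , nz , inj₂ (mk z)

module _ {m : ℕ} .{{_ : ℕ.NonZero m}} where

  -- T^s = 1 leaves cos d = cos c, which factors into T^{d+c} = 1 or T^{d-c} = 1 on a multiple. With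
  -- T^s = T^m = 1, coprimality then forces T = 1.
  cancelling-case : ∀ {u s d c} → Nontrivial m u → Fixes u s → CosRel u s d c →
    Coprime m (gcdℤ s (d ℤ.+ c)) → Coprime m (gcdℤ s (d ℤ.- c)) → ⊥
  cancelling-case {u} {s} {d} {c} nt hs h cop₁ cop₂ = conclude
    (factor-eigen {m} (nonzero nt) (periodic nt)
      (cos-product -1ℤ (mk λ i → sym (ℤₚ.*-assoc -1ℤ -1ℤ (u i))) d c
        (cos-difference {e = d} {c} (cos-fixed {s = s} {d} {c} hs h))))
    where
    conclude : (∃ λ v → u ⊑ v × NonZeroFun v ×
      ((sh (d ℤ.+ c) ⊕ con -1ℤ ≈[ v ] con 0ℤ) ⊎ (sh (d ℤ.+ ℤ.- c) ⊕ con -1ℤ ≈[ v ] con 0ℤ))) → ⊥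
    conclude (v , le , nz , inj₁ k) = nontrivial-¬fixes (nontrivial-⊑ le nz nt)
      (ideal-coprime fixes-ideal s (d ℤ.+ c) cop₁ (le (periodic nt)) (le hs) (sum-zero⇒ -1ℤ k))
    conclude (v , le , nz , inj₂ k) = nontrivial-¬fixes (nontrivial-⊑ le nz nt)
      (ideal-coprime fixes-ideal s (d ℤ.- c) cop₂ (le (periodic nt)) (le hs) (sum-zero⇒ -1ℤ k))

  -- T^c = -1 cancels the constant 2 and leaves cos s + cos d = 0, which factors.
  anti-case : ∀ {u s d c} → Nontrivial m u → Anti u c → CosRel u s d c →
    ∃ λ v → u ⊑ v × NonZeroFun v × (Anti v (s ℤ.+ d) ⊎ Anti v (s ℤ.- d))
  anti-case {u} {s} {d} {c} nt hc h = conclude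
    (factor-eigen {m} (nonzero nt) (periodic nt)
      (cos-product 1ℤ (mk λ i → sym (ℤₚ.*-assoc 1ℤ 1ℤ (u i))) s d (cos-anti {s = s} {d} {c} hc h)))
    where
    conclude : (∃ λ v → u ⊑ v × NonZeroFun v ×
      ((sh (s ℤ.+ d) ⊕ con 1ℤ ≈[ v ] con 0ℤ) ⊎ (sh (s ℤ.+ ℤ.- d) ⊕ con 1ℤ ≈[ v ] con 0ℤ))) →
      ∃ λ v → u ⊑ v × NonZeroFun v × (Anti v (s ℤ.+ d) ⊎ Anti v (s ℤ.- d))
    conclude (v , le , nz , k) = v , le , nz , Sum.map (sum-zero⇒ 1ℤ) (sum-zero⇒ 1ℤ) k

-- Two-adic valuations

TwoPart : ℕ → ℕ → Set
TwoPart n k = ∃ λ j → n ≡ 2 ℕ.^ k ℕ.* suc (2 ℕ.* j)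

parity : ∀ n → ∃ λ j → n ≡ 2 ℕ.* j ⊎ n ≡ suc (2 ℕ.* j)
parity zero = 0 , inj₁ refl
parity (suc n) with parity n
... | j , inj₁ e = j , inj₂ (cong suc e)
... | j , inj₂ e = suc j , inj₁ (trans (cong suc e) (sym (ℕₚ.*-suc 2 j)))

odd≢even : ∀ j k → suc (2 ℕ.* j) ≢ 2 ℕ.* k
odd≢even j       zero    ()
odd≢even zero    (suc k) e = contradiction (trans e (ℕₚ.*-suc 2 k)) λ ()
odd≢even (suc j) (suc k) e = odd≢even j k (ℕₚ.suc-injective (ℕₚ.suc-injective
  (trans (cong suc (sym (ℕₚ.*-suc 2 j))) (trans e (ℕₚ.*-suc 2 k)))))

twoPart : ∀ n .{{_ : ℕ.NonZero n}} → ∃ (TwoPart n)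
twoPart = <-rec (λ n → .{{ℕ.NonZero n}} → ∃ (TwoPart n)) step
  where
  step : ∀ n → (∀ {j} → j < n → .{{ℕ.NonZero j}} → ∃ (TwoPart j)) → .{{ℕ.NonZero n}} → ∃ (TwoPart n)
  step n rec {{nz}} with parity n
  ... | j , inj₂ e = 0 , j , trans e (sym (ℕₚ.*-identityˡ _))
  ... | zero , inj₁ e  = contradiction e (ℕ.≢-nonZero⁻¹ n {{nz}})
  ... | suc j , inj₁ e with rec {suc j} (subst (suc j <_) (sym e) (ℕₚ.m<m+n (suc j) (s≤s z≤n)))
  ...   | k , i , e′ = suc k , i , trans e (trans (cong (2 ℕ.*_) e′) (sym (ℕₚ.*-assoc 2 (2 ℕ.^ k) _)))

twoPart⇒IsV2 : ∀ {n k} → TwoPart n k → IsV2 (+ n) k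
twoPart⇒IsV2 {n} {k} (j , e) = divides (suc (2 ℕ.* j)) (trans e (ℕₚ.*-comm (2 ℕ.^ k) _)) , ¬∣
  where
  ¬∣ : ¬ (2 ℕ.^ suc k ∣ n)
  ¬∣ (divides q e′) = odd≢even j q (ℕₚ.*-cancelˡ-≡ _ _ (2 ℕ.^ k) {{ℕₚ.m^n≢0 2 k}} (trans (sym e) (trans e′
    (solve 2 (λ q x → q :* (con 2 :* x) := x :* (con 2 :* q)) refl q (2 ℕ.^ k)))))
    where open NatSolver.+-*-Solver

twoPart-double : ∀ {n k} → TwoPart n k → TwoPart (n ℕ.+ n) (suc k)
twoPart-double {n} {k} (j , e) = j , trans (cong₂ ℕ._+_ e e)
  (solve 2 (λ x y → x :* y :+ x :* y := con 2 :* x :* y) refl (2 ℕ.^ k) (suc (2 ℕ.* j)))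
  where open NatSolver.+-*-Solver

-- Otherwise some odd multiple of `y` is a multiple of `z`, and T to that power is both -1 and 1.
anti-twoPart-< : ∀ {u y z ky kz} → NonZeroFun u → Anti u (+ y) → Fixes u (+ z) →
  TwoPart y ky → TwoPart z kz → ky < kz
anti-twoPart-< {u} {y} {z} {ky} {kz} nz hy hz (p , ey) (r , ez) with ky ℕ.<? kz
... | yes lt = lt
... | no ¬lt with ℕₚ.m≤n⇒∃[o]m+o≡n (ℕₚ.≮⇒≥ ¬lt)
...   | t , refl = contradiction (subst (Fixes u) (cong +_ (sym common)) fixed) (¬anti-fixes nz odd)
  where
  q = 2 ℕ.^ t ℕ.* suc (2 ℕ.* p)
  common : suc (2 ℕ.* r) ℕ.* y ≡ q ℕ.* z
  common = trans (cong (suc (2 ℕ.* r) ℕ.*_) (trans ey (cong (ℕ._* suc (2 ℕ.* p)) (ℕₚ.^-distribˡ-+-* 2 kz t))))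
    (trans (solve 4 (λ r a b p → r :* (a :* b :* p) := b :* p :* (a :* r)) refl
             (suc (2 ℕ.* r)) (2 ℕ.^ kz) (2 ℕ.^ t) (suc (2 ℕ.* p)))
           (cong (q ℕ.*_) (sym ez)))
    where open NatSolver.+-*-Solver
  odd : Anti u (+ (suc (2 ℕ.* r) ℕ.* y))
  odd = subst (Anti u) (sym (ℤₚ.pos-* (suc (2 ℕ.* r)) y)) (anti-odd r hy)
  fixed : Fixes u (+ (q ℕ.* z))
  fixed = subst (Fixes u) (sym (ℤₚ.pos-* q z)) (fixes-ℕ* q hz)

-- The strict inequality is applied to y and 2z, where T^{2z} = 1, and with the roles exchanged.
anti-twoPart-≡ : ∀ {u y z ky kz} → NonZeroFun u → Anti u (+ y) → Anti u (+ z) →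
  TwoPart y ky → TwoPart z kz → ky ≡ kz
anti-twoPart-≡ {u} {y} {z} {ky} {kz} nz hy hz ty tz = ℕₚ.≤-antisym (le hy hz ty tz) (le hz hy tz ty)
  where
  double : ∀ {z} → Anti u (+ z) → Fixes u (+ (z ℕ.+ z))
  double {z} h = subst (Fixes u) (trans (sym (ℤₚ.pos-* 2 z)) (cong (λ t → + (z ℕ.+ t)) (ℕₚ.+-identityʳ z))) (anti-fixes h)
  le : ∀ {y z ky kz} → Anti u (+ y) → Anti u (+ z) → TwoPart y ky → TwoPart z kz → ky ≤ kz
  le {z = z} {kz = kz} hy hz ty tz = ℕₚ.≤-pred (anti-twoPart-< nz hy (double {z} hz) ty (twoPart-double {z} {kz} tz))

-- Exact periods and residue classes

∣-fixes : ∀ {u n z} → Fixes u (+ n) → n ∣ ∣ z ∣ → Fixes u z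
∣-fixes {u} {n} {z} h n∣z with ℤS.∣ᵤ⇒∣ {+ n} {z} n∣z
... | ℤS.divides q e = subst (Fixes u) (sym e) (fixes-* q h)

exact-period? : ∀ n qs → Dec (∀ {h} → h < n → h ∣ n → Any (h ∣_) qs)
exact-period? n qs = ℕₚ.allUpTo? (λ h → (h ∣? n) →-dec Any.any? (h ∣?_) qs) n

-- gcd(z, n) is again a period. If it were less than n, it would divide a member of `qs` by the
-- finite check, and that member would be a period.
exact-period : ∀ n .{{_ : ℕ.NonZero n}} qs {check : True (exact-period? n qs)} {u} → Fixes u (+ n) →
  All (λ q → ¬ Fixes u (+ q)) qs → ∀ {z} → Fixes u z → n ∣ ∣ z ∣
exact-period n qs {check} {u} hn hqs {z} hz with gcdℤ z (+ n) ℕ.<? n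
... | yes lt = contradiction (toWitness check lt (gcd[m,n]∣n ∣ z ∣ n)) (none hqs)
  where
  none : ∀ {qs} → All (λ q → ¬ Fixes u (+ q)) qs → ¬ Any (gcdℤ z (+ n) ∣_) qs
  none (h ∷ _)  (here g∣q) = h (∣-fixes (ideal-gcd fixes-ideal z (+ n) hz hn) g∣q)
  none (_ ∷ hs) (there i)  = none hs i
... | no ≮ = subst (_∣ ∣ z ∣) (ℕₚ.≤-antisym (∣⇒≤ (gcd[m,n]∣n ∣ z ∣ n)) (ℕₚ.≮⇒≥ ≮)) (gcd[m,n]∣m ∣ z ∣ n)

residue? : ∀ n k ds rs → Dec (∀ {r} → r < n → n ∣ ∣ + k ℤ.* + r ∣ →
  All (λ d → ¬ (n ∣ ∣ + d ℤ.* + r ∣)) ds → Any (PM n (+ r)) rs)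
residue? n k ds rs = ℕₚ.allUpTo? (λ r → (n ∣? ∣ + k ℤ.* + r ∣) →-dec
  (All.all? (λ d → ¬? (n ∣? ∣ + d ℤ.* + r ∣)) ds →-dec
  Any.any? (λ ρ → (n ∣? ∣ + r ℤ.- + ρ ∣) ⊎-dec (n ∣? ∣ + r ℤ.- (ℤ.- + ρ) ∣)) rs)) n

-- All the divisibilities depend on `x` modulo `n` only, so the check on the residues below `n`
-- decides.
residue : ∀ n .{{_ : ℕ.NonZero n}} k ds rs {check : True (residue? n k ds rs)} x → n ∣ ∣ + k ℤ.* x ∣ →
  All (λ d → ¬ (n ∣ ∣ + d ℤ.* x ∣)) ds → Any (PM n x) rs
residue n k ds rs {check} x nk nds = Any.map (λ {ρ} → Sum.map (back (+ ρ)) (back (ℤ.- + ρ)))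
  (toWitness check (ℤDivMod.n%ℕd<d x n) (to (+ k) nk) (All.map (λ {d} ¬h h → ¬h (from (+ d) h)) nds))
  where
  open ℤ-Solver
  r = + (x ℤDivMod.%ℕ n)
  q = x ℤDivMod./ℕ n
  x≡ : x ≡ r ℤ.+ q ℤ.* + n
  x≡ = ℤDivMod.a≡a%ℕn+[a/ℕn]*n x n
  transfer : ∀ {y z} t → z ≡ y ℤ.+ t ℤ.* + n → n ∣ ∣ y ∣ → n ∣ ∣ z ∣
  transfer {y} {z} t e h = ℤS.∣⇒∣ᵤ {+ n} {z} (subst (+ n ℤS.∣_) (sym e)
    (ℤS.∣m∣n⇒∣m+n (ℤS.∣ᵤ⇒∣ {+ n} {y} h) (ℤS.∣n⇒∣m*n t ℤS.∣-refl)))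
  to : ∀ l → n ∣ ∣ l ℤ.* x ∣ → n ∣ ∣ l ℤ.* r ∣
  to l = transfer {l ℤ.* x} {l ℤ.* r} (ℤ.- (l ℤ.* q)) (trans
    (solve 4 (λ l r q n → l :* r := l :* (r :+ q :* n) :+ (:- (l :* q)) :* n) refl l r q (+ n))
    (cong (λ t → l ℤ.* t ℤ.+ ℤ.- (l ℤ.* q) ℤ.* + n) (sym x≡)))
  from : ∀ l → n ∣ ∣ l ℤ.* r ∣ → n ∣ ∣ l ℤ.* x ∣
  from l = transfer {l ℤ.* r} {l ℤ.* x} (l ℤ.* q) (trans (cong (l ℤ.*_) x≡)
    (solve 4 (λ l r q n → l :* (r :+ q :* n) := l :* r :+ l :* q :* n) refl l r q (+ n)))
  back : ∀ ρ → n ∣ ∣ r ℤ.- ρ ∣ → n ∣ ∣ x ℤ.- ρ ∣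
  back ρ = transfer {r ℤ.- ρ} {x ℤ.- ρ} q (trans (cong (ℤ._- ρ) x≡)
    (solve 4 (λ r q n ρ → r :+ q :* n :- ρ := r :- ρ :+ q :* n) refl r q (+ n) ρ))

-- Once `n` is the exact period, T^{kx} = 1 amounts to n dividing k x, and the order of T^x confines
-- `x` to a few classes modulo `n`.
fixes-residue : ∀ n .{{_ : ℕ.NonZero n}} k ds rs {check : True (residue? n k ds rs)} {u} → Fixes u (+ n) →
  (∀ {z} → Fixes u z → n ∣ ∣ z ∣) → ∀ x → Fixes u (+ k ℤ.* x) → All (λ d → ¬ Fixes u (+ d ℤ.* x)) ds →
  Any (PM n x) rs
fixes-residue n k ds rs {check} hn exact x hk hds = residue n k ds rs {check} x (exact hk)
  (All.map (λ {d} ¬h h → ¬h (∣-fixes {z = + d ℤ.* x} hn h)) hds)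

i≡j+[i-j] : ∀ i j → i ≡ j ℤ.+ (i ℤ.- j)
i≡j+[i-j] = solve 2 (λ i j → i := j :+ (i :- j)) refl
  where open ℤ-Solver

-i≡-j+-[i-j] : ∀ i j → ℤ.- i ≡ ℤ.- j ℤ.+ ℤ.- (i ℤ.- j)
-i≡-j+-[i-j] = solve 2 (λ i j → :- i := (:- j) :+ (:- (i :- j))) refl
  where open ℤ-Solver

*-distribˡ-- : ∀ k i j → k ℤ.* (i ℤ.- j) ≡ k ℤ.* i ℤ.- k ℤ.* j
*-distribˡ-- = solve 3 (λ k i j → k :* (i :- j) := k :* i :- k :* j) refl
  where open ℤ-Solver

6[d+2t]-12t≡6d : ∀ d t → + 6 ℤ.* (d ℤ.+ + 2 ℤ.* t) ℤ.+ ℤ.- (+ 12 ℤ.* t) ≡ + 6 ℤ.* d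
6[d+2t]-12t≡6d = solve 2 (λ d t →
  # (+ 6) :* (d :+ # (+ 2) :* t) :+ (:- (# (+ 12) :* t)) := # (+ 6) :* d) refl
  where open ℤ-Solver

-- Relations on a common period

module _ {u : ℤ → ℤ} where
  open OpRing u
  open OpSolver u
  open SetoidReasoning setoid

  fixes-scale : ∀ {n} → Fixes u (+ n) → ∀ x → Fixes u (+ n ℤ.* x)
  fixes-scale {n} h x = subst (Fixes u) (ℤₚ.*-comm x (+ n)) (fixes-* x h)

  anti-nested : ∀ j k {e} → Anti u (+ k ℤ.* e) → Anti u (+ (suc (2 ℕ.* j) ℕ.* k) ℤ.* e)
  anti-nested j k {e} h = ≈-trans
    (sh-≡ (trans (cong (ℤ._* e) (ℤₚ.pos-* (suc (2 ℕ.* j)) k)) (ℤₚ.*-assoc (+ suc (2 ℕ.* j)) (+ k) e)))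
    (anti-odd j h)

  -- `n` will be a common multiple of the orders of T^s, T^d and T^c; (i) makes it a multiple of the
  -- order of T.
  fixed-period : ∀ n {m} s d c → Coprime m (gcdℤ d (s ℤ.+ c)) → Fixes u (+ m) →
    Fixes u (+ n ℤ.* s) → Fixes u (+ n ℤ.* d) → Fixes u (+ n ℤ.* c) → Fixes u (+ n)
  fixed-period n {m} s d c cop hm hs hd hc = subst (Fixes u) (ℤₚ.*-identityʳ (+ n))
    (ideal-coprime (scaled-ideal (+ n)) d (s ℤ.+ c) cop (fixes-* (+ n) hm) hd
      (Ideal.+-closed (scaled-ideal (+ n)) {s} {c} hs hc))

  -- Every proper divisor of 12 divides 4 or 6. The period 4 contradicts the order 6 of T^x, and 6
  -- the order 4 of T^y.
  order₁₂-exact : NonZeroFun u → ∀ {x y} → Order₆ u x → Order₄ u y → Fixes u (+ 12) →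
    ∀ {z} → Fixes u z → 12 ∣ ∣ z ∣
  order₁₂-exact nz {x} {y} o₆ o₄ h = exact-period 12 (4 ∷ 6 ∷ []) h (¬4 ∷ ¬6 ∷ [])
    where
    ¬4 : ¬ Fixes u (+ 4)
    ¬4 h₄ = order₆-¬fixes nz o₆ (fixes-combine {u} {6} {4} {x} (order₆-fixed o₆) (fixes-scale h₄ x) 2 1 1 refl)
    ¬6 : ¬ Fixes u (+ 6)
    ¬6 h₆ = ¬anti-fixes nz (anti-nested 1 2 {y} o₄) (fixes-scale h₆ y)

  -- The period 15 contradicts T^{5y} = -1, and 6 the primitive fifth root of unity T^{2y}. That 10
  -- is not a period must come from an exponent whose order is divisible by 3.
  order₃₀-exact : NonZeroFun u → ∀ {y} → Order₁₀ u y → ¬ Fixes u (+ 10) → Fixes u (+ 30) →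
    ∀ {z} → Fixes u z → 30 ∣ ∣ z ∣
  order₃₀-exact nz {y} o ¬10 h = exact-period 30 (15 ∷ 10 ∷ 6 ∷ []) h (¬15 ∷ ¬10 ∷ ¬6 ∷ [])
    where
    ¬15 : ¬ Fixes u (+ 15)
    ¬15 h₁₅ = ¬anti-fixes nz (anti-nested 1 5 {y} (Order₁₀.anti o)) (fixes-scale h₁₅ y)
    ¬6 : ¬ Fixes u (+ 6)
    ¬6 h₆ = quint-¬fixes nz (Order₁₀.sum o)
      (fixes-combine {u} {6} {10} {y} (fixes-scale h₆ y) (Order₁₀.fixed o) 2 2 1 refl)

  cos-resp : ∀ {x y} → Fixes u (x ℤ.- y) → cos x ≈[ u ] cos y
  cos-resp {x} {y} h = +-cong (shift h (i≡j+[i-j] x y)) (shift (fixes-neg h) (-i≡-j+-[i-j] x y))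
    where
    shift : ∀ {z w v} → Fixes u v → z ≡ w ℤ.+ v → sh z ≈[ u ] sh w
    shift {z} {w} {v} h e = ≈-trans (sh-≡ e) (≈-trans (sh-+ w v) (≈-trans (*-congˡ h) (*-identityʳ _)))

  PM-cos : ∀ {n x ρ} → Fixes u (+ n) → PM n x ρ → ∀ k → cos (+ k ℤ.* x) ≈[ u ] cos (+ k ℤ.* + ρ)
  PM-cos {n} {x} {ρ} h pm k = go pm
    where
    scale : ∀ y → n ∣ ∣ x ℤ.- y ∣ → Fixes u (+ k ℤ.* x ℤ.- + k ℤ.* y)
    scale y n∣ = subst (Fixes u)
      (*-distribˡ-- (+ k) x y)
      (fixes-* (+ k) (∣-fixes {z = x ℤ.- y} h n∣))
    go : PM n x ρ → cos (+ k ℤ.* x) ≈[ u ] cos (+ k ℤ.* + ρ)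
    go (inj₁ n∣) = cos-resp (scale (+ ρ) n∣)
    go (inj₂ n∣) = ≈-trans (cos-resp (scale (ℤ.- + ρ) n∣))
      (≈-trans (cos-≡ (sym (ℤₚ.neg-distribʳ-* (+ k) (+ ρ)))) (cos-neg (+ k ℤ.* + ρ)))

  PM-cos₁ : ∀ {n x ρ} → Fixes u (+ n) → PM n x ρ → cos x ≈[ u ] cos (+ ρ)
  PM-cos₁ {n} {x} {ρ} h pm = ≈-trans (cos-≡ (sym (ℤₚ.*-identityˡ x)))
    (≈-trans (PM-cos h pm 1) (cos-≡ (ℤₚ.*-identityˡ (+ ρ))))

  cosRel-order₆ : ∀ {s d c} → Order₆ u s → CosRel u s d c → cos d ≈[ u ] con 1ℤ ⊕ cos c
  cosRel-order₆ {s} {d} {c} o h = begin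
    cos d                             ≈⟨ solve 2 (λ x y → y := (x :+ y) :- x) ≈-refl (cos s) (cos d) ⟩
    (cos s ⊕ cos d) ⊕ con -1ℤ ⊗ cos s ≈⟨ +-cong h (*-congˡ (order₆-cos o)) ⟩
    (cos 0ℤ ⊕ cos c) ⊕ con -1ℤ ⊗ con 1ℤ ≈⟨ +-congʳ (+-congʳ cos-0) ⟩
    (con 1ℤ ⊕ con 1ℤ ⊕ cos c) ⊕ con -1ℤ ⊗ con 1ℤ
                                      ≈⟨ solve 1 (λ x → (# 1ℤ :+ # 1ℤ :+ x) :- # 1ℤ := # 1ℤ :+ x) ≈-refl (cos c) ⟩
    con 1ℤ ⊕ cos c                    ∎

  -- With z = T^{2d} and b = z² + z³, cos d is -b and cos 4d is b. The relation cos d = 1 + cos c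
  -- would become 2b + 1 = 0, but 2b + 1 has square 5.
  order₆-order₁₀-≢ : NonZeroFun u → ∀ {s d c} → CosRel u s d c → Order₆ u s → Order₁₀ u d →
    ¬ cos c ≈[ u ] cos (+ 4 ℤ.* d)
  order₆-order₁₀-≢ nz {s} {d} {c} h o₆ o₁₀ k = quint-irrational nz (Order₁₀.sum o₁₀) (begin
    con (+ 2) ⊗ b ⊕ con 1ℤ            ≈⟨ solve 1 (λ b → # (+ 2) :* b :+ # 1ℤ := (# 1ℤ :+ b) :- ((# -1ℤ) :* b)) ≈-refl b ⟩
    (con 1ℤ ⊕ b) ⊕ con -1ℤ ⊗ (con -1ℤ ⊗ b)
      ≈⟨ +-cong (+-congˡ (≈-trans k (order₁₀-cos₄ o₁₀))) (*-congˡ (order₁₀-cos o₁₀)) ⟨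
    (con 1ℤ ⊕ cos c) ⊕ con -1ℤ ⊗ cos d ≈⟨ +-congʳ (cosRel-order₆ {s} {d} {c} o₆ h) ⟨
    cos d ⊕ con -1ℤ ⊗ cos d           ≈⟨ solve 1 (λ x → x :- x := # 0ℤ) ≈-refl (cos d) ⟩
    con 0ℤ                            ∎)
    where b = sh (+ 2 ℤ.* (+ 2 ℤ.* d)) ⊕ sh (+ 3 ℤ.* (+ 2 ℤ.* d))

  -- Here 2 + cos c = 1, while equal cosines on the left add up to -2b; again 2b + 1 = 0.
  order₁₀-order₃-≢ : NonZeroFun u → ∀ {s d c} → CosRel u s d c → Order₁₀ u d → Order₃ u c →
    ¬ cos s ≈[ u ] cos d
  order₁₀-order₃-≢ nz {s} {d} {c} h o₁₀ o₃ k = quint-irrational nz (Order₁₀.sum o₁₀) (begin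
    con (+ 2) ⊗ b ⊕ con 1ℤ
      ≈⟨ solve 1 (λ b → # (+ 2) :* b :+ # 1ℤ := (# 1ℤ :+ # 1ℤ :+ # -1ℤ) :- ((# -1ℤ) :* b :+ (# -1ℤ) :* b)) ≈-refl b ⟩
    (con 1ℤ ⊕ con 1ℤ ⊕ con -1ℤ) ⊕ con -1ℤ ⊗ (con -1ℤ ⊗ b ⊕ con -1ℤ ⊗ b)
      ≈⟨ +-cong (+-cong cos-0 (order₃-cos o₃)) (*-congˡ (+-cong (≈-trans k (order₁₀-cos o₁₀)) (order₁₀-cos o₁₀))) ⟨
    (cos 0ℤ ⊕ cos c) ⊕ con -1ℤ ⊗ (cos s ⊕ cos d) ≈⟨ +-congʳ h ⟨
    (cos s ⊕ cos d) ⊕ con -1ℤ ⊗ (cos s ⊕ cos d) ≈⟨ solve 1 (λ x → x :- x := # 0ℤ) ≈-refl (cos s ⊕ cos d) ⟩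
    con 0ℤ                            ∎)
    where b = sh (+ 2 ℤ.* (+ 2 ℤ.* d)) ⊕ sh (+ 3 ℤ.* (+ 2 ℤ.* d))

-- The isolated solutions of the trace equation

module _ {m : ℕ} {u : ℤ → ℤ} {s d c : ℤ} (nt : Nontrivial m u) (h : CosRel u s d c)
  (cop : Coprime m (gcdℤ d (s ℤ.+ c))) where
  open OpRing u
  open OpSolver u
  open SetoidReasoning setoid

  -- cos s = cos d = 1 leaves cos c = 0, so the unspecified order of T^c is 4 and T has order 12. In
  -- ℤ/12 the elements of order 6 are ±2 and those of order 4 are ±3.
  order₆-order₆-case : Order₆ u s → Order₆ u d → 12 ∣ m × PM 12 s 2 × PM 12 d 2 × PM 12 c 3
  order₆-order₆-case os od = conclude
    (fixes-residue 12 6 (3 ∷ 2 ∷ []) (2 ∷ []) fix₁₂ exact s (order₆-fixed os) (order₆-excluded os))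
    (fixes-residue 12 6 (3 ∷ 2 ∷ []) (2 ∷ []) fix₁₂ exact d (order₆-fixed od) (order₆-excluded od))
    (fixes-residue 12 4 (2 ∷ []) (3 ∷ []) fix₁₂ exact c fix₄ (¬anti-fixes (nonzero nt) oc ∷ []))
    where
    cos-c : cos c ≈[ u ] con 0ℤ
    cos-c = begin
      cos c                            ≈⟨ solve 1 (λ x → x := (# 1ℤ :+ x) :- # 1ℤ) ≈-refl (cos c) ⟩
      con 1ℤ ⊕ cos c ⊕ con -1ℤ ⊗ con 1ℤ ≈⟨ +-congʳ (≈-trans (≈-sym (order₆-cos od)) (cosRel-order₆ {s = s} {d} {c} os h)) ⟨
      con 1ℤ ⊕ con -1ℤ ⊗ con 1ℤ        ≈⟨ solve 0 (# 1ℤ :- # 1ℤ := # 0ℤ) ≈-refl ⟩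
      con 0ℤ                           ∎
    oc : Order₄ u c
    oc = cos-0⇒order₄ cos-c
    fix₄ : Fixes u (+ 4 ℤ.* c)
    fix₄ = ≈-trans (sh-≡ (ℤₚ.*-assoc (+ 2) (+ 2) c)) (anti-fixes oc)
    fix₁₂ : Fixes u (+ 12)
    fix₁₂ = fixed-period 12 s d c cop (periodic nt) (fixes-multiple 2 6 {s} (order₆-fixed os))
      (fixes-multiple 2 6 {d} (order₆-fixed od)) (fixes-multiple 3 4 {c} fix₄)
    exact : ∀ {z} → Fixes u z → 12 ∣ ∣ z ∣
    exact = order₁₂-exact (nonzero nt) os oc fix₁₂
    order₆-excluded : ∀ {x} → Order₆ u x → All (λ k → ¬ Fixes u (+ k ℤ.* x)) (3 ∷ 2 ∷ [])
    order₆-excluded o = ¬anti-fixes (nonzero nt) (Order₆.anti o) ∷ order₆-¬fixes (nonzero nt) o ∷ []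
    conclude : Any (PM 12 s) (2 ∷ []) → Any (PM 12 d) (2 ∷ []) → Any (PM 12 c) (3 ∷ []) →
      12 ∣ m × PM 12 s 2 × PM 12 d 2 × PM 12 c 3
    conclude (here ps) (here pd) (here pc) = exact (periodic nt) , ps , pd , pc

  -- Here T^s has order 6 and T^d order 4 modulo 12, which contradicts s ≡ d (mod 2).
  order₆-order₃-case : ∀ t → s ≡ d ℤ.+ + 2 ℤ.* t → Order₆ u s → Order₃ u c → ⊥
  order₆-order₃-case t s≡ os oc = ¬anti-fixes (nonzero nt) (anti-nested 1 2 {d} od) fix₆
    where
    cos-d : cos d ≈[ u ] con 0ℤ
    cos-d = begin
      cos d              ≈⟨ cosRel-order₆ {s = s} {d} {c} os h ⟩
      con 1ℤ ⊕ cos c     ≈⟨ +-congˡ (order₃-cos oc) ⟩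
      con 1ℤ ⊕ con -1ℤ   ≈⟨ solve 0 (# 1ℤ :+ # -1ℤ := # 0ℤ) ≈-refl ⟩
      con 0ℤ             ∎
    od : Order₄ u d
    od = cos-0⇒order₄ cos-d
    fix₁₂ : Fixes u (+ 12)
    fix₁₂ = fixed-period 12 s d c cop (periodic nt) (fixes-multiple 2 6 {s} (order₆-fixed os))
      (fixes-multiple 3 4 {d} (≈-trans (sh-≡ (ℤₚ.*-assoc (+ 2) (+ 2) d)) (anti-fixes od)))
      (fixes-multiple 4 3 {c} (Order₃.fixed oc))
    fix₆ : Fixes u (+ 6 ℤ.* d)
    fix₆ = subst (Fixes u)
      (trans (cong (λ x → + 6 ℤ.* x ℤ.+ ℤ.- (+ 12 ℤ.* t)) s≡)
        (6[d+2t]-12t≡6d d t))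
      (fixes-+ (order₆-fixed os) (fixes-neg (fixes-scale fix₁₂ t)))

  order₁₀-excluded : ∀ {x} → Order₁₀ u x → All (λ k → ¬ Fixes u (+ k ℤ.* x)) (5 ∷ 2 ∷ [])
  order₁₀-excluded o = ¬anti-fixes (nonzero nt) (Order₁₀.anti o) ∷ quint-¬fixes (nonzero nt) (Order₁₀.sum o) ∷ []

  -- In ℤ/30 the elements of order 6 are ±5, those of order 10 are ±3 and ±9, those of order 5 are
  -- ±6 and ±12. Of the four combinations of d and c, two have cos c = cos 4d and are impossible.
  order₆-order₁₀-case : Order₆ u s → Order₁₀ u d → Order₅ u c →
    30 ∣ m × PM 30 s 5 × (PM 30 d 3 × PM 30 c 6 ⊎ PM 30 d 9 × PM 30 c 12)
  order₆-order₁₀-case os od oc = conclude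
    (fixes-residue 30 6 (3 ∷ 2 ∷ []) (5 ∷ []) fix₃₀ exact s (order₆-fixed os)
      (¬anti-fixes (nonzero nt) (Order₆.anti os) ∷ order₆-¬fixes (nonzero nt) os ∷ []))
    (fixes-residue 30 10 (5 ∷ 2 ∷ []) (3 ∷ 9 ∷ []) fix₃₀ exact d (Order₁₀.fixed od) (order₁₀-excluded od))
    (fixes-residue 30 5 (1 ∷ []) (6 ∷ 12 ∷ []) fix₃₀ exact c (Order₅.fixed oc)
      ((λ k → quint-¬fixes (nonzero nt) (Order₅.sum oc) (≈-trans (≈-sym (sh-1* c)) k)) ∷ []))
    where
    fix₃₀ : Fixes u (+ 30)
    fix₃₀ = fixed-period 30 s d c cop (periodic nt) (fixes-multiple 5 6 {s} (order₆-fixed os))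
      (fixes-multiple 3 10 {d} (Order₁₀.fixed od)) (fixes-multiple 6 5 {c} (Order₅.fixed oc))
    exact : ∀ {z} → Fixes u z → 30 ∣ ∣ z ∣
    exact = order₃₀-exact (nonzero nt) od (λ h₁₀ → order₆-¬fixes (nonzero nt) os
      (fixes-combine {u} {10} {6} {s} (fixes-scale h₁₀ s) (order₆-fixed os) 2 2 3 refl)) fix₃₀
    conclude : Any (PM 30 s) (5 ∷ []) → Any (PM 30 d) (3 ∷ 9 ∷ []) → Any (PM 30 c) (6 ∷ 12 ∷ []) →
      30 ∣ m × PM 30 s 5 × (PM 30 d 3 × PM 30 c 6 ⊎ PM 30 d 9 × PM 30 c 12)
    conclude (here ps) (here pd) (here pc) = exact (periodic nt) , ps , inj₁ (pd , pc)
    conclude (here ps) (there (here pd)) (there (here pc)) = exact (periodic nt) , ps , inj₂ (pd , pc)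
    conclude (here ps) (here pd) (there (here pc)) = contradiction
      (≈-trans (PM-cos₁ fix₃₀ pc) (≈-sym (PM-cos fix₃₀ pd 4)))
      (order₆-order₁₀-≢ (nonzero nt) {s} {d} {c} h os od)
    -- 4 · 9 = 36 ≡ 6 modulo 30.
    conclude (here ps) (there (here pd)) (here pc) = contradiction
      (≈-trans (PM-cos₁ fix₃₀ pc) (≈-trans (≈-sym (cos-resp {x = + 36} {+ 6} fix₃₀)) (≈-sym (PM-cos fix₃₀ pd 4))))
      (order₆-order₁₀-≢ (nonzero nt) {s} {d} {c} h os od)

  -- `s` and `d` both lie in the classes ±3, ±9 of order 10; in the same class up to sign they would
  -- have equal cosines.
  order₁₀-order₁₀-case : Order₁₀ u s → Order₁₀ u d → Order₃ u c →
    30 ∣ m × (PM 30 s 3 × PM 30 d 9 ⊎ PM 30 s 9 × PM 30 d 3) × PM 30 c 10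
  order₁₀-order₁₀-case os od oc = conclude
    (fixes-residue 30 10 (5 ∷ 2 ∷ []) (3 ∷ 9 ∷ []) fix₃₀ exact s (Order₁₀.fixed os) (order₁₀-excluded os))
    (fixes-residue 30 10 (5 ∷ 2 ∷ []) (3 ∷ 9 ∷ []) fix₃₀ exact d (Order₁₀.fixed od) (order₁₀-excluded od))
    (fixes-residue 30 3 (1 ∷ []) (10 ∷ []) fix₃₀ exact c (Order₃.fixed oc)
      ((λ k → order₃-¬fixes (nonzero nt) oc (≈-trans (≈-sym (sh-1* c)) k)) ∷ []))
    where
    fix₃₀ : Fixes u (+ 30)
    fix₃₀ = fixed-period 30 s d c cop (periodic nt) (fixes-multiple 3 10 {s} (Order₁₀.fixed os))
      (fixes-multiple 3 10 {d} (Order₁₀.fixed od)) (fixes-multiple 10 3 {c} (Order₃.fixed oc))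
    exact : ∀ {z} → Fixes u z → 30 ∣ ∣ z ∣
    exact = order₃₀-exact (nonzero nt) od (λ h₁₀ → order₃-¬fixes (nonzero nt) oc (≈-trans (≈-sym (sh-1* c))
      (fixes-combine {u} {10} {3} {c} (fixes-scale h₁₀ c) (Order₃.fixed oc) 1 1 3 refl))) fix₃₀
    distinct : ∀ {ρ} → PM 30 s ρ → PM 30 d ρ → ⊥
    distinct ps pd = order₁₀-order₃-≢ (nonzero nt) {s} {d} {c} h od oc
      (≈-trans (PM-cos₁ fix₃₀ ps) (≈-sym (PM-cos₁ fix₃₀ pd)))
    conclude : Any (PM 30 s) (3 ∷ 9 ∷ []) → Any (PM 30 d) (3 ∷ 9 ∷ []) → Any (PM 30 c) (10 ∷ []) →
      30 ∣ m × (PM 30 s 3 × PM 30 d 9 ⊎ PM 30 s 9 × PM 30 d 3) × PM 30 c 10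
    conclude (here ps) (there (here pd)) (here pc) = exact (periodic nt) , inj₁ (ps , pd) , pc
    conclude (there (here ps)) (here pd) (here pc) = exact (periodic nt) , inj₂ (ps , pd) , pc
    conclude (here ps) (here pd) _ = contradiction pd (distinct {3} ps)
    conclude (there (here ps)) (there (here pd)) _ = contradiction pd (distinct {9} ps)

-- The conditions leave only constant functions

Conditions : (m a b c : ℕ) → Set
Conditions m a b c =
  ( Coprime m (gcdℤ (+ a ℤ.- + b) (+ a ℤ.+ + b ℤ.+ + c))
  × Coprime m (gcdℤ (+ a ℤ.- + b) (+ a ℤ.+ + b ℤ.- + c))
  × Coprime m (gcdℤ (+ a ℤ.+ + b) (+ a ℤ.- + b ℤ.+ + c))
  × Coprime m (gcdℤ (+ a ℤ.+ + b) (+ a ℤ.- + b ℤ.- + c)) )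
  × (∀ km kc → IsV2 (+ m) km → IsV2 (+ c) kc → kc < km →
       ∀ ka kb → IsV2 (+ a) ka → IsV2 (+ b) kb →
       suc ka ≢ kc × suc kb ≢ kc)
  × (12 ∣ m →
       ¬ (PM 12 (+ a ℤ.+ + b) 2 × PM 12 (+ a ℤ.- + b) 2 × PM 12 (+ c) 3))
  × (30 ∣ m →
       ¬ ( Forb30 (+ a ℤ.+ + b) (+ a ℤ.- + b) (+ c) 3 5 6
         ⊎ Forb30 (+ a ℤ.+ + b) (+ a ℤ.- + b) (+ c) 3 9 10
         ⊎ Forb30 (+ a ℤ.+ + b) (+ a ℤ.- + b) (+ c) 5 9 12 ))

module _ {m a b c : ℕ} .{{_ : ℕ.NonZero m}} .{{_ : ℕ.NonZero a}} .{{_ : ℕ.NonZero b}} .{{_ : ℕ.NonZero c}}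
  (conditions : Conditions m a b c) where

  private
    s d : ℤ
    s = + a ℤ.+ + b
    d = + a ℤ.- + b

    cop₁ = proj₁ (proj₁ conditions)
    cop₂ = proj₁ (proj₂ (proj₁ conditions))
    cop₃ = proj₁ (proj₂ (proj₂ (proj₁ conditions)))
    cop₄ = proj₂ (proj₂ (proj₂ (proj₁ conditions)))
    cond₂ = proj₁ (proj₂ conditions)
    cond₁₂ = proj₁ (proj₂ (proj₂ conditions))
    cond₃₀ = proj₂ (proj₂ (proj₂ conditions))

  -- T^c = -1 and T^m = 1 force v₂(c) < v₂(m), so (ii) applies. As s + d = 2a and s - d = 2b, the
  -- relation yields T^{2a} = -1 or T^{2b} = -1, hence v₂(2a) or v₂(2b) equals v₂(c).
  two-adic : ∀ {u} → Nontrivial m u → Anti u (+ c) → CosRel u s d (+ c) → ⊥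
  two-adic {u} nt hc h = conclude (anti-case {m} {s = s} {d} {+ c} nt hc h)
    where
    tm = proj₂ (twoPart m)
    ta = proj₂ (twoPart a)
    tb = proj₂ (twoPart b)
    tc = proj₂ (twoPart c)
    km = proj₁ (twoPart m)
    ka = proj₁ (twoPart a)
    kb = proj₁ (twoPart b)
    kc = proj₁ (twoPart c)
    distinct : suc ka ≢ kc × suc kb ≢ kc
    distinct = cond₂ km kc (twoPart⇒IsV2 {m} {km} tm) (twoPart⇒IsV2 {c} {kc} tc)
      (anti-twoPart-< {y = c} {m} {kc} {km} (nonzero nt) hc (periodic nt) tc tm)
      ka kb (twoPart⇒IsV2 {a} {ka} ta) (twoPart⇒IsV2 {b} {kb} tb)
    s+d : s ℤ.+ d ≡ + (a ℕ.+ a)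
    s+d = trans (ℤ-Solver.solve 2 (λ a b → let open ℤ-Solver in (a :+ b) :+ (a :- b) := a :+ a) refl (+ a) (+ b))
      (sym (ℤₚ.pos-+ a a))
    s-d : s ℤ.- d ≡ + (b ℕ.+ b)
    s-d = trans (ℤ-Solver.solve 2 (λ a b → let open ℤ-Solver in (a :+ b) :- (a :- b) := b :+ b) refl (+ a) (+ b))
      (sym (ℤₚ.pos-+ b b))
    conclude : (∃ λ v → u ⊑ v × NonZeroFun v × (Anti v (s ℤ.+ d) ⊎ Anti v (s ℤ.- d))) → ⊥
    conclude (v , le , nz , inj₁ k) = proj₁ distinct
      (anti-twoPart-≡ {kz = kc} nz (subst (Anti v) s+d k) (le hc) (twoPart-double {a} {ka} ta) tc)
    conclude (v , le , nz , inj₂ k) = proj₂ distinct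
      (anti-twoPart-≡ {kz = kc} nz (subst (Anti v) s-d k) (le hc) (twoPart-double {b} {kb} tb) tc)

  -- Three passages to multiples fix the orders of T^s, T^d and T^c on one function, which is still
  -- nontrivial and still satisfies the relation; its orders then solve the trace equation.
  ¬nontrivial : ∀ {u} → Nontrivial m u → ¬ CosRel u s d (+ c)
  ¬nontrivial {u} nt h = assign-d (assign-order {m} (nonzero nt) (periodic nt) s)
    where
    cases : ∀ {v} → Nontrivial m v → CosRel v s d (+ c) → ∀ {os od oc} →
      HasOrder± v m s os → HasOrder± v m d od → HasOrder± v m (+ c) oc → Solutions os od oc → ⊥
    cases nt h (hs , _) (hd , _) (hc , _) (inj₁ refl) =
      cancelling-case nt (hasOrder₁ {m = m} hs) h cop₃ cop₄
    cases {v} nt h (hs , _) (hd , _) (hc , _) (inj₂ (inj₁ refl)) =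
      cancelling-case nt (hasOrder₁ {m = m} hd) (cos-swap {s = s} {d} {+ c} h) cop₁ cop₂
    cases nt h (hs , _) (hd , _) (hc , _) (inj₂ (inj₂ (inj₁ refl))) =
      two-adic nt (hasOrder₂ {m = m} hc) h
    cases nt h (hs , _) (hd , _) (hc , _) (inj₂ (inj₂ (inj₂ (inj₁ (refl , refl , refl))))) =
      let 12∣m , pms = order₆-order₆-case {s = s} {d} {+ c} nt h cop₁ (hasOrder₆ {m = m} hs) (hasOrder₆ {m = m} hd)
      in cond₁₂ 12∣m pms
    cases nt h (hs , _) (hd , _) (hc , _) (inj₂ (inj₂ (inj₂ (inj₂ (inj₁ (refl , refl , refl)))))) =
      order₆-order₃-case {s = s} {d} {+ c} nt h cop₁ (+ b)
        (ℤ-Solver.solve 2 (λ a b → let open ℤ-Solver in a :+ b := a :- b :+ # (+ 2) :* b) refl (+ a) (+ b))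
        (hasOrder₆ {m = m} hs) (hasOrder₃ {m = m} hc)
    cases nt h (hs , _) (hd , _) (hc , _) (inj₂ (inj₂ (inj₂ (inj₂ (inj₂ (inj₁ (refl , refl , refl))))))) =
      order₆-order₃-case {s = d} {s} {+ c} nt (cos-swap {s = s} {d} {+ c} h) cop₃ (ℤ.- + b)
        (ℤ-Solver.solve 2 (λ a b → let open ℤ-Solver in a :- b := a :+ b :+ # (+ 2) :* (:- b)) refl (+ a) (+ b))
        (hasOrder₆ {m = m} hd) (hasOrder₃ {m = m} hc)
    cases nt h (hs , _) (hd , _) (hc , _) (inj₂ (inj₂ (inj₂ (inj₂ (inj₂ (inj₂ (inj₁ (refl , refl , refl)))))))) =
      conclude (order₆-order₁₀-case {s = s} {d} {+ c} nt h cop₁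
        (hasOrder₆ {m = m} hs) (hasOrder₁₀ {m = m} hd) (hasOrder₅ {m = m} hc))
      where
      conclude : 30 ∣ m × PM 30 s 5 × (PM 30 d 3 × PM 30 (+ c) 6 ⊎ PM 30 d 9 × PM 30 (+ c) 12) → ⊥
      conclude (30∣m , ps , inj₁ (pd , pc)) = cond₃₀ 30∣m (inj₁ (inj₂ (ps , pd) , pc))
      conclude (30∣m , ps , inj₂ (pd , pc)) = cond₃₀ 30∣m (inj₂ (inj₂ (inj₁ (ps , pd) , pc)))
    cases nt h (hs , _) (hd , _) (hc , _) (inj₂ (inj₂ (inj₂ (inj₂ (inj₂ (inj₂ (inj₂ (inj₁ (refl , refl , refl))))))))) =
      conclude (order₆-order₁₀-case {s = d} {s} {+ c} nt (cos-swap {s = s} {d} {+ c} h) cop₃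
        (hasOrder₆ {m = m} hd) (hasOrder₁₀ {m = m} hs) (hasOrder₅ {m = m} hc))
      where
      conclude : 30 ∣ m × PM 30 d 5 × (PM 30 s 3 × PM 30 (+ c) 6 ⊎ PM 30 s 9 × PM 30 (+ c) 12) → ⊥
      conclude (30∣m , pd , inj₁ (ps , pc)) = cond₃₀ 30∣m (inj₁ (inj₁ (ps , pd) , pc))
      conclude (30∣m , pd , inj₂ (ps , pc)) = cond₃₀ 30∣m (inj₂ (inj₂ (inj₂ (ps , pd) , pc)))
    cases nt h (hs , _) (hd , _) (hc , _) (inj₂ (inj₂ (inj₂ (inj₂ (inj₂ (inj₂ (inj₂ (inj₂ (refl , refl , refl))))))))) =
      let 30∣m , pms = order₁₀-order₁₀-case {s = s} {d} {+ c} nt h cop₁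
            (hasOrder₁₀ {m = m} hs) (hasOrder₁₀ {m = m} hd) (hasOrder₃ {m = m} hc)
      in cond₃₀ 30∣m (inj₂ (inj₁ pms))
    assign-d : (∃ λ v → u ⊑ v × NonZeroFun v × ∃ (HasOrder± v m s)) → ⊥
    assign-d (v₁ , le₁ , nz₁ , os , hs) = assign-c (assign-order {m} nz₁ (le₁ (periodic nt)) d)
      where
      assign-c : (∃ λ v → v₁ ⊑ v × NonZeroFun v × ∃ (HasOrder± v m d)) → ⊥
      assign-c (v₂ , le₂ , nz₂ , od , hd) = conclude (assign-order {m} nz₂ (le₂ (le₁ (periodic nt))) (+ c))
        where
        conclude : (∃ λ v → v₂ ⊑ v × NonZeroFun v × ∃ (HasOrder± v m (+ c))) → ⊥
        conclude (v , le₃ , nz , oc , hc) = cases nt′ h′ hs′ hd′ hc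
          (solutions os od oc (trace-equation {m} {s = s} {d} {+ c} {os} {od} {oc} (nonzero nt′) (periodic nt′) h′ hs′ hd′ hc))
          where
          nt′ : Nontrivial m v
          nt′ = nontrivial-⊑ (λ x → le₃ (le₂ (le₁ x))) nz nt
          h′ : CosRel v s d (+ c)
          h′ = le₃ (le₂ (le₁ h))
          hs′ : HasOrder± v m s os
          hs′ = HasOrder±-⊑ {o = os} (λ x → le₃ (le₂ x)) hs
          hd′ : HasOrder± v m d od
          hd′ = HasOrder±-⊑ {o = od} le₃ hd

  -- (T - 1) w has zero sum over a period by telescoping. If it is nonzero it is nontrivial, which
  -- is excluded; if it is zero, T fixes `w`.
  cosRel-constant : ∀ w → Fixes w (+ m) → CosRel w s d (+ c) → ∀ i → w i ≡ w 0ℤ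
  cosRel-constant w pw h = conclude (zero? {m} (⊑-⟦⟧ Δ w pw))
    where
    open OpRing w
    open OpSolver w
    Δ = sh 1ℤ ⊕ con -1ℤ
    S = sumSh 1ℤ (multiples 1 0 m)
    pw′ : Fixes w (+ (1 ℕ.* m) ℤ.* 1ℤ)
    pw′ = subst (Fixes w) (trans (cong +_ (sym (ℕₚ.*-identityˡ m))) (sym (ℤₚ.*-identityʳ _))) pw
    SΔ≈0 : S ⊗ Δ ≈[ w ] con 0ℤ
    SΔ≈0 = ≈-trans (solve 2 (λ x y → y :* (x :+ # -1ℤ) := x :* y :- y) ≈-refl (sh 1ℤ) S)
      (≈-trans (+-congʳ (geometric-invariant 1 1ℤ m pw′)) (solve 1 (λ y → y :- y := # 0ℤ) ≈-refl S))
    conclude : NonZeroFun (⟦ Δ ⟧ w) ⊎ (∀ i → ⟦ Δ ⟧ w i ≡ 0ℤ) → ∀ i → w i ≡ w 0ℤ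
    conclude (inj₁ nz) = contradiction (⊑-⟦⟧ Δ w h) (¬nontrivial record
      { nonzero = nz ; periodic = ⊑-⟦⟧ Δ w pw ; zeroSum = mk (at SΔ≈0) })
    conclude (inj₂ z) i = trans (cong w (sym (trans (ℤₚ.+-identityˡ _) (ℤₚ.*-identityʳ i))))
      (fixes-at {w} {i ℤ.* 1ℤ} (fixes-* i (sum-zero⇒ {w} {1ℤ} -1ℤ (mk z))) 0ℤ)

-- The kernel of the adjacency matrix

module ℚ-Solver where
  open RationalSolver.+-*-Solver public
    using (solve; _:=_; _:+_; _:*_; _:-_; :-_) renaming (con to #)

fromℤ-+ : ∀ i j → fromℤ (i ℤ.+ j) ≡ fromℤ i ℚ.+ fromℤ j
fromℤ-+ i j = ℚₚ.toℚᵘ-injective (ℚᵘₚ.≃-trans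
  (ℚᵘ.*≡* (solve 2 (λ i j → (i :+ j) :* # 1ℤ := (i :* # 1ℤ :+ j :* # 1ℤ) :* # 1ℤ) refl i j))
  (ℚᵘₚ.≃-sym (ℚₚ.toℚᵘ-homo-+ (fromℤ i) (fromℤ j))))
  where open ℤ-Solver

fromℤ-* : ∀ i j → fromℤ (i ℤ.* j) ≡ fromℤ i ℚ.* fromℤ j
fromℤ-* i j = ℚₚ.toℚᵘ-injective (ℚᵘₚ.≃-sym (ℚₚ.toℚᵘ-homo-* (fromℤ i) (fromℤ j)))

fromℤ-injective : ∀ {i j} → fromℤ i ≡ fromℤ j → i ≡ j
fromℤ-injective = cong ↥_

denominator-* : ∀ p → fromℤ (↧ p) ℚ.* p ≡ fromℤ (↥ p)
denominator-* p@record{} = ℚₚ.toℚᵘ-injective (ℚᵘₚ.≃-trans (ℚₚ.toℚᵘ-homo-* (fromℤ (↧ p)) p)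
  (ℚᵘ.*≡* (trans (solve 2 (λ n d → d :* n :* # 1ℤ := n :* d) refl (↥ p) (↧ p))
    (cong (λ t → ↥ p ℤ.* + suc t) (sym (ℕₚ.+-identityʳ _))))))
  where open ℤ-Solver

record Clears (D : ℤ) (x : ℚ) (n : ℤ) : Set where
  constructor clears
  field cleared : fromℤ D ℚ.* x ≡ fromℤ n
open Clears public

clears-+ : ∀ {D x y k n} → Clears D x k → Clears D y n → Clears D (x ℚ.+ y) (k ℤ.+ n)
clears-+ {D} {x} {y} {k} {n} (clears hx) (clears hy) = clears (trans (ℚₚ.*-distribˡ-+ (fromℤ D) x y)
  (trans (cong₂ ℚ._+_ hx hy) (sym (fromℤ-+ k n))))

clears-0 : ∀ {D x n} → x ≡ 0ℚ → Clears D x n → n ≡ 0ℤ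
clears-0 {D} refl (clears h) = fromℤ-injective (trans (sym h) (ℚₚ.*-zeroʳ (fromℤ D)))

clears-* : ∀ L {D x n} → Clears D x n → Clears (L ℤ.* D) x (L ℤ.* n)
clears-* L {D} {x} {n} (clears h) = clears (trans (cong (ℚ._* x) (fromℤ-* L D))
  (trans (ℚₚ.*-assoc (fromℤ L) (fromℤ D) x) (trans (cong (fromℤ L ℚ.*_) h) (sym (fromℤ-* L n)))))

clear-denominators : ∀ n (f : Fin n → ℚ) →
  ∃ λ D → D ≢ 0ℤ × ∃ λ (g : Fin n → ℤ) → ∀ i → Clears D (f i) (g i)
clear-denominators zero    f = 1ℤ , (λ ()) , (λ ()) , λ ()
clear-denominators (suc n) f = ↧ p ℤ.* D , ≢0 , g′ , h′
  where
  p = f Fin.zero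
  rec = clear-denominators n (f ∘ Fin.suc)
  D = proj₁ rec
  g = proj₁ (proj₂ (proj₂ rec))
  ≢0 : ↧ p ℤ.* D ≢ 0ℤ
  ≢0 e with ℤₚ.i*j≡0⇒i≡0∨j≡0 (↧ p) e
  ... | inj₂ D≡0 = proj₁ (proj₂ rec) D≡0
  g′ : Fin (suc n) → ℤ
  g′ Fin.zero    = D ℤ.* ↥ p
  g′ (Fin.suc i) = ↧ p ℤ.* g i
  h′ : ∀ i → Clears (↧ p ℤ.* D) (f i) (g′ i)
  h′ Fin.zero    = subst (λ K → Clears K p (D ℤ.* ↥ p)) (ℤₚ.*-comm D (↧ p)) (clears-* D (clears (denominator-* p)))
  h′ (Fin.suc i) = clears-* (↧ p) (proj₂ (proj₂ (proj₂ rec)) i)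

sumFin-cong : ∀ n {f g} → (∀ i → f i ≡ g i) → sumFin n f ≡ sumFin n g
sumFin-cong zero    h = refl
sumFin-cong (suc n) h = cong₂ ℚ._+_ (h Fin.zero) (sumFin-cong n (h ∘ Fin.suc))

sumFin-+ : ∀ n f g → sumFin n (λ i → f i ℚ.+ g i) ≡ sumFin n f ℚ.+ sumFin n g
sumFin-+ zero    f g = refl
sumFin-+ (suc n) f g = trans (cong (f Fin.zero ℚ.+ g Fin.zero ℚ.+_) (sumFin-+ n (f ∘ Fin.suc) (g ∘ Fin.suc)))
  (solve 4 (λ a b c d → (a :+ b) :+ (c :+ d) := (a :+ c) :+ (b :+ d)) refl
    (f Fin.zero) (g Fin.zero) (sumFin n (f ∘ Fin.suc)) (sumFin n (g ∘ Fin.suc)))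
  where open ℚ-Solver

sumFin-0 : ∀ n {f} → (∀ i → f i ≡ 0ℚ) → sumFin n f ≡ 0ℚ
sumFin-0 zero    h = refl
sumFin-0 (suc n) h = trans (cong₂ ℚ._+_ (h Fin.zero) (sumFin-0 n (h ∘ Fin.suc))) refl

sumFin-single : ∀ n {f} j → (∀ i → i ≢ j → f i ≡ 0ℚ) → sumFin n f ≡ f j
sumFin-single (suc n) {f} Fin.zero    h =
  trans (cong (f Fin.zero ℚ.+_) (sumFin-0 n (λ i → h (Fin.suc i) λ ()))) (ℚₚ.+-identityʳ _)
sumFin-single (suc n) {f} (Fin.suc j) h =
  trans (cong₂ ℚ._+_ (h Fin.zero λ ()) (sumFin-single n j (λ i i≢j → h (Fin.suc i) (i≢j ∘ Finₚ.suc-injective))))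
    (ℚₚ.+-identityˡ _)

if-false : ∀ {b} x → b ≡ false → (if b then 1ℚ else 0ℚ) ℚ.* x ≡ 0ℚ
if-false x refl = ℚₚ.*-zeroˡ x

if-true : ∀ {b} x → b ≡ true → (if b then 1ℚ else 0ℚ) ℚ.* x ≡ x
if-true x refl = ℚₚ.*-identityˡ x

indicator-∨ : ∀ {P Q : Set} (P? : Dec P) (Q? : Dec Q) → (P → ¬ Q) → ∀ x →
  (if does P? ∨ does Q? then 1ℚ else 0ℚ) ℚ.* x ≡
  (if does P? then 1ℚ else 0ℚ) ℚ.* x ℚ.+ (if does Q? then 1ℚ else 0ℚ) ℚ.* x
indicator-∨ (yes p) (yes q) disjoint x = contradiction q (disjoint p)
indicator-∨ (yes p) (no _)  disjoint x =
  sym (trans (cong (1ℚ ℚ.* x ℚ.+_) (ℚₚ.*-zeroˡ x)) (ℚₚ.+-identityʳ (1ℚ ℚ.* x)))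
indicator-∨ (no _)  Q?      disjoint x =
  sym (trans (cong (ℚ._+ (if does Q? then 1ℚ else 0ℚ) ℚ.* x) (ℚₚ.*-zeroˡ x))
             (ℚₚ.+-identityˡ ((if does Q? then 1ℚ else 0ℚ) ℚ.* x)))

module _ {m : ℕ} .{{_ : ℕ.NonZero m}} where

  reduce : ℤ → Fin m
  reduce z = fromℕ< (ℤDivMod.n%ℕd<d z m)

  extend : {X : Set} → (Fin m → X) → ℤ → X
  extend f z = f (reduce z)

  toℕ-reduce : ∀ z → toℕ (reduce z) ≡ z ℤDivMod.%ℕ m
  toℕ-reduce z = Finₚ.toℕ-fromℕ< (ℤDivMod.n%ℕd<d z m)

  reduce-split : ∀ z → z ≡ pos (reduce z) ℤ.+ (z ℤDivMod./ℕ m) ℤ.* + m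
  reduce-split z = trans (ℤDivMod.a≡a%ℕn+[a/ℕn]*n z m)
    (cong (λ t → + t ℤ.+ (z ℤDivMod./ℕ m) ℤ.* + m) (sym (toℕ-reduce z)))

  reduce-cong : ∀ z → m ∣ ∣ pos (reduce z) ℤ.- z ∣
  reduce-cong z = ℤS.∣⇒∣ᵤ {+ m} {pos (reduce z) ℤ.- z} (ℤS.divides (ℤ.- q) (trans
    (cong (λ t → r ℤ.- t) (reduce-split z))
    (solve 3 (λ r q m → r :- (r :+ q :* m) := (:- q) :* m) refl r q (+ m))))
    where
    open ℤ-Solver
    r = pos (reduce z)
    q = z ℤDivMod./ℕ m

  cong-trans : ∀ x y z → m ∣ ∣ x ℤ.- y ∣ → m ∣ ∣ y ℤ.- z ∣ → m ∣ ∣ x ℤ.- z ∣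
  cong-trans x y z h k = ℤS.∣⇒∣ᵤ {+ m} {x ℤ.- z} (subst (+ m ℤS.∣_)
    (solve 3 (λ x y z → (x :- y) :+ (y :- z) := x :- z) refl x y z)
    (ℤS.∣m∣n⇒∣m+n (ℤS.∣ᵤ⇒∣ {+ m} {x ℤ.- y} h) (ℤS.∣ᵤ⇒∣ {+ m} {y ℤ.- z} k)))
    where open ℤ-Solver

  cong-sym : ∀ x y → m ∣ ∣ x ℤ.- y ∣ → m ∣ ∣ y ℤ.- x ∣
  cong-sym x y = subst (m ∣_) (ℤₚ.∣i-j∣≡∣j-i∣ x y)

  pos-unique : ∀ (i j : Fin m) → m ∣ ∣ pos i ℤ.- pos j ∣ → i ≡ j
  pos-unique i j h with ∣ pos i ℤ.- pos j ∣ in e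
  ... | zero  = Finₚ.toℕ-injective (ℤₚ.+-injective (ℤₚ.i-j≡0⇒i≡j (pos i) (pos j) (ℤₚ.∣i∣≡0⇒i≡0 e)))
  ... | suc k = contradiction (∣⇒≤ h) (ℕₚ.<⇒≱ (subst (_< m) e bound))
    where
    bound : ∣ pos i ℤ.- pos j ∣ < m
    bound = ℕₚ.≤-<-trans (ℕₚ.≤-trans (ℕₚ.≤-reflexive (cong ∣_∣ (ℤₚ.m-n≡m⊖n (toℕ i) (toℕ j))))
      (ℤₚ.∣m⊝n∣≤m⊔n (toℕ i) (toℕ j)))
      (ℕₚ.⊔-pres-<m (Finₚ.toℕ<n i) (Finₚ.toℕ<n j))

  reduce-unique : ∀ i z → m ∣ ∣ pos i ℤ.- z ∣ → i ≡ reduce z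
  reduce-unique i z h = pos-unique i (reduce z) (cong-trans (pos i) z (pos (reduce z)) h
    (cong-sym (pos (reduce z)) z (reduce-cong z)))

  reduce-pos : ∀ i → reduce (pos i) ≡ i
  reduce-pos i = pos-unique (reduce (pos i)) i (reduce-cong (pos i))

  reduce-periodic : ∀ z → reduce (z ℤ.+ + m) ≡ reduce z
  reduce-periodic z = reduce-unique _ z (cong-trans (pos (reduce (z ℤ.+ + m))) (z ℤ.+ + m) z
    (reduce-cong (z ℤ.+ + m)) (ℤS.∣⇒∣ᵤ {+ m} {z ℤ.+ + m ℤ.- z} (subst (+ m ℤS.∣_)
      (solve 2 (λ z m → m := z :+ m :- z) refl z (+ m)) ℤS.∣-refl)))
    where open ℤ-Solver

  extend-periodic : ∀ f → Fixes (extend f) (+ m)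
  extend-periodic f = mk λ i → trans (cong f (reduce-periodic i)) (sym (ℤₚ.*-identityˡ _))

  extend-pos : {X : Set} (f : Fin m → X) → ∀ i → extend f (pos i) ≡ f i
  extend-pos f i = cong f (reduce-pos i)

  periodic-extend : ∀ {w} → Fixes w (+ m) → ∀ z → w (pos (reduce z)) ≡ w z
  periodic-extend {w} pw z = sym (trans (cong w (reduce-split z))
    (fixes-at (fixes-* (z ℤDivMod./ℕ m) pw) (pos (reduce z))))

  sumFin-cong? : ∀ z (f : Fin m → ℚ) →
    sumFin m (λ j → (if cong? m (pos j) z then 1ℚ else 0ℚ) ℚ.* f j) ≡ extend f z
  sumFin-cong? z f = trans (sumFin-single m (reduce z) off) on
    where
    off : ∀ i → i ≢ reduce z → (if cong? m (pos i) z then 1ℚ else 0ℚ) ℚ.* f i ≡ 0ℚ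
    off i i≢ = if-false (f i) (dec-false (m ∣? ∣ pos i ℤ.- z ∣) (i≢ ∘ reduce-unique i z))
    on : (if cong? m (pos (reduce z)) z then 1ℚ else 0ℚ) ℚ.* f (reduce z) ≡ f (reduce z)
    on = if-true (f (reduce z)) (dec-true (m ∣? ∣ pos (reduce z) ℤ.- z ∣) (reduce-cong z))

  -- Matrix entries are 0 or 1, so the two neighbours contribute one term each only if they are
  -- distinct modulo `m`.
  sumFin-∨ : ∀ z z′ → ¬ (m ∣ ∣ z ℤ.- z′ ∣) → (f : Fin m → ℚ) →
    sumFin m (λ j → (if cong? m (pos j) z ∨ cong? m (pos j) z′ then 1ℚ else 0ℚ) ℚ.* f j) ≡
    extend f z ℚ.+ extend f z′
  sumFin-∨ z z′ z≢z′ f = trans (trans (sumFin-cong m split-∨) (sumFin-+ m _ _))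
    (cong₂ ℚ._+_ (sumFin-cong? z f) (sumFin-cong? z′ f))
    where
    split-∨ : ∀ j → (if cong? m (pos j) z ∨ cong? m (pos j) z′ then 1ℚ else 0ℚ) ℚ.* f j ≡
      (if cong? m (pos j) z then 1ℚ else 0ℚ) ℚ.* f j ℚ.+ (if cong? m (pos j) z′ then 1ℚ else 0ℚ) ℚ.* f j
    split-∨ j = indicator-∨ (m ∣? ∣ pos j ℤ.- z ∣) (m ∣? ∣ pos j ℤ.- z′ ∣)
      (λ p q → z≢z′ (cong-trans z (pos j) z′ (cong-sym (pos j) z p) q)) (f j)

-- (f , g) ↦ the coordinates of A (f , g) at x_i and at y_i.
Rows : {X : Set} → (X → X → X) → (a b c : ℕ) → (ℤ → X) → (ℤ → X) → ℤ → X × X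
Rows _+_ a b c f g i =
    ((f (i ℤ.+ + a) + f (i ℤ.- + a)) + (g i + g (i ℤ.+ + c)))
  , ((f i + f (i ℤ.- + c)) + (g (i ℤ.+ + b) + g (i ℤ.- + b)))

module _ {m a b c : ℕ} .{{_ : ℕ.NonZero m}}
  (1≤a : 1 ≤ a) (a≤b : a ≤ b) (2b<m : 2 ℕ.* b < m) (1≤c : 1 ≤ c) (2c≤m : 2 ℕ.* c ≤ m) where

  ∤-small : ∀ {k} → 1 ≤ k → k < m → ¬ (m ∣ k)
  ∤-small {suc k} _ k<m m∣k = ℕₚ.<⇒≱ k<m (∣⇒≤ m∣k)

  -- The difference is 2k with 0 < 2k < m, by the bound on `b`.
  ±-distinct : ∀ k → 1 ≤ k → k ≤ b → ∀ i → ¬ (m ∣ ∣ (i ℤ.+ + k) ℤ.- (i ℤ.- + k) ∣)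
  ±-distinct k 1≤k k≤b i = subst (λ t → ¬ (m ∣ t)) (sym (cong ∣_∣ difference))
    (∤-small (ℕₚ.≤-trans 1≤k (ℕₚ.m≤m+n k _)) (ℕₚ.≤-<-trans (ℕₚ.*-monoʳ-≤ 2 k≤b) 2b<m))
    where
    open ℤ-Solver
    difference : (i ℤ.+ + k) ℤ.- (i ℤ.- + k) ≡ + (2 ℕ.* k)
    difference = trans (solve 2 (λ i k → (i :+ k) :- (i :- k) := # (+ 2) :* k) refl i (+ k)) (sym (ℤₚ.pos-* 2 k))

  c<m : c < m
  c<m = ℕₚ.<-≤-trans (ℕₚ.m<m+n c (ℕₚ.≤-trans 1≤c (ℕₚ.m≤m+n c 0))) 2c≤m

  c-distinct : ∀ i j → j ≡ i ℤ.+ + c ⊎ j ≡ i ℤ.- + c → ¬ (m ∣ ∣ i ℤ.- j ∣)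
  c-distinct i j e = subst (λ t → ¬ (m ∣ t)) (sym (size e)) (∤-small 1≤c c<m)
    where
    open ℤ-Solver
    size : j ≡ i ℤ.+ + c ⊎ j ≡ i ℤ.- + c → ∣ i ℤ.- j ∣ ≡ c
    size (inj₁ refl) = trans (cong ∣_∣ (solve 2 (λ i c → i :- (i :+ c) := :- c) refl i (+ c))) (ℤₚ.∣-i∣≡∣i∣ (+ c))
    size (inj₂ refl) = cong ∣_∣ (solve 2 (λ i c → i :- (i :- c) := c) refl i (+ c))

  rows : (Vert m → ℚ) → ℤ → ℚ × ℚ
  rows y = Rows ℚ._+_ a b c (extend (y ∘ inj₁)) (extend (y ∘ inj₂))

  adjacency-x : ∀ y i → sumV m (λ v → adjMat m a b c (inj₁ i) v ℚ.* y v) ≡ proj₁ (rows y (pos i))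
  adjacency-x y i = cong₂ ℚ._+_
    (sumFin-∨ (pos i ℤ.+ + a) (pos i ℤ.- + a) (±-distinct a 1≤a a≤b (pos i)) (y ∘ inj₁))
    (sumFin-∨ (pos i) (pos i ℤ.+ + c) (c-distinct (pos i) _ (inj₁ refl)) (y ∘ inj₂))

  adjacency-y : ∀ y i → sumV m (λ v → adjMat m a b c (inj₂ i) v ℚ.* y v) ≡ proj₂ (rows y (pos i))
  adjacency-y y i = cong₂ ℚ._+_
    (trans (sumFin-cong m transpose)
      (sumFin-∨ (pos i) (pos i ℤ.- + c) (c-distinct (pos i) _ (inj₂ refl)) (y ∘ inj₁)))
    (sumFin-∨ (pos i ℤ.+ + b) (pos i ℤ.- + b) (±-distinct b (ℕₚ.≤-trans 1≤a a≤b) ℕₚ.≤-refl (pos i)) (y ∘ inj₂))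
    where
    open ℤ-Solver
    -- The neighbours x_j of y_i satisfy i = j or i = j + c, that is, j = i or j = i - c.
    transpose : ∀ j →
      (if cong? m (pos i) (pos j) ∨ cong? m (pos i) (pos j ℤ.+ + c) then 1ℚ else 0ℚ) ℚ.* y (inj₁ j) ≡
      (if cong? m (pos j) (pos i) ∨ cong? m (pos j) (pos i ℤ.- + c) then 1ℚ else 0ℚ) ℚ.* y (inj₁ j)
    transpose j = cong₂ (λ s t → (if does (m ∣? s) ∨ does (m ∣? t) then 1ℚ else 0ℚ) ℚ.* y (inj₁ j))
      (ℤₚ.∣i-j∣≡∣j-i∣ (pos i) (pos j))
      (trans (ℤₚ.∣i-j∣≡∣j-i∣ (pos i) (pos j ℤ.+ + c))
        (cong ∣_∣ (solve 3 (λ i j c → j :+ c :- i := j :- (i :- c)) refl (pos i) (pos j) (+ c))))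

  kernel⇒rows : ∀ {y} → InKernel m (adjMat m a b c) y → ∀ i →
    proj₁ (rows y (pos i)) ≡ 0ℚ × proj₂ (rows y (pos i)) ≡ 0ℚ
  kernel⇒rows {y} h i = trans (sym (adjacency-x y i)) (h (inj₁ i)) , trans (sym (adjacency-y y i)) (h (inj₂ i))

  rows⇒kernel : ∀ {y} → (∀ i → proj₁ (rows y (pos i)) ≡ 0ℚ × proj₂ (rows y (pos i)) ≡ 0ℚ) →
    InKernel m (adjMat m a b c) y
  rows⇒kernel {y} h (inj₁ i) = trans (adjacency-x y i) (proj₁ (h i))
  rows⇒kernel {y} h (inj₂ i) = trans (adjacency-y y i) (proj₂ (h i))

-- Elimination in the two by two block system

1+T : ℤ → Op
1+T e = con 1ℤ ⊕ sh e

module _ {u : ℤ → ℤ} where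
  open OpRing u
  open OpSolver u
  open SetoidReasoning setoid

  cos-*-cos : ∀ e f → cos e ⊗ cos f ≈[ u ] cos (e ℤ.+ f) ⊕ cos (e ℤ.- f)
  cos-*-cos e f = begin
    cos e ⊗ cos f
      ≈⟨ solve 4 (λ x x⁻ y y⁻ → (x :+ x⁻) :* (y :+ y⁻) := (x :* y :+ x⁻ :* y⁻) :+ (x :* y⁻ :+ x⁻ :* y)) ≈-refl
           (sh e) (sh (ℤ.- e)) (sh f) (sh (ℤ.- f)) ⟩
    (sh e ⊗ sh f ⊕ sh (ℤ.- e) ⊗ sh (ℤ.- f)) ⊕ (sh e ⊗ sh (ℤ.- f) ⊕ sh (ℤ.- e) ⊗ sh f)
      ≈⟨ +-cong (+-cong (sh-+ e f) (≈-trans (sh-≡ (ℤₚ.neg-distrib-+ e f)) (sh-+ (ℤ.- e) (ℤ.- f))))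
                (+-cong (sh-+ e (ℤ.- f)) (≈-trans (sh-≡ (neg-- e f)) (sh-+ (ℤ.- e) f))) ⟨
    cos (e ℤ.+ f) ⊕ cos (e ℤ.- f) ∎
    where
    neg-- : ∀ e f → ℤ.- (e ℤ.- f) ≡ ℤ.- e ℤ.+ f
    neg-- e f = trans (ℤₚ.neg-distrib-+ e (ℤ.- f)) (cong (λ t → ℤ.- e ℤ.+ t) (ℤₚ.neg-involutive f))

  1+T-*-1+T⁻¹ : ∀ e → 1+T e ⊗ 1+T (ℤ.- e) ≈[ u ] cos 0ℤ ⊕ cos e
  1+T-*-1+T⁻¹ e = begin
    1+T e ⊗ 1+T (ℤ.- e)
      ≈⟨ solve 2 (λ x y → (# 1ℤ :+ x) :* (# 1ℤ :+ y) := # 1ℤ :+ x :* y :+ (x :+ y)) ≈-refl (sh e) (sh (ℤ.- e)) ⟩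
    con 1ℤ ⊕ sh e ⊗ sh (ℤ.- e) ⊕ cos e ≈⟨ +-congʳ (+-congˡ (sh-inverse e)) ⟩
    con 1ℤ ⊕ con 1ℤ ⊕ cos e ≈⟨ +-congʳ cos-0 ⟨
    cos 0ℤ ⊕ cos e ∎

  -- The hypothesis equates the products of the diagonal and of the off-diagonal blocks of the
  -- adjacency matrix. The product formula for cosines is the origin of the exponents a + b and a -
  -- b.
  determinant⇒CosRel : ∀ {a b c} → cos b ⊗ cos a ≈[ u ] 1+T c ⊗ 1+T (ℤ.- c) → CosRel u (a ℤ.+ b) (a ℤ.- b) c
  determinant⇒CosRel {a} {b} {c} h = begin
    cos (a ℤ.+ b) ⊕ cos (a ℤ.- b)  ≈⟨ cos-*-cos a b ⟨
    cos a ⊗ cos b                  ≈⟨ *-comm (cos a) (cos b) ⟩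
    cos b ⊗ cos a                  ≈⟨ h ⟩
    1+T c ⊗ 1+T (ℤ.- c)            ≈⟨ 1+T-*-1+T⁻¹ c ⟩
    cos 0ℤ ⊕ cos c                 ∎

  CosRel⇒determinant : ∀ {a b c} → CosRel u (a ℤ.+ b) (a ℤ.- b) c → cos a ⊗ cos b ≈[ u ] 1+T c ⊗ 1+T (ℤ.- c)
  CosRel⇒determinant {a} {b} {c} h = ≈-trans (cos-*-cos a b) (≈-trans h (≈-sym (1+T-*-1+T⁻¹ c)))

-- Applying `q′` to the first equation and `q` to the second produces the same term in `g`, which
-- cancels; nothing is inverted.
eliminate : ∀ {f g} p q p′ q′ →
  (∀ i → ⟦ p ⟧ f i ℤ.+ ⟦ q ⟧ g i ≡ 0ℤ) → (∀ i → ⟦ p′ ⟧ f i ℤ.+ ⟦ q′ ⟧ g i ≡ 0ℤ) →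
  q′ ⊗ p ≈[ f ] q ⊗ p′
eliminate {f} {g} p q p′ q′ h h′ = mk λ i → ℤ+.∙-cancelʳ (⟦ q ⟧ (⟦ q′ ⟧ g) i) _ _ (begin
  ⟦ q′ ⟧ (⟦ p ⟧ f) i ℤ.+ ⟦ q ⟧ (⟦ q′ ⟧ g) i   ≡⟨ cong (λ t → ⟦ q′ ⟧ (⟦ p ⟧ f) i ℤ.+ t) (⟦⟧-comm q q′ g i) ⟩
  ⟦ q′ ⟧ (⟦ p ⟧ f) i ℤ.+ ⟦ q′ ⟧ (⟦ q ⟧ g) i   ≡⟨ ⟦⟧-+ q′ (⟦ p ⟧ f) (⟦ q ⟧ g) i ⟨
  ⟦ q′ ⟧ (λ j → ⟦ p ⟧ f j ℤ.+ ⟦ q ⟧ g j) i    ≡⟨ ⟦⟧-0 q′ h i ⟩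
  0ℤ                                           ≡⟨ ⟦⟧-0 q h′ i ⟨
  ⟦ q ⟧ (λ j → ⟦ p′ ⟧ f j ℤ.+ ⟦ q′ ⟧ g j) i   ≡⟨ ⟦⟧-+ q (⟦ p′ ⟧ f) (⟦ q′ ⟧ g) i ⟩
  ⟦ q ⟧ (⟦ p′ ⟧ f) i ℤ.+ ⟦ q ⟧ (⟦ q′ ⟧ g) i   ∎)
  where
  open ≡-Reasoning

double≡0 : ∀ x → x ℤ.+ x ≡ 0ℤ → x ≡ 0ℤ
double≡0 (+ zero)  e = refl
double≡0 (+ suc n) ()
double≡0 -[1+ n ] ()

module _ {m : ℕ} .{{_ : ℕ.NonZero m}} where

  Kernelℤ : (a b c : ℕ) → (ℤ → ℤ) → (ℤ → ℤ) → Set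
  Kernelℤ a b c f g = (∀ i → ⟦ cos (+ a) ⟧ f i ℤ.+ ⟦ 1+T (+ c) ⟧ g i ≡ 0ℤ)
                    × (∀ i → ⟦ 1+T (ℤ.- + c) ⟧ f i ℤ.+ ⟦ cos (+ b) ⟧ g i ≡ 0ℤ)

  row-x≡ : ∀ {a b c f g} i →
    proj₁ (Rows ℤ._+_ a b c f g i) ≡ ⟦ cos (+ a) ⟧ f i ℤ.+ ⟦ 1+T (+ c) ⟧ g i
  row-x≡ {a} {c = c} {f} {g} i =
    cong (λ t → (f (i ℤ.+ + a) ℤ.+ f (i ℤ.- + a)) ℤ.+ (t ℤ.+ g (i ℤ.+ + c))) (sym (ℤₚ.*-identityˡ (g i)))

  row-y≡ : ∀ {a b c f g} i →
    proj₂ (Rows ℤ._+_ a b c f g i) ≡ ⟦ 1+T (ℤ.- + c) ⟧ f i ℤ.+ ⟦ cos (+ b) ⟧ g i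
  row-y≡ {b = b} {c} {f} {g} i =
    cong (λ t → (t ℤ.+ f (i ℤ.- + c)) ℤ.+ (g (i ℤ.+ + b) ℤ.+ g (i ℤ.- + b))) (sym (ℤₚ.*-identityˡ (f i)))

  clears-Rows : ∀ {a b c} D {f g : ℤ → ℚ} {F G : ℤ → ℤ} →
    (∀ i → Clears D (f i) (F i)) → (∀ i → Clears D (g i) (G i)) → ∀ i →
    Clears D (proj₁ (Rows ℚ._+_ a b c f g i)) (proj₁ (Rows ℤ._+_ a b c F G i)) ×
    Clears D (proj₂ (Rows ℚ._+_ a b c f g i)) (proj₂ (Rows ℤ._+_ a b c F G i))
  clears-Rows {a} {b} {c} D hf hg i =
      clears-+ (clears-+ (hf (i ℤ.+ + a)) (hf (i ℤ.- + a))) (clears-+ (hg i) (hg (i ℤ.+ + c)))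
    , clears-+ (clears-+ (hf i) (hf (i ℤ.- + c))) (clears-+ (hg (i ℤ.+ + b)) (hg (i ℤ.- + b)))

  ⟦⟧+⟦⟧-zero : ∀ p q {f g} → Fixes f (+ m) → Fixes g (+ m) →
    (∀ (i : Fin m) → ⟦ p ⟧ f (pos i) ℤ.+ ⟦ q ⟧ g (pos i) ≡ 0ℤ) → ∀ i → ⟦ p ⟧ f i ℤ.+ ⟦ q ⟧ g i ≡ 0ℤ
  ⟦⟧+⟦⟧-zero p q {f} {g} pf pg h i = trans
    (sym (cong₂ ℤ._+_ (periodic-extend (⊑-⟦⟧ p f pf) i) (periodic-extend (⊑-⟦⟧ q g pg) i))) (h (reduce i))

fromℤ≢0 : ∀ {D} → D ≢ 0ℤ → fromℤ D ≢ 0ℚ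
fromℤ≢0 D≢0 e = D≢0 (fromℤ-injective e)

*-cancelˡ-≡ : ∀ {r p q} → r ≢ 0ℚ → r ℚ.* p ≡ r ℚ.* q → p ≡ q
*-cancelˡ-≡ {r} {p} {q} r≢0 e = begin
  p                    ≡⟨ inverse p ⟨
  1/r ℚ.* (r ℚ.* p)    ≡⟨ cong (1/r ℚ.*_) e ⟩
  1/r ℚ.* (r ℚ.* q)    ≡⟨ inverse q ⟩
  q                    ∎
  where
  open ≡-Reasoning
  instance
    nonZero : ℚ.NonZero r
    nonZero = ℚ.≢-nonZero r≢0
  1/r : ℚ
  1/r = ℚ.1/ r
  inverse : ∀ x → 1/r ℚ.* (r ℚ.* x) ≡ x
  inverse x = trans (sym (ℚₚ.*-assoc 1/r r x)) (trans (cong (ℚ._* x) (ℚₚ.*-inverseˡ r)) (ℚₚ.*-identityˡ x))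

-- Nut graphs and constant solutions

module _ {m a b c : ℕ} .{{_ : ℕ.NonZero m}}
  (1≤a : 1 ≤ a) (a≤b : a ≤ b) (2b<m : 2 ℕ.* b < m) (1≤c : 1 ≤ c) (2c≤m : 2 ℕ.* c ≤ m) where

  OnlyConstants : Set
  OnlyConstants = ∀ w → Fixes w (+ m) → CosRel w (+ a ℤ.+ + b) (+ a ℤ.- + b) (+ c) → ∀ i → w i ≡ w 0ℤ

  -- Every vertex has two neighbours of each kind, so this vector always lies in the kernel.
  balanced : Vert m → ℚ
  balanced = [ (λ _ → 1ℚ) , (λ _ → ℚ.- 1ℚ) ]

  balanced-kernel : InKernel m (adjMat m a b c) balanced
  balanced-kernel = rows⇒kernel 1≤a a≤b 2b<m 1≤c 2c≤m {balanced} (λ i → refl , refl)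

  balanced≢0 : ∀ v → balanced v ≢ 0ℚ
  balanced≢0 (inj₁ _) ()
  balanced≢0 (inj₂ _) ()

  -- Eliminating either half leaves the same determinant, so both halves are constant; the row at
  -- x_0 then reads 2 (f 0 + g 0) = 0.
  kernelℤ-constant : OnlyConstants → ∀ {f g} → Fixes f (+ m) → Fixes g (+ m) → Kernelℤ {m} a b c f g →
    ∀ i → f i ≡ f 0ℤ × g i ≡ ℤ.- f 0ℤ
  kernelℤ-constant only {f} {g} pf pg (hx , hy) i = f-constant i , trans (g-constant i) g0
    where
    f-constant : ∀ i → f i ≡ f 0ℤ
    f-constant = only f pf (determinant⇒CosRel {a = + a} {+ b} {+ c}
      (eliminate {f} {g} (cos (+ a)) (1+T (+ c)) (1+T (ℤ.- + c)) (cos (+ b)) hx hy))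
    g-constant : ∀ i → g i ≡ g 0ℤ
    g-constant = only g pg (determinant⇒CosRel {a = + a} {+ b} {+ c} (≈-trans (*-comm (cos (+ b)) (cos (+ a)))
      (≈-trans (eliminate {g} {f} (cos (+ b)) (1+T (ℤ.- + c)) (1+T (+ c)) (cos (+ a))
        (swap (⟦ 1+T (ℤ.- + c) ⟧ f) (⟦ cos (+ b) ⟧ g) hy) (swap (⟦ cos (+ a) ⟧ f) (⟦ 1+T (+ c) ⟧ g) hx))
               (*-comm (1+T (ℤ.- + c)) (1+T (+ c))))))
      where
      open OpRing g
      swap : ∀ (x y : ℤ → ℤ) → (∀ i → x i ℤ.+ y i ≡ 0ℤ) → ∀ i → y i ℤ.+ x i ≡ 0ℤ
      swap x y h i = trans (ℤₚ.+-comm (y i) (x i)) (h i)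
    sum≡0 : f 0ℤ ℤ.+ g 0ℤ ≡ 0ℤ
    sum≡0 = double≡0 _ (trans (regroup (f 0ℤ) (g 0ℤ))
      (trans (sym (cong₂ ℤ._+_ (cong₂ ℤ._+_ (f-constant (0ℤ ℤ.+ + a)) (f-constant (0ℤ ℤ.+ ℤ.- + a)))
               (cong (λ t → 1ℤ ℤ.* g 0ℤ ℤ.+ t) (g-constant (0ℤ ℤ.+ + c)))))
             (hx 0ℤ)))
      where
      open ℤ-Solver
      regroup : ∀ x y → (x ℤ.+ y) ℤ.+ (x ℤ.+ y) ≡ (x ℤ.+ x) ℤ.+ (1ℤ ℤ.* y ℤ.+ y)
      regroup = solve 2 (λ x y → (x :+ y) :+ (x :+ y) := (x :+ x) :+ (# 1ℤ :* y :+ y)) refl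
    g0 : g 0ℤ ≡ ℤ.- f 0ℤ
    g0 = trans (i≡[j+i]-j (g 0ℤ) (f 0ℤ)) (trans (cong (ℤ._- f 0ℤ) sum≡0) (ℤₚ.+-identityˡ _))
      where
      open ℤ-Solver
      i≡[j+i]-j : ∀ i j → i ≡ j ℤ.+ i ℤ.- j
      i≡[j+i]-j = solve 2 (λ i j → i := j :+ i :- j) refl

  constants⇒nut : OnlyConstants → IsNutB₂ m a b c
  constants⇒nut only = balanced , balanced-kernel , balanced≢0 , multiple
    where
    multiple : ∀ y → InKernel m (adjMat m a b c) y → ∃ λ (t : ℚ) → ∀ v → y v ≡ t ℚ.* balanced v
    multiple y ker = t , proportional
      where
      cx = clear-denominators m (y ∘ inj₁)
      cy = clear-denominators m (y ∘ inj₂)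
      Dx = proj₁ cx
      Dy = proj₁ cy
      D : ℤ
      D = Dx ℤ.* Dy
      D≢0 : D ≢ 0ℤ
      D≢0 e = [ proj₁ (proj₂ cx) , proj₁ (proj₂ cy) ] (ℤₚ.i*j≡0⇒i≡0∨j≡0 Dx e)
      fx = proj₁ (proj₂ (proj₂ cx))
      fy = proj₁ (proj₂ (proj₂ cy))
      f g : ℤ → ℤ
      f = extend (λ i → Dy ℤ.* fx i)
      g = extend (λ i → Dx ℤ.* fy i)
      t : ℚ
      t = extend (y ∘ inj₁) 0ℤ
      f≡ : ∀ z → Clears D (extend (y ∘ inj₁) z) (f z)
      f≡ z = subst (λ K → Clears K (extend (y ∘ inj₁) z) (f z)) (ℤₚ.*-comm Dy Dx)
        (clears-* Dy (proj₂ (proj₂ (proj₂ cx)) (reduce z)))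
      g≡ : ∀ z → Clears D (extend (y ∘ inj₂) z) (g z)
      g≡ z = clears-* Dx (proj₂ (proj₂ (proj₂ cy)) (reduce z))
      pf : Fixes f (+ m)
      pf = extend-periodic (λ i → Dy ℤ.* fx i)
      pg : Fixes g (+ m)
      pg = extend-periodic (λ i → Dx ℤ.* fy i)
      rational = kernel⇒rows 1≤a a≤b 2b<m 1≤c 2c≤m {y} ker
      integral = clears-Rows {m} {a} {b} {c} D f≡ g≡
      kernelℤ : Kernelℤ {m} a b c f g
      kernelℤ =
          ⟦⟧+⟦⟧-zero (cos (+ a)) (1+T (+ c)) pf pg (λ i → trans (sym (row-x≡ {m} {a} {b} {c} {f} {g} (pos i)))
            (clears-0 (proj₁ (rational i)) (proj₁ (integral (pos i)))))
        , ⟦⟧+⟦⟧-zero (1+T (ℤ.- + c)) (cos (+ b)) pf pg (λ i → trans (sym (row-y≡ {m} {a} {b} {c} {f} {g} (pos i)))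
            (clears-0 (proj₂ (rational i)) (proj₂ (integral (pos i)))))
      constant = kernelℤ-constant only {f} {g} pf pg kernelℤ
      cancel : ∀ {x x′} → fromℤ D ℚ.* x ≡ fromℤ D ℚ.* x′ → x ≡ x′
      cancel = *-cancelˡ-≡ (fromℤ≢0 D≢0)
      proportional : ∀ v → y v ≡ t ℚ.* balanced v
      proportional (inj₁ i) = trans (trans (sym (extend-pos (y ∘ inj₁) i)) (cancel (begin
        fromℤ D ℚ.* extend (y ∘ inj₁) (pos i)  ≡⟨ cleared (f≡ (pos i)) ⟩
        fromℤ (f (pos i))                      ≡⟨ cong fromℤ (proj₁ (constant (pos i))) ⟩
        fromℤ (f 0ℤ)                           ≡⟨ cleared (f≡ 0ℤ) ⟨
        fromℤ D ℚ.* t                          ∎))) (sym (ℚₚ.*-identityʳ t))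
        where open ≡-Reasoning
      proportional (inj₂ i) = trans (sym (extend-pos (y ∘ inj₂) i)) (cancel (begin
        fromℤ D ℚ.* extend (y ∘ inj₂) (pos i)  ≡⟨ cleared (g≡ (pos i)) ⟩
        fromℤ (g (pos i))                      ≡⟨ cong fromℤ (trans (proj₂ (constant (pos i))) (sym (ℤₚ.-1*i≡-i (f 0ℤ)))) ⟩
        fromℤ (-1ℤ ℤ.* f 0ℤ)                   ≡⟨ fromℤ-* -1ℤ (f 0ℤ) ⟩
        (ℚ.- 1ℚ) ℚ.* fromℤ (f 0ℤ)              ≡⟨ cong ((ℚ.- 1ℚ) ℚ.*_) (cleared (f≡ 0ℤ)) ⟨
        (ℚ.- 1ℚ) ℚ.* (fromℤ D ℚ.* t)           ≡⟨ swap (ℚ.- 1ℚ) (fromℤ D) t ⟩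
        fromℤ D ℚ.* (t ℚ.* (ℚ.- 1ℚ))           ∎))
        where
        open ≡-Reasoning
        swap : ∀ x y z → x ℚ.* (y ℚ.* z) ≡ y ℚ.* (z ℚ.* x)
        swap x y z = trans (ℚₚ.*-comm x (y ℚ.* z)) (ℚₚ.*-assoc y z x)

  -- The given spanning vector is unknown, but `balanced` is a nonzero multiple of it. Hence it is
  -- constant on each half, and so is every kernel vector.
  nut⇒kernelℤ-constant : IsNutB₂ m a b c → ∀ {f g} → Fixes f (+ m) → Fixes g (+ m) → Kernelℤ {m} a b c f g →
    ∀ i → f i ≡ f 0ℤ × g i ≡ g 0ℤ
  nut⇒kernelℤ-constant (x , ker , _ , multiple) {f} {g} pf pg (hx , hy) i =
      constant pf inj₁ 1ℚ (λ k → proj₂ b-multiple (inj₁ k)) (λ k → proj₂ y-multiple (inj₁ k)) i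
    , constant pg inj₂ (ℚ.- 1ℚ) (λ k → proj₂ b-multiple (inj₂ k)) (λ k → proj₂ y-multiple (inj₂ k)) i
    where
    y : Vert m → ℚ
    y = [ fromℤ ∘ f ∘ pos , fromℤ ∘ g ∘ pos ]
    one* : ∀ {w : ℤ → ℤ} → Fixes w (+ m) → ∀ z → Clears 1ℤ (extend (fromℤ ∘ w ∘ pos {m}) z) (w z)
    one* {w} pw z = clears (trans (ℚₚ.*-identityˡ _) (cong fromℤ (periodic-extend {m} pw z)))
    y-rows = clears-Rows {m} {a} {b} {c} 1ℤ (one* pf) (one* pg)
    y-kernel : InKernel m (adjMat m a b c) y
    y-kernel = rows⇒kernel 1≤a a≤b 2b<m 1≤c 2c≤m {y} λ i →
        trans (sym (ℚₚ.*-identityˡ _)) (trans (cleared (proj₁ (y-rows (pos i))))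
          (cong fromℤ (trans (row-x≡ {m} {a} {b} {c} {f} {g} (pos i)) (hx (pos i)))))
      , trans (sym (ℚₚ.*-identityˡ _)) (trans (cleared (proj₂ (y-rows (pos i))))
          (cong fromℤ (trans (row-y≡ {m} {a} {b} {c} {f} {g} (pos i)) (hy (pos i)))))
    y-multiple : ∃ λ (t : ℚ) → ∀ v → y v ≡ t ℚ.* x v
    y-multiple = multiple y y-kernel
    b-multiple : ∃ λ (t : ℚ) → ∀ v → balanced v ≡ t ℚ.* x v
    b-multiple = multiple balanced balanced-kernel
    t₀ : ℚ
    t₀ = proj₁ b-multiple
    o : Fin m
    o = reduce 0ℤ
    t₀≢0 : t₀ ≢ 0ℚ
    t₀≢0 e = balanced≢0 (inj₁ o) (trans (proj₂ b-multiple (inj₁ o))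
      (trans (cong (ℚ._* x (inj₁ o)) e) (ℚₚ.*-zeroˡ (x (inj₁ o)))))
    constant : ∀ {w : ℤ → ℤ} → Fixes w (+ m) → (inj : Fin m → Vert m) → ∀ κ →
      (∀ k → κ ≡ t₀ ℚ.* x (inj k)) → (∀ k → fromℤ (w (pos k)) ≡ proj₁ y-multiple ℚ.* x (inj k)) →
      ∀ i → w i ≡ w 0ℤ
    constant {w} pw inj κ hκ hw i = fromℤ-injective (begin
      fromℤ (w i)                            ≡⟨ cong fromℤ (periodic-extend pw i) ⟨
      fromℤ (w (pos (reduce {m} i)))         ≡⟨ hw (reduce i) ⟩
      proj₁ y-multiple ℚ.* x (inj (reduce i)) ≡⟨ cong (proj₁ y-multiple ℚ.*_)
                                                  (*-cancelˡ-≡ t₀≢0 (trans (sym (hκ (reduce i))) (hκ o))) ⟩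
      proj₁ y-multiple ℚ.* x (inj o)         ≡⟨ hw o ⟨
      fromℤ (w (pos o))                      ≡⟨ cong fromℤ (periodic-extend pw 0ℤ) ⟩
      fromℤ (w 0ℤ)                           ∎)
      where open ≡-Reasoning

  -- The determinant kills `w`, so both columns of the adjugate matrix, applied to `w`, are kernel
  -- pairs and have constant halves. Thus `A` and `C⁻` kill Δ w, where Δ = T - 1, and (Δ w, 0) is a
  -- kernel pair too. So Δ w is constant, and by A Δ w = 0 twice this constant is 0.
  nut⇒constants : IsNutB₂ m a b c → OnlyConstants
  nut⇒constants nut w pw h i = ℤₚ.i-j≡0⇒i≡j (w i) (w 0ℤ) w-const
    where
    open OpRing w
    open OpSolver w
    A = cos (+ a)
    B = cos (+ b)
    C⁺ = 1+T (+ c)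
    C⁻ = 1+T (ℤ.- + c)
    Δ = sh 1ℤ ⊕ con -1ℤ
    det : A ⊗ B ≈[ w ] C⁺ ⊗ C⁻
    det = CosRel⇒determinant {a = + a} {+ b} {+ c} h
    ⟦⟧-periodic : ∀ p → Fixes (⟦ p ⟧ w) (+ m)
    ⟦⟧-periodic p = ⊑-⟦⟧ p w pw
    pair : ∀ p q → A ⊗ p ⊕ C⁺ ⊗ q ≈[ w ] con 0ℤ → C⁻ ⊗ p ⊕ B ⊗ q ≈[ w ] con 0ℤ →
      ∀ i → ⟦ p ⟧ w i ≡ ⟦ p ⟧ w 0ℤ × ⟦ q ⟧ w i ≡ ⟦ q ⟧ w 0ℤ
    pair p q hx hy = nut⇒kernelℤ-constant nut {⟦ p ⟧ w} {⟦ q ⟧ w} (⟦⟧-periodic p) (⟦⟧-periodic q) (at hx , at hy)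
    constant⇒Δ : ∀ p → (∀ i → ⟦ p ⟧ w i ≡ ⟦ p ⟧ w 0ℤ) → p ⊗ Δ ≈[ w ] con 0ℤ
    constant⇒Δ p k = ≈-trans (*-comm p Δ) (mk λ i → trans
      (cong₂ (λ s t → s ℤ.+ -1ℤ ℤ.* t) (k (i ℤ.+ 1ℤ)) (k i))
      (cancel (⟦ p ⟧ w 0ℤ) (w i)))
      where
      cancel : ∀ x y → x ℤ.+ -1ℤ ℤ.* x ≡ 0ℤ ℤ.* y
      cancel x y = trans (cong (λ t → x ℤ.+ t) (ℤₚ.-1*i≡-i x)) (ℤₚ.+-inverseʳ x)
    first : ∀ i → ⟦ B ⟧ w i ≡ ⟦ B ⟧ w 0ℤ × ⟦ con -1ℤ ⊗ C⁻ ⟧ w i ≡ ⟦ con -1ℤ ⊗ C⁻ ⟧ w 0ℤ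
    first = pair B (con -1ℤ ⊗ C⁻)
      (≈-trans (+-congʳ det) (solve 2 (λ c d → c :* d :+ c :* ((# -1ℤ) :* d) := # 0ℤ) ≈-refl C⁺ C⁻))
      (solve 2 (λ b d → d :* b :+ b :* ((# -1ℤ) :* d) := # 0ℤ) ≈-refl B C⁻)
    second : ∀ i → ⟦ con -1ℤ ⊗ C⁺ ⟧ w i ≡ ⟦ con -1ℤ ⊗ C⁺ ⟧ w 0ℤ × ⟦ A ⟧ w i ≡ ⟦ A ⟧ w 0ℤ
    second = pair (con -1ℤ ⊗ C⁺) A
      (solve 2 (λ a c → a :* ((# -1ℤ) :* c) :+ c :* a := # 0ℤ) ≈-refl A C⁺)
      (≈-trans (+-congˡ (≈-trans (*-comm B A) det))
        (solve 2 (λ c d → d :* ((# -1ℤ) :* c) :+ c :* d := # 0ℤ) ≈-refl C⁺ C⁻))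
    AΔ : A ⊗ Δ ≈[ w ] con 0ℤ
    AΔ = constant⇒Δ A (λ i → proj₂ (second i))
    C⁻Δ : C⁻ ⊗ Δ ≈[ w ] con 0ℤ
    C⁻Δ = ≈-trans (solve 2 (λ d x → d :* x := (# -1ℤ) :* ((# -1ℤ) :* d :* x)) ≈-refl C⁻ Δ)
      (≈-trans (*-congˡ (constant⇒Δ (con -1ℤ ⊗ C⁻) (λ i → proj₂ (first i)))) (zeroʳ _))
    Δ-constant : ∀ i → ⟦ Δ ⟧ w i ≡ ⟦ Δ ⟧ w 0ℤ
    Δ-constant i = proj₁ (pair Δ (con 0ℤ)
      (≈-trans (+-congʳ AΔ) (solve 1 (λ c → # 0ℤ :+ c :* # 0ℤ := # 0ℤ) ≈-refl C⁺))
      (≈-trans (+-congʳ C⁻Δ) (solve 1 (λ b → # 0ℤ :+ b :* # 0ℤ := # 0ℤ) ≈-refl B)) i)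
    Δ-zero : ∀ i → ⟦ Δ ⟧ w i ≡ 0ℤ
    Δ-zero i = trans (Δ-constant i) (double≡0 (⟦ Δ ⟧ w 0ℤ)
      (trans (sym (cong₂ ℤ._+_ (Δ-constant (0ℤ ℤ.+ + a)) (Δ-constant (0ℤ ℤ.+ ℤ.- + a)))) (at AΔ 0ℤ)))
    w-const : w i ℤ.- w 0ℤ ≡ 0ℤ
    w-const = ℤₚ.i≡j⇒i-j≡0 (trans (cong w (sym (trans (ℤₚ.+-identityˡ _) (ℤₚ.*-identityʳ i))))
      (fixes-at {w} {i ℤ.* 1ℤ} (fixes-* i (sum-zero⇒ {w} {1ℤ} -1ℤ (mk Δ-zero))) 0ℤ))

-- Kernel vectors when a condition fails

indicator : ℕ → ℤ → ℤ
indicator n z = if does (n ∣? ∣ z ∣) then 1ℤ else 0ℤ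

indicator-∣ : ∀ {n z} → n ∣ ∣ z ∣ → indicator n z ≡ 1ℤ
indicator-∣ {n} {z} h = cong (if_then 1ℤ else 0ℤ) (dec-true (n ∣? ∣ z ∣) h)

indicator-∤ : ∀ {n z} → ¬ (n ∣ ∣ z ∣) → indicator n z ≡ 0ℤ
indicator-∤ {n} {z} h = cong (if_then 1ℤ else 0ℤ) (dec-false (n ∣? ∣ z ∣) h)

indicator-fixes : ∀ {n e} → n ∣ ∣ e ∣ → Fixes (indicator n) e
indicator-fixes {n} {e} n∣e = mk λ i → trans (go i (n ∣? ∣ i ∣)) (sym (ℤₚ.*-identityˡ (indicator n i)))
  where
  signed : + n ℤS.∣ e
  signed = ℤS.∣ᵤ⇒∣ {+ n} {e} n∣e
  go : ∀ i → _ → indicator n (i ℤ.+ e) ≡ indicator n i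
  go i (yes p) = trans (indicator-∣ {n} {i ℤ.+ e} (ℤS.∣⇒∣ᵤ {+ n} {i ℤ.+ e} (ℤS.∣m∣n⇒∣m+n (ℤS.∣ᵤ⇒∣ {+ n} {i} p) signed)))
                       (sym (indicator-∣ {n} {i} p))
  go i (no ¬p) = trans (indicator-∤ {n} {i ℤ.+ e} (λ q → ¬p (ℤS.∣⇒∣ᵤ {+ n} {i}
                         (ℤS.∣m+n∣n⇒∣m {+ n} {i} {e} (ℤS.∣ᵤ⇒∣ {+ n} {i ℤ.+ e} q) signed))))
                       (sym (indicator-∤ {n} {i} ¬p))

module _ {u : ℤ → ℤ} where
  open OpRing u
  open OpSolver u

  fixes⇒CosRel : ∀ {s d c} → Fixes u d → cos s ≈[ u ] cos c → CosRel u s d c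
  fixes⇒CosRel {s} {d} {c} hd h =
    ≈-trans (+-cong h (≈-trans (fixes-cos hd) (≈-sym cos-0))) (+-comm (cos c) (cos 0ℤ))

  fixes-+⇒cos : ∀ {s c} → Fixes u (s ℤ.+ c) → cos s ≈[ u ] cos c
  fixes-+⇒cos {s} {c} h = ≈-trans
    (cos-resp {x = s} {ℤ.- c} (subst (λ t → Fixes u (s ℤ.+ t)) (sym (ℤₚ.neg-involutive c)) h)) (cos-neg c)

  anti-double⇒cos : ∀ {e} → Anti u (+ 2 ℤ.* e) → cos e ≈[ u ] con 0ℤ
  anti-double⇒cos {e} h = ≈-trans
    (solve 2 (λ x y → x :+ y := y :* (x :* x :+ # 1ℤ) :+ x :* (# 1ℤ :- x :* y)) ≈-refl x y)
    (≈-trans (+-cong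
       (*-congˡ (+-congʳ (≈-trans (≈-sym (≈-trans (sh-*+ 1 1 e) (*-cong (sh-1* e) (sh-1* e)))) h)))
       (*-congˡ (+-congˡ (*-congˡ (sh-inverse e)))))
     (solve 2 (λ x y → y :* (# -1ℤ :+ # 1ℤ) :+ x :* (# 1ℤ :- # 1ℤ) := # 0ℤ) ≈-refl x y))
    where
    x = sh e
    y = sh (ℤ.- e)

  -- Both sides of the determinant equation vanish: 1 + T^c on one side, one of the cosines on the
  -- other.
  anti⇒CosRel : ∀ {a b c} → Anti u c → cos a ≈[ u ] con 0ℤ ⊎ cos b ≈[ u ] con 0ℤ →
    CosRel u (a ℤ.+ b) (a ℤ.- b) c
  anti⇒CosRel {a} {b} {c} hc h = determinant⇒CosRel {a = a} {b} {c}
    (≈-trans (product-zero h) (≈-sym (≈-trans (*-congʳ (+-congˡ hc))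
      (solve 1 (λ x → (# 1ℤ :+ # -1ℤ) :* x := # 0ℤ) ≈-refl (1+T (ℤ.- c))))))
    where
    product-zero : cos a ≈[ u ] con 0ℤ ⊎ cos b ≈[ u ] con 0ℤ → cos b ⊗ cos a ≈[ u ] con 0ℤ
    product-zero (inj₁ k) = ≈-trans (*-congˡ k) (zeroʳ (cos b))
    product-zero (inj₂ k) = ≈-trans (*-congʳ k) (zeroˡ (cos a))

  PM⇒CosRel : ∀ {n s d c p q r} → Fixes u (+ n) → CosRel u (+ p) (+ q) (+ r) →
    PM n s p → PM n d q → PM n c r → CosRel u s d c
  PM⇒CosRel hn h ps pd pc = ≈-trans (+-cong (PM-cos₁ hn ps) (PM-cos₁ hn pd))
    (≈-trans h (+-congˡ (≈-sym (PM-cos₁ hn pc))))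

IsV2⇒TwoPart : ∀ {n k} → IsV2 (+ n) k → TwoPart n k
IsV2⇒TwoPart {n} {k} (divides q e , ¬∣) with parity q
... | j , inj₂ e′ = j , trans e (trans (ℕₚ.*-comm q (2 ℕ.^ k)) (cong (2 ℕ.^ k ℕ.*_) e′))
... | j , inj₁ e′ = contradiction (divides j (trans e (trans (cong (ℕ._* 2 ℕ.^ k) (trans e′ (ℕₚ.*-comm 2 j)))
                      (ℕₚ.*-assoc j 2 (2 ℕ.^ k))))) ¬∣

anti-TwoPart : ∀ {u n k} → Anti u (+ (2 ℕ.^ k)) → TwoPart n k → Anti u (+ n)
anti-TwoPart {u} {n} {k} h (j , e) = subst (Anti u)
  (trans (sym (ℤₚ.pos-* (suc (2 ℕ.* j)) (2 ℕ.^ k))) (cong +_ (trans (ℕₚ.*-comm _ (2 ℕ.^ k)) (sym e)))) (anti-odd j h)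

-- On alternating k the shift by 2ᵏ acts as −1.
alternating : ℕ → ℤ → ℤ
alternating k = ⟦ con 1ℤ ⊕ con -1ℤ ⊗ sh (+ (2 ℕ.^ k)) ⟧ (indicator (2 ℕ.^ suc k))

alternating-fixes : ∀ k {e} → 2 ℕ.^ suc k ∣ ∣ e ∣ → Fixes (alternating k) e
alternating-fixes k {e} h = ⊑-⟦⟧ (con 1ℤ ⊕ con -1ℤ ⊗ sh (+ (2 ℕ.^ k))) (indicator (2 ℕ.^ suc k))
  (indicator-fixes {2 ℕ.^ suc k} {e} h)

-- With h = 2^k, (T^h + 1)(1 - T^h) = 1 - T^{2h} kills the indicator of the multiples of 2h.
alternating-anti : ∀ k → Anti (alternating k) (+ (2 ℕ.^ k))
alternating-anti k = sum-zero⇒ 1ℤ (mk (at killed))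
  where
  w = indicator (2 ℕ.^ suc k)
  h = + (2 ℕ.^ k)
  open OpRing w
  open OpSolver w
  double : h ℤ.+ h ≡ + (2 ℕ.^ suc k)
  double = trans (sym (ℤₚ.pos-+ (2 ℕ.^ k) (2 ℕ.^ k))) (cong (λ t → + (2 ℕ.^ k ℕ.+ t)) (sym (ℕₚ.+-identityʳ _)))
  square : sh h ⊗ sh h ≈[ w ] con 1ℤ
  square = ≈-trans (≈-sym (sh-+ h h)) (≈-trans (sh-≡ double) (indicator-fixes {2 ℕ.^ suc k} {+ (2 ℕ.^ suc k)} ∣-refl))
  killed : (sh h ⊕ con 1ℤ) ⊗ (con 1ℤ ⊕ con -1ℤ ⊗ sh h) ≈[ w ] con 0ℤ
  killed = ≈-trans (solve 1 (λ x → (x :+ # 1ℤ) :* (# 1ℤ :+ (# -1ℤ) :* x) := # 1ℤ :- x :* x) ≈-refl (sh h))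
    (≈-trans (+-congˡ (*-congˡ square)) (solve 0 (# 1ℤ :- # 1ℤ := # 0ℤ) ≈-refl))

alternating-0 : ∀ k → alternating k 0ℤ ≡ 1ℤ
alternating-0 k = cong₂ (λ x y → 1ℤ ℤ.* x ℤ.+ -1ℤ ℤ.* y)
  (indicator-∣ {2 ℕ.^ suc k} {0ℤ} ((2 ℕ.^ suc k) ∣0))
  (indicator-∤ {2 ℕ.^ suc k} {0ℤ ℤ.+ + (2 ℕ.^ k)} λ h → ℕₚ.<⇒≱ (ℕₚ.^-monoʳ-< 2 ℕₚ.≤-refl (ℕₚ.n<1+n k))
    (∣⇒≤ {{ℕₚ.m^n≢0 2 k}} (subst (λ t → 2 ℕ.^ suc k ∣ ∣ t ∣) (ℤₚ.+-identityˡ (+ (2 ℕ.^ k))) h)))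

-- Products of functions on ℤ/4 and ℤ/3, and on ℤ/2, ℤ/3 and ℤ/5, chosen in the span of the characters of
-- exact order 12 and 30.
table₁₂ : Vec ℤ 12
table₁₂ = 1ℤ ∷ 0ℤ ∷ 0ℤ ∷ 0ℤ ∷ -1ℤ ∷ 0ℤ ∷ -1ℤ ∷ 0ℤ ∷ 0ℤ ∷ 0ℤ ∷ 1ℤ ∷ 0ℤ ∷ []

table₃₀ : Vec ℤ 30
table₃₀ = 1ℤ ∷ -1ℤ ∷ 0ℤ ∷ 0ℤ ∷ 0ℤ ∷ 0ℤ ∷ -1ℤ ∷ 0ℤ ∷ 0ℤ ∷ 0ℤ ∷
          -1ℤ ∷ 0ℤ ∷ 0ℤ ∷ 0ℤ ∷ 0ℤ ∷ -1ℤ ∷ 1ℤ ∷ 0ℤ ∷ 0ℤ ∷ 0ℤ ∷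
          0ℤ ∷ 1ℤ ∷ 0ℤ ∷ 0ℤ ∷ 0ℤ ∷ 1ℤ ∷ 0ℤ ∷ 0ℤ ∷ 0ℤ ∷ 0ℤ ∷ []

primitive₁₂ : ℤ → ℤ
primitive₁₂ = extend (lookup table₁₂)

primitive₃₀ : ℤ → ℤ
primitive₃₀ = extend (lookup table₃₀)

primitive₁₂-periodic : Fixes primitive₁₂ (+ 12)
primitive₁₂-periodic = extend-periodic (lookup table₁₂)

primitive₃₀-periodic : Fixes primitive₃₀ (+ 30)
primitive₃₀-periodic = extend-periodic (lookup table₃₀)

CosRel-periodic : ∀ {n u} .{{_ : ℕ.NonZero n}} → Fixes u (+ n) → ∀ s d c →
  (∀ {j} → j < n → ⟦ cosGap s d c ⟧ u (+ j) ≡ 0ℤ) → CosRel u s d c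
CosRel-periodic {n} {u} hn s d c h = gap⇒CosRel {s = s} {d} {c}
  (mk (periodic-rec (⊑-⟦⟧ (cosGap s d c) u hn) (_≡ 0ℤ) (λ j → h {j})))

primitive₁₂-CosRel : CosRel primitive₁₂ (+ 2) (+ 2) (+ 3)
primitive₁₂-CosRel = CosRel-periodic primitive₁₂-periodic (+ 2) (+ 2) (+ 3)
  (from-yes (ℕₚ.allUpTo? (λ j → ⟦ cosGap (+ 2) (+ 2) (+ 3) ⟧ primitive₁₂ (+ j) ℤ.≟ 0ℤ) 12))

primitive₃₀-CosRel₁ : CosRel primitive₃₀ (+ 3) (+ 5) (+ 6)
primitive₃₀-CosRel₁ = CosRel-periodic primitive₃₀-periodic (+ 3) (+ 5) (+ 6)
  (from-yes (ℕₚ.allUpTo? (λ j → ⟦ cosGap (+ 3) (+ 5) (+ 6) ⟧ primitive₃₀ (+ j) ℤ.≟ 0ℤ) 30))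

primitive₃₀-CosRel₂ : CosRel primitive₃₀ (+ 3) (+ 9) (+ 10)
primitive₃₀-CosRel₂ = CosRel-periodic primitive₃₀-periodic (+ 3) (+ 9) (+ 10)
  (from-yes (ℕₚ.allUpTo? (λ j → ⟦ cosGap (+ 3) (+ 9) (+ 10) ⟧ primitive₃₀ (+ j) ℤ.≟ 0ℤ) 30))

primitive₃₀-CosRel₃ : CosRel primitive₃₀ (+ 5) (+ 9) (+ 12)
primitive₃₀-CosRel₃ = CosRel-periodic primitive₃₀-periodic (+ 5) (+ 9) (+ 12)
  (from-yes (ℕₚ.allUpTo? (λ j → ⟦ cosGap (+ 5) (+ 9) (+ 12) ⟧ primitive₃₀ (+ j) ℤ.≟ 0ℤ) 30))

module _ {m a b c : ℕ}
  (only : ∀ w → Fixes w (+ m) → CosRel w (+ a ℤ.+ + b) (+ a ℤ.- + b) (+ c) → ∀ i → w i ≡ w 0ℤ) where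

  private
    σ δ : ℤ
    σ = + a ℤ.+ + b
    δ = + a ℤ.- + b

  indicator-trivial : ∀ {i} → i ∣ m → CosRel (indicator i) σ δ (+ c) → i ≡ 1
  indicator-trivial {i} i∣m h with i ∣? 1
  ... | yes i∣1 = ∣1⇒≡1 i∣1
  ... | no ¬i∣1 = contradiction
    (trans (sym (indicator-∤ {i} {1ℤ} ¬i∣1))
      (trans (only (indicator i) (indicator-fixes {i} {+ m} i∣m) h 1ℤ) (indicator-∣ {i} {0ℤ} (i ∣0)))) λ ()

  -- For a common divisor `i` the indicator of the multiples of `i` has period `m`; if it solves the
  -- relation it is constant, so i = 1.
  coprime-condition : ∀ x y →
    (∀ {i} → i ∣ ∣ x ∣ → i ∣ ∣ y ∣ → CosRel (indicator i) σ δ (+ c)) → Coprime m (gcdℤ x y)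
  coprime-condition x y h (i∣m , i∣g) = indicator-trivial i∣m
    (h (∣-trans i∣g (gcd[m,n]∣m ∣ x ∣ ∣ y ∣)) (∣-trans i∣g (gcd[m,n]∣n ∣ x ∣ ∣ y ∣)))

  -- `alternating kc` has period `m` because kc < km, and T^c = -1 on it because `c` is an odd
  -- multiple of 2^kc. T^{2a} = -1 means cos a = 0, so the relation holds; but a constant function
  -- negated by a shift vanishes, and this one is 1 at 0.
  two-adic-condition : ∀ {km kc} → IsV2 (+ m) km → IsV2 (+ c) kc → kc < km →
    Anti (alternating kc) (+ 2 ℤ.* + a) ⊎ Anti (alternating kc) (+ 2 ℤ.* + b) → ⊥
  two-adic-condition {km} {kc} vm vc kc<km h = contradiction
    (trans (sym (alternating-0 kc)) (double≡0 (w 0ℤ) twice)) λ ()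
    where
    w = alternating kc
    constant : ∀ i → w i ≡ w 0ℤ
    constant = only w (alternating-fixes kc {+ m} (∣-trans (divides-pow kc<km) (proj₁ vm)))
      (anti⇒CosRel {a = + a} {+ b} {+ c} (anti-TwoPart {n = c} {kc} (alternating-anti kc) (IsV2⇒TwoPart {c} {kc} vc))
        (Sum.map anti-double⇒cos anti-double⇒cos h))
      where
      divides-pow : ∀ {k l} → k < l → 2 ℕ.^ suc k ∣ 2 ℕ.^ l
      divides-pow {k} {l} k<l = divides (2 ℕ.^ (l ℕ.∸ suc k))
        (trans (cong (2 ℕ.^_) (sym (ℕₚ.m∸n+n≡m k<l))) (ℕₚ.^-distribˡ-+-* 2 (l ℕ.∸ suc k) (suc k)))
    twice : w 0ℤ ℤ.+ w 0ℤ ≡ 0ℤ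
    twice = trans (cong (ℤ._+ w 0ℤ) (trans (sym (constant (0ℤ ℤ.+ + (2 ℕ.^ kc)))) (at (alternating-anti kc) 0ℤ)))
      (trans (cong (ℤ._+ w 0ℤ) (ℤₚ.-1*i≡-i (w 0ℤ))) (ℤₚ.+-inverseˡ (w 0ℤ)))

  anti-double : ∀ {k l n} → IsV2 (+ n) l → suc l ≡ k → Anti (alternating k) (+ 2 ℤ.* + n)
  anti-double {k} {l} {n} v refl = subst (Anti (alternating k))
    (trans (cong (λ t → + (n ℕ.+ t)) (sym (ℕₚ.+-identityʳ n))) (ℤₚ.pos-* 2 n))
    (anti-TwoPart {n = n ℕ.+ n} {k} (alternating-anti k) (twoPart-double {n} {l} (IsV2⇒TwoPart {n} {l} v)))

  primitive₁₂-condition : 12 ∣ m → ¬ CosRel primitive₁₂ σ δ (+ c)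
  -- The table has different entries at 1 and at 0, which refutes constancy.
  primitive₁₂-condition 12∣m h = contradiction
    (only primitive₁₂ (∣-fixes {z = + m} primitive₁₂-periodic 12∣m) h 1ℤ) λ ()

  primitive₃₀-condition : 30 ∣ m → ¬ CosRel primitive₃₀ σ δ (+ c)
  primitive₃₀-condition 30∣m h = contradiction
    (only primitive₃₀ (∣-fixes {z = + m} primitive₃₀-periodic 30∣m) h 1ℤ) λ ()

  Forb30⇒CosRel : ∀ {p q r} → CosRel primitive₃₀ (+ p) (+ q) (+ r) → Forb30 σ δ (+ c) p q r →
    CosRel primitive₃₀ σ δ (+ c)
  Forb30⇒CosRel {p} {q} {r} h (inj₁ (ps , pd) , pc) =
    PM⇒CosRel {s = σ} {δ} {+ c} {p} {q} {r} primitive₃₀-periodic h ps pd pc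
  Forb30⇒CosRel {p} {q} {r} h (inj₂ (ps , pd) , pc) =
    PM⇒CosRel {s = σ} {δ} {+ c} {q} {p} {r} primitive₃₀-periodic (cos-swap {s = + p} {+ q} {+ r} h) ps pd pc

  constants⇒conditions : Conditions m a b c
  constants⇒conditions =
      ( coprime-condition δ (σ ℤ.+ + c) (λ {i} x y → fixes⇒CosRel {s = σ} {δ} {+ c}
          (indicator-fixes {i} {δ} x) (fixes-+⇒cos {s = σ} {+ c} (indicator-fixes {i} {σ ℤ.+ + c} y)))
      , coprime-condition δ (σ ℤ.- + c) (λ {i} x y → fixes⇒CosRel {s = σ} {δ} {+ c}
          (indicator-fixes {i} {δ} x) (cos-resp {x = σ} {+ c} (indicator-fixes {i} {σ ℤ.- + c} y)))
      , coprime-condition σ (δ ℤ.+ + c) (λ {i} x y → cos-swap {s = δ} {σ} {+ c} (fixes⇒CosRel {s = δ} {σ} {+ c}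
          (indicator-fixes {i} {σ} x) (fixes-+⇒cos {s = δ} {+ c} (indicator-fixes {i} {δ ℤ.+ + c} y))))
      , coprime-condition σ (δ ℤ.- + c) (λ {i} x y → cos-swap {s = δ} {σ} {+ c} (fixes⇒CosRel {s = δ} {σ} {+ c}
          (indicator-fixes {i} {σ} x) (cos-resp {x = δ} {+ c} (indicator-fixes {i} {δ ℤ.- + c} y)))) )
    , (λ km kc vm vc kc<km ka kb va vb →
          (λ e → two-adic-condition {km} {kc} vm vc kc<km (inj₁ (anti-double {kc} {ka} {a} va e)))
        , (λ e → two-adic-condition {km} {kc} vm vc kc<km (inj₂ (anti-double {kc} {kb} {b} vb e))))
    , (λ 12∣m (ps , pd , pc) → primitive₁₂-condition 12∣m
        (PM⇒CosRel {s = σ} {δ} {+ c} {2} {2} {3} primitive₁₂-periodic primitive₁₂-CosRel ps pd pc))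
    , (λ 30∣m forb → primitive₃₀-condition 30∣m ([ Forb30⇒CosRel {3} {5} {6} primitive₃₀-CosRel₁ ,
        [ Forb30⇒CosRel {3} {9} {10} primitive₃₀-CosRel₂ , Forb30⇒CosRel {5} {9} {12} primitive₃₀-CosRel₃ ] ] forb))

open import Data.Nat using (_*_)

theorem4p1 : (m a b c : ℕ) →
  3 ≤ m → 1 ≤ a → a ≤ b → 2 * b < m → 1 ≤ c → 2 * c ≤ m →
  IsNutB₂ m a b c ⇔
    ( -- (i)
      ( Coprime m (gcdℤ (+ a ℤ.- + b) (+ a ℤ.+ + b ℤ.+ + c))
      × Coprime m (gcdℤ (+ a ℤ.- + b) (+ a ℤ.+ + b ℤ.- + c))
      × Coprime m (gcdℤ (+ a ℤ.+ + b) (+ a ℤ.- + b ℤ.+ + c))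
      × Coprime m (gcdℤ (+ a ℤ.+ + b) (+ a ℤ.- + b ℤ.- + c)) )
    -- (ii)
    × (∀ km kc → IsV2 (+ m) km → IsV2 (+ c) kc → kc < km →
         ∀ ka kb → IsV2 (+ a) ka → IsV2 (+ b) kb →
         suc ka ≢ kc × suc kb ≢ kc)
    -- (iii)
    × (12 ∣ m →
         ¬ (PM 12 (+ a ℤ.+ + b) 2 × PM 12 (+ a ℤ.- + b) 2 × PM 12 (+ c) 3))
    -- (iv)
    × (30 ∣ m →
         ¬ ( Forb30 (+ a ℤ.+ + b) (+ a ℤ.- + b) (+ c) 3 5 6
           ⊎ Forb30 (+ a ℤ.+ + b) (+ a ℤ.- + b) (+ c) 3 9 10
           ⊎ Forb30 (+ a ℤ.+ + b) (+ a ℤ.- + b) (+ c) 5 9 12 )) )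
theorem4p1 m a b c 3≤m 1≤a a≤b 2b<m 1≤c 2c≤m = mk⇔
  (λ nut → constants⇒conditions (nut⇒constants 1≤a a≤b 2b<m 1≤c 2c≤m nut))
  (λ conditions → constants⇒nut 1≤a a≤b 2b<m 1≤c 2c≤m (cosRel-constant conditions))
  where
  instance
    m≢0 : ℕ.NonZero m
    m≢0 = ℕ.>-nonZero (ℕₚ.≤-trans (s≤s z≤n) 3≤m)
    a≢0 : ℕ.NonZero a
    a≢0 = ℕ.>-nonZero 1≤a
    b≢0 : ℕ.NonZero b
    b≢0 = ℕ.>-nonZero (ℕₚ.≤-trans 1≤a a≤b)
    c≢0 : ℕ.NonZero c
    c≢0 = ℕ.>-nonZero 1≤c
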